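{- Let $F$ be a real quadratic field and let $K$ be a quartic CM field, Galois over $\mathbb{Q}$ and containing $F$, with discriminant $\Delta_K$. For a reduced matrix $Z=\begin{pmatrix} z_1 & z_{12} \\ z_{12} & z_2 \end{pmatrix}\in\mathcal{F}_2$ corresponding to a choice of CM triple $(I,\xi,\Phi)$ on $K$, we have $$|z_{12}|\geq \frac{2}{3}\,|\Delta_K|^{ -1/2}.$$
   Context: $\mathbb{H}_2$ is the Siegel upper half space of symmetric $2\times2$ complex matrices with positive definite imaginary part. Its fundamental domain $\mathcal{F}_2$ is the set of $Z=X+iY\in\mathbb{H}_2$, with $X=\begin{pmatrix} x_1 & x_{12} \\ x_{12} & x_2 \end{pmatrix}$, $Y=\begin{pmatrix} y_1 & y_{12} \\ y_{12} & y_2 \end{pmatrix}$ real, such that: (S1) $-\frac12\le x_i<\frac12$ for $i=1,2,12$; (S2) $0\le 2y_{12}\le y_1\le y_2$; (S3) $|\det(CZ+D)|\ge1$ for all $\begin{pmatrix} A & B \\ C & D \end{pmatrix}\in\operatorname{Sp}_4(\mathbb{Z})$. CM triple $(I,\xi,\Phi)$ on $K$: a fractional ideal $I$ of $K$, a CM type $\Phi=(\phi_1,\phi_2)$ of $K$ (embeddings $K\to\mathbb{C}$, one from each pair of complex conjugate embeddings), and a totally imaginary $\xi\in K$ such that $\xi\bar I I=\mathcal{D}_{K/\mathbb{Q}}^{ -1}$ (inverse different) and $\phi_1(\xi),\phi_2(\xi)$ have positive imaginary part. Write $\Phi(x)=(\phi_1(x),\phi_2(x))\in\mathbb{C}^2$.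 The associated Riemann form on $\mathbb{C}^2$ is $E_{\Phi,\xi}(z,w)=\sum_{j=1}^2\phi_j(\xi)(z_j\overline{w_j}-\overline{z_j}w_j)$, so that $E_{\Phi,\xi}(\Phi(x),\Phi(y))=-\operatorname{Tr}_{K/\mathbb{Q}}(\xi\bar x y)$ for $x,y\in K$. A symplectic $\mathbb{Z}$-basis of $I$ is a $\mathbb{Z}$-basis $(e_1,e_2,e_3,e_4)$ with $E_{\Phi,\xi}(\Phi(e_i),\Phi(e_j))=1$ if $j=i+2$, $-1$ if $j=i-2$, and $0$ otherwise. It defines $Z\in\mathbb{H}_2$ by $\Phi(e_3)=z_1\Phi(e_1)+z_{12}\Phi(e_2)$ and $\Phi(e_4)=z_{12}\Phi(e_1)+z_2\Phi(e_2)$. A reduced matrix corresponding to $(I,\xi,\Phi)$ is such a $Z$, for some symplectic basis, that lies in $\mathcal{F}_2$.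
   Formalization: The claim is proved assuming that the CM type Φ is primitive or z₁₂ ≠ 0; without this it fails: for K = ℚ(√5, i), I = 𝒪_K, ξ = i(1+√5)/(4√5) and φ₁(i) = φ₂(i) = i, one gets the reduced matrix Z = i·Id with z₁₂ = 0. -}

module Defs where

open import Algebra.Bundles using (CommutativeRing; RawRing)
open import Algebra.Morphism.Structures using (module RingMorphisms)
import Algebra.Definitions.RawMonoid as RawSum
import Algebra.Definitions.RawSemiring as RawPower
open import Data.Bool.Base using (if_then_else_)
open import Data.Fin.Base using (Fin; toℕ; punchIn; _↑ˡ_; _↑ʳ_)
open import Data.Fin.Patterns using (0F; 1F; 2F; 3F)
open import Data.Integer.Base as ℤ using (ℤ; +_; -[1+_])
import Data.Integer.Properties as ℤₚ
open import Data.Nat.Base as ℕ using (ℕ; zero; suc; z≤n; s≤s)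
open import Data.Nat.Coprimality using (Coprime)
import Data.Nat.DivMod as ℕ
import Data.Nat.Properties as ℕₚ
open import Data.Product.Base using (Σ; ∃; ∃-syntax; _×_; _,_; proj₁; proj₂)
open import Data.Rational.Base as ℚ using (ℚ; mkℚ; 0ℚ; 1ℚ; ½; _/_; *<*; *≤*)
import Data.Rational.Properties as ℚₚ
open import Data.Rational.Solver using (module +-*-Solver)
import Data.Rational.Unnormalised.Base as ℚᵘ
import Data.Rational.Unnormalised.Properties as ℚᵘₚ
open import Data.Sum.Base using (_⊎_; inj₁; inj₂)
open import Data.Unit.Base using (⊤; tt)
open import Data.Vec.Functional using (Vector)
open import Function.Base using (_∘_)
open import Function.Bundles using (Inverse)
open import Level using (0ℓ)
open import Relation.Binary.Bundles using (Setoid)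
open import Relation.Binary.PropositionalEquality using (_≡_; refl; sym; trans; cong; cong₂; subst; subst₂)
import Relation.Binary.PropositionalEquality.Properties as ≡
open import Relation.Nullary using (¬_; yes; no; does; contradiction)

module RationalLemmas where
  open import Data.Rational.Base using (_+_; _-_; _*_; -_; ∣_∣; _<_; _≤_; positive)

  ∣-∣-sym : ∀ p q → ∣ p - q ∣ ≡ ∣ q - p ∣
  ∣-∣-sym p q = trans (sym (ℚₚ.∣-p∣≡∣p∣ (p - q)))
    (cong ∣_∣ (solve 2 (λ p q → :- (p :- q) := q :- p) refl p q))
    where open +-*-Solver

  p≤∣p∣ : ∀ p → p ≤ ∣ p ∣
  p≤∣p∣ p with ℚₚ.≤-total 0ℚ p
  ... | inj₁ 0≤p = ℚₚ.≤-reflexive (sym (ℚₚ.0≤p⇒∣p∣≡p 0≤p))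
  ... | inj₂ p≤0 = ℚₚ.≤-trans p≤0 (ℚₚ.0≤∣p∣ p)

  ∣p∣<r : ∀ {p r} → p < r → - p < r → ∣ p ∣ < r
  ∣p∣<r {p} {r} p<r -p<r with ℚₚ.∣p∣≡p∨∣p∣≡-p p
  ... | inj₁ eq = subst (_< r) (sym eq) p<r
  ... | inj₂ eq = subst (_< r) (sym eq) -p<r

  ½ε+½ε : ∀ ε → ½ * ε + ½ * ε ≡ ε
  ½ε+½ε = solve 1 (λ ε → con ½ :* ε :+ con ½ :* ε := ε) refl
    where open +-*-Solver

  *-pos : ∀ {p q} → 0ℚ < p → 0ℚ < q → 0ℚ < p * q
  *-pos {p} {q} 0<p 0<q = subst (_< p * q) (ℚₚ.*-zeroʳ p)
    (ℚₚ.*-monoʳ-<-pos p {{positive 0<p}} 0<q)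

  ½*-pos : ∀ {ε} → 0ℚ < ε → 0ℚ < ½ * ε
  ½*-pos = *-pos (ℚₚ.positive⁻¹ ½)

open RationalLemmas

-- Real numbers: Cauchy sequences of rationals.  The field operations are
-- termwise; equality is the equivalence _≈_, not _≡_.

IsCauchy : (ℕ → ℚ) → Set
IsCauchy x = ∀ ε → 0ℚ ℚ.< ε →
  ∃[ N ] (∀ m n → N ℕ.≤ m → N ℕ.≤ n → ℚ.∣ x m ℚ.- x n ∣ ℚ.< ε)

record ℝ : Set where
  constructor mkℝ
  field
    seq    : ℕ → ℚ
    cauchy : IsCauchy seq

module Real where
  open ℝ
  open import Data.Rational.Base using (∣_∣)

  infix  4 _≈_ _<_ _≤_
  infix  8 -_
  infixl 7 _*_
  infixl 6 _+_ _-_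

  _≈_ : ℝ → ℝ → Set
  x ≈ y = ∀ ε → 0ℚ ℚ.< ε → ∃[ N ] (∀ n → N ℕ.≤ n → ∣ seq x n ℚ.- seq y n ∣ ℚ.< ε)

  _<_ : ℝ → ℝ → Set
  x < y = ∃[ ε ] (0ℚ ℚ.< ε × ∃[ N ] (∀ n → N ℕ.≤ n → seq x n ℚ.+ ε ℚ.< seq y n))

  _≤_ : ℝ → ℝ → Set
  x ≤ y = ¬ (y < x)

  fromℚ : ℚ → ℝ
  fromℚ q = mkℝ (λ _ → q) λ ε 0<ε → 0 , λ _ _ _ _ →
    subst (ℚ._< ε) (sym (cong ∣_∣ (ℚₚ.+-inverseʳ q))) 0<ε

  fromℤ : ℤ → ℝ
  fromℤ a = fromℚ (a / 1)

  0# 1# : ℝ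
  0# = fromℚ 0ℚ
  1# = fromℚ 1ℚ

  _+_ : ℝ → ℝ → ℝ
  x + y = mkℝ (λ n → seq x n ℚ.+ seq y n) λ ε 0<ε →
    let (N , hN) = cauchy x (½ ℚ.* ε) (½*-pos 0<ε)
        (M , hM) = cauchy y (½ ℚ.* ε) (½*-pos 0<ε)
    in N ℕ.⊔ M , λ m n p q → begin-strict
      ∣ (seq x m ℚ.+ seq y m) ℚ.- (seq x n ℚ.+ seq y n) ∣
        ≡⟨ cong ∣_∣ (solve 4 (λ a b c d → (a :+ b) :- (c :+ d) := (a :- c) :+ (b :- d)) refl
             (seq x m) (seq y m) (seq x n) (seq y n)) ⟩
      ∣ (seq x m ℚ.- seq x n) ℚ.+ (seq y m ℚ.- seq y n) ∣
        ≤⟨ ℚₚ.∣p+q∣≤∣p∣+∣q∣ (seq x m ℚ.- seq x n) (seq y m ℚ.- seq y n) ⟩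
      ∣ seq x m ℚ.- seq x n ∣ ℚ.+ ∣ seq y m ℚ.- seq y n ∣
        <⟨ ℚₚ.+-mono-< (hN m n (ℕₚ.m⊔n≤o⇒m≤o N M p) (ℕₚ.m⊔n≤o⇒m≤o N M q))
                       (hM m n (ℕₚ.m⊔n≤o⇒n≤o N M p) (ℕₚ.m⊔n≤o⇒n≤o N M q)) ⟩
      ½ ℚ.* ε ℚ.+ ½ ℚ.* ε
        ≡⟨ ½ε+½ε ε ⟩
      ε ∎
    where open +-*-Solver
          open ℚₚ.≤-Reasoning

  -_ : ℝ → ℝ
  - x = mkℝ (λ n → ℚ.- seq x n) λ ε 0<ε →
    let (N , hN) = cauchy x ε 0<ε
    in N , λ m n p q → subst (ℚ._< ε)
      (trans (∣-∣-sym (seq x m) (seq x n))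
        (cong ∣_∣ (solve 2 (λ a b → b :- a := (:- a) :- (:- b)) refl (seq x m) (seq x n))))
      (hN m n p q)
    where open +-*-Solver

  _-_ : ℝ → ℝ → ℝ
  x - y = x + (- y)

  bounded : ∀ x → ∃[ B ] (0ℚ ℚ.< B × ∃[ N ] (∀ n → N ℕ.≤ n → ∣ seq x n ∣ ℚ.≤ B))
  bounded x = B , 0<B , N , below
    where
    open ℚₚ.≤-Reasoning
    open +-*-Solver
    N = proj₁ (cauchy x 1ℚ (ℚₚ.positive⁻¹ 1ℚ))
    hN = proj₂ (cauchy x 1ℚ (ℚₚ.positive⁻¹ 1ℚ))
    a = seq x N
    B = ∣ a ∣ ℚ.+ 1ℚ
    0<B : 0ℚ ℚ.< B
    0<B = begin-strict
      0ℚ           <⟨ ℚₚ.positive⁻¹ 1ℚ ⟩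
      0ℚ ℚ.+ 1ℚ    ≤⟨ ℚₚ.+-monoˡ-≤ 1ℚ (ℚₚ.0≤∣p∣ a) ⟩
      B            ∎
    below : ∀ n → N ℕ.≤ n → ∣ seq x n ∣ ℚ.≤ B
    below n N≤n = begin
      ∣ seq x n ∣                        ≡⟨ cong ∣_∣ (solve 2 (λ b a → b := a :+ (b :- a)) refl (seq x n) a) ⟩
      ∣ a ℚ.+ (seq x n ℚ.- a) ∣          ≤⟨ ℚₚ.∣p+q∣≤∣p∣+∣q∣ a (seq x n ℚ.- a) ⟩
      ∣ a ∣ ℚ.+ ∣ seq x n ℚ.- a ∣        ≤⟨ ℚₚ.+-monoʳ-≤ ∣ a ∣ (ℚₚ.<⇒≤ (hN n N N≤n ℕₚ.≤-refl)) ⟩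
      B                                  ∎

  *-cauchy : ∀ x y → IsCauchy (λ n → seq x n ℚ.* seq y n)
  *-cauchy x y ε 0<ε = L , close
    where
    open ℚₚ.≤-Reasoning
    open +-*-Solver
    B = proj₁ (bounded x)
    0<B = proj₁ (proj₂ (bounded x))
    N₁ = proj₁ (proj₂ (proj₂ (bounded x)))
    h₁ = proj₂ (proj₂ (proj₂ (bounded x)))
    C = proj₁ (bounded y)
    0<C = proj₁ (proj₂ (bounded y))
    N₂ = proj₁ (proj₂ (proj₂ (bounded y)))
    h₂ = proj₂ (proj₂ (proj₂ (bounded y)))
    S = B ℚ.+ C
    instance
      S-pos : ℚ.Positive S
      S-pos = ℚₚ.pos+pos⇒pos B {{ℚ.positive 0<B}} C {{ℚ.positive 0<C}}
      S-nonZero : ℚ.NonZero S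
      S-nonZero = ℚₚ.pos⇒nonZero S
    δ = ε ℚ.* (ℚ.1/ S)
    0<δ : 0ℚ ℚ.< δ
    0<δ = *-pos 0<ε (ℚₚ.positive⁻¹ (ℚ.1/ S) {{ℚₚ.1/pos⇒pos S}})
    N₃ = proj₁ (cauchy x δ 0<δ)
    h₃ = proj₂ (cauchy x δ 0<δ)
    N₄ = proj₁ (cauchy y δ 0<δ)
    h₄ = proj₂ (cauchy y δ 0<δ)
    L = (N₁ ℕ.⊔ N₂) ℕ.⊔ (N₃ ℕ.⊔ N₄)
    ≥₁ : ∀ {n} → L ℕ.≤ n → N₁ ℕ.≤ n
    ≥₁ p = ℕₚ.m⊔n≤o⇒m≤o N₁ N₂ (ℕₚ.m⊔n≤o⇒m≤o (N₁ ℕ.⊔ N₂) (N₃ ℕ.⊔ N₄) p)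
    ≥₂ : ∀ {n} → L ℕ.≤ n → N₂ ℕ.≤ n
    ≥₂ p = ℕₚ.m⊔n≤o⇒n≤o N₁ N₂ (ℕₚ.m⊔n≤o⇒m≤o (N₁ ℕ.⊔ N₂) (N₃ ℕ.⊔ N₄) p)
    ≥₃ : ∀ {n} → L ℕ.≤ n → N₃ ℕ.≤ n
    ≥₃ p = ℕₚ.m⊔n≤o⇒m≤o N₃ N₄ (ℕₚ.m⊔n≤o⇒n≤o (N₁ ℕ.⊔ N₂) (N₃ ℕ.⊔ N₄) p)
    ≥₄ : ∀ {n} → L ℕ.≤ n → N₄ ℕ.≤ n
    ≥₄ p = ℕₚ.m⊔n≤o⇒n≤o N₃ N₄ (ℕₚ.m⊔n≤o⇒n≤o (N₁ ℕ.⊔ N₂) (N₃ ℕ.⊔ N₄) p)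
    bound : ∀ {a b c} → ∣ a ∣ ℚ.≤ c → 0ℚ ℚ.< c → ∣ b ∣ ℚ.< δ → ∣ a ℚ.* b ∣ ℚ.< c ℚ.* δ
    bound {a} {b} {c} a≤c 0<c b<δ = begin-strict
      ∣ a ℚ.* b ∣        ≡⟨ ℚₚ.∣p*q∣≡∣p∣*∣q∣ a b ⟩
      ∣ a ∣ ℚ.* ∣ b ∣    ≤⟨ ℚₚ.*-monoʳ-≤-nonNeg ∣ b ∣ {{ℚₚ.∣-∣-nonNeg b}} a≤c ⟩
      c ℚ.* ∣ b ∣        <⟨ ℚₚ.*-monoʳ-<-pos c {{ℚ.positive 0<c}} b<δ ⟩
      c ℚ.* δ            ∎
    close : ∀ m n → L ℕ.≤ m → L ℕ.≤ n → ∣ seq x m ℚ.* seq y m ℚ.- seq x n ℚ.* seq y n ∣ ℚ.< ε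
    close m n p q = begin-strict
      ∣ seq x m ℚ.* seq y m ℚ.- seq x n ℚ.* seq y n ∣
        ≡⟨ cong ∣_∣ (solve 4 (λ a b c d → a :* b :- c :* d := a :* (b :- d) :+ d :* (a :- c)) refl
             (seq x m) (seq y m) (seq x n) (seq y n)) ⟩
      ∣ seq x m ℚ.* (seq y m ℚ.- seq y n) ℚ.+ seq y n ℚ.* (seq x m ℚ.- seq x n) ∣
        ≤⟨ ℚₚ.∣p+q∣≤∣p∣+∣q∣ (seq x m ℚ.* (seq y m ℚ.- seq y n)) (seq y n ℚ.* (seq x m ℚ.- seq x n)) ⟩
      ∣ seq x m ℚ.* (seq y m ℚ.- seq y n) ∣ ℚ.+ ∣ seq y n ℚ.* (seq x m ℚ.- seq x n) ∣
        <⟨ ℚₚ.+-mono-<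
             (bound {seq x m} {seq y m ℚ.- seq y n} (h₁ m (≥₁ p)) 0<B (h₄ m n (≥₄ p) (≥₄ q)))
             (bound {seq y n} {seq x m ℚ.- seq x n} (h₂ n (≥₂ q)) 0<C (h₃ m n (≥₃ p) (≥₃ q))) ⟩
      B ℚ.* δ ℚ.+ C ℚ.* δ
        ≡⟨ solve 4 (λ B C ε i → B :* (ε :* i) :+ C :* (ε :* i) := ε :* ((B :+ C) :* i)) refl B C ε (ℚ.1/ S) ⟩
      ε ℚ.* (S ℚ.* ℚ.1/ S)
        ≡⟨ cong (ε ℚ.*_) (ℚₚ.*-inverseʳ S) ⟩
      ε ℚ.* 1ℚ
        ≡⟨ ℚₚ.*-identityʳ ε ⟩
      ε ∎

  _*_ : ℝ → ℝ → ℝ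
  x * y = mkℝ (λ n → seq x n ℚ.* seq y n) (*-cauchy x y)

  ⌊√_⌋ : ℕ → ℕ
  ⌊√ zero ⌋  = zero
  ⌊√ suc n ⌋ with suc ⌊√ n ⌋ ℕ.* suc ⌊√ n ⌋ ℕₚ.≤? suc n
  ... | yes _ = suc ⌊√ n ⌋
  ... | no  _ = ⌊√ n ⌋

  ⌊√⌋-lower : ∀ n → ⌊√ n ⌋ ℕ.* ⌊√ n ⌋ ℕ.≤ n
  ⌊√⌋-lower zero = z≤n
  ⌊√⌋-lower (suc n) with suc ⌊√ n ⌋ ℕ.* suc ⌊√ n ⌋ ℕₚ.≤? suc n
  ... | yes p = p
  ... | no  _ = ℕₚ.m≤n⇒m≤1+n (⌊√⌋-lower n)

  ⌊√⌋-upper : ∀ n → n ℕ.< suc ⌊√ n ⌋ ℕ.* suc ⌊√ n ⌋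
  ⌊√⌋-upper zero = s≤s z≤n
  ⌊√⌋-upper (suc n) with suc ⌊√ n ⌋ ℕ.* suc ⌊√ n ⌋ ℕₚ.≤? suc n
  ... | yes _ = ℕₚ.≤-<-trans (⌊√⌋-upper n)
                  (ℕₚ.*-mono-< {suc ⌊√ n ⌋} {suc (suc ⌊√ n ⌋)} ℕₚ.≤-refl ℕₚ.≤-refl)
  ... | no ¬p = ℕₚ.≰⇒> ¬p

  -- ⌊k √q⌋ / k with k = suc n, and 0 for negative q
  ℚ-√ : ℕ → ℚ → ℚ
  ℚ-√ n (mkℚ (+ a) d _)    = + ⌊√ (a ℕ.* (suc n ℕ.* suc n)) ℕ./ suc d ⌋ / suc n
  ℚ-√ n (mkℚ -[1+ _ ] _ _) = 0ℚ

  1/[1+_] : ℕ → ℚ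
  1/[1+ n ] = + 1 / suc n

  module ℚ-√-Lemmas where
    open ℚₚ.≤-Reasoning
    open +-*-Solver

    toℚᵘ-square : ∀ r n →
      ℚ.toℚᵘ ((+ r / suc n) ℚ.* (+ r / suc n)) ℚᵘ.≃ ℚᵘ.mkℚᵘ (+ r) n ℚᵘ.* ℚᵘ.mkℚᵘ (+ r) n
    toℚᵘ-square r n = ℚᵘₚ.≃-trans (ℚₚ.toℚᵘ-homo-* (+ r / suc n) (+ r / suc n))
      (ℚᵘₚ.*-cong (ℚₚ.toℚᵘ-fromℚᵘ (ℚᵘ.mkℚᵘ (+ r) n)) (ℚₚ.toℚᵘ-fromℚᵘ (ℚᵘ.mkℚᵘ (+ r) n)))

    lhs≡ : ∀ r d → + (r ℕ.* r ℕ.* suc d) ≡ (+ r ℤ.* + r) ℤ.* + suc d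
    lhs≡ r d = trans (ℤₚ.pos-* (r ℕ.* r) (suc d)) (cong (ℤ._* + suc d) (ℤₚ.pos-* r r))

    square-≤ : ∀ r n a d .(c : Coprime a (suc d)) → r ℕ.* r ℕ.* suc d ℕ.≤ a ℕ.* (suc n ℕ.* suc n) →
      (+ r / suc n) ℚ.* (+ r / suc n) ℚ.≤ mkℚ (+ a) d c
    square-≤ r n a d c h = ℚₚ.toℚᵘ-cancel-≤ (ℚᵘₚ.≤-respˡ-≃ (ℚᵘₚ.≃-sym (toℚᵘ-square r n))
      (ℚᵘ.*≤* (subst₂ ℤ._≤_ (lhs≡ r d) (ℤₚ.pos-* a (suc n ℕ.* suc n)) (ℤ.+≤+ h))))

    square-> : ∀ r n a d .(c : Coprime a (suc d)) → a ℕ.* (suc n ℕ.* suc n) ℕ.< r ℕ.* r ℕ.* suc d →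
      mkℚ (+ a) d c ℚ.< (+ r / suc n) ℚ.* (+ r / suc n)
    square-> r n a d c h = ℚₚ.toℚᵘ-cancel-< (ℚᵘₚ.<-respʳ-≃ (ℚᵘₚ.≃-sym (toℚᵘ-square r n))
      (ℚᵘ.*<* (subst₂ ℤ._<_ (ℤₚ.pos-* a (suc n ℕ.* suc n)) (lhs≡ r d) (ℤ.+<+ h))))

    suc-/ : ∀ r n → + suc r / suc n ≡ (+ r / suc n) ℚ.+ 1/[1+ n ]
    suc-/ r n = ℚₚ.toℚᵘ-injective (ℚᵘₚ.≃-trans (ℚₚ.toℚᵘ-fromℚᵘ (ℚᵘ.mkℚᵘ (+ suc r) n))
      (ℚᵘₚ.≃-trans (ℚᵘ.*≡* eq) (ℚᵘₚ.≃-sym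
      (ℚᵘₚ.≃-trans (ℚₚ.toℚᵘ-homo-+ (+ r / suc n) 1/[1+ n ])
        (ℚᵘₚ.+-cong (ℚₚ.toℚᵘ-fromℚᵘ (ℚᵘ.mkℚᵘ (+ r) n)) (ℚₚ.toℚᵘ-fromℚᵘ (ℚᵘ.mkℚᵘ (+ 1) n)))))))
      where
      k = + suc n
      eq : + suc r ℤ.* + (suc n ℕ.* suc n) ≡ (+ r ℤ.* k ℤ.+ + 1 ℤ.* k) ℤ.* k
      eq = trans (cong (+ suc r ℤ.*_) (ℤₚ.pos-* (suc n) (suc n)))
        (trans (sym (ℤₚ.*-assoc (+ suc r) k k))
          (cong (ℤ._* k) (trans (cong (ℤ._* k) (ℤₚ.+-comm (+ 1) (+ r))) (ℤₚ.*-distribʳ-+ k (+ r) (+ 1)))))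

    0≤ : ∀ n q → 0ℚ ℚ.≤ ℚ-√ n q
    0≤ n (mkℚ (+ a) d _)    = ℚₚ.nonNegative⁻¹ _
      {{ℚₚ.normalize-nonNeg ⌊√ (a ℕ.* (suc n ℕ.* suc n)) ℕ./ suc d ⌋ (suc n)}}
    0≤ n (mkℚ -[1+ _ ] _ _) = ℚₚ.≤-refl

    0<1/[1+_] : ∀ n → 0ℚ ℚ.< 1/[1+ n ]
    0<1/[1+ n ] = ℚₚ.positive⁻¹ 1/[1+ n ] {{ℚₚ.normalize-pos 1 (suc n)}}

    lower : ∀ n q → ℚ-√ n q ≡ 0ℚ ⊎ ℚ-√ n q ℚ.* ℚ-√ n q ℚ.≤ q
    lower n (mkℚ -[1+ _ ] _ _) = inj₁ refl
    lower n (mkℚ (+ a) d c)    = inj₂ (square-≤ ⌊√ A ℕ./ suc d ⌋ n a d c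
      (ℕₚ.≤-trans (ℕₚ.*-monoˡ-≤ (suc d) (⌊√⌋-lower (A ℕ./ suc d))) (ℕ.m/n*n≤m A (suc d))))
      where A = a ℕ.* (suc n ℕ.* suc n)

    upper : ∀ n q → q ℚ.< (ℚ-√ n q ℚ.+ 1/[1+ n ]) ℚ.* (ℚ-√ n q ℚ.+ 1/[1+ n ])
    upper n q@(mkℚ -[1+ _ ] _ _) = ℚₚ.<-trans (ℚₚ.negative⁻¹ q)
      (*-pos 0<s 0<s)
      where
      0<s : 0ℚ ℚ.< 0ℚ ℚ.+ 1/[1+ n ]
      0<s = subst (0ℚ ℚ.<_) (sym (ℚₚ.+-identityˡ 1/[1+ n ])) 0<1/[1+ n ]
    upper n (mkℚ (+ a) d c) = subst (λ t → mkℚ (+ a) d c ℚ.< t ℚ.* t) (suc-/ r n)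
      (square-> (suc r) n a d c (ℕₚ.<-≤-trans A<
        (ℕₚ.*-monoˡ-≤ (suc d) (⌊√⌋-upper (A ℕ./ suc d)))))
      where
      A = a ℕ.* (suc n ℕ.* suc n)
      r = ⌊√ A ℕ./ suc d ⌋
      A< : A ℕ.< suc (A ℕ./ suc d) ℕ.* suc d
      A< = subst (ℕ._< suc (A ℕ./ suc d) ℕ.* suc d) (sym (ℕ.m≡m%n+[m/n]*n A (suc d)))
        (ℕₚ.+-monoˡ-< (A ℕ./ suc d ℕ.* suc d) (ℕ.m%n<n A (suc d)))

    gap : ∀ m n p q {η} → 0ℚ ℚ.< η → ∣ p ℚ.- q ∣ ℚ.< η ℚ.* η →
      ℚ-√ m p ℚ.< ℚ-√ n q ℚ.+ 1/[1+ n ] ℚ.+ η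
    gap m n p q {η} 0<η close with lower m p
    ... | inj₁ s≡0 = begin-strict
      ℚ-√ m p             ≡⟨ s≡0 ⟩
      0ℚ ℚ.+ 0ℚ ℚ.+ 0ℚ    <⟨ ℚₚ.+-mono-≤-< (ℚₚ.+-mono-≤ (0≤ n q) (ℚₚ.<⇒≤ 0<1/[1+ n ])) 0<η ⟩
      ℚ-√ n q ℚ.+ 1/[1+ n ] ℚ.+ η ∎
    ... | inj₂ s²≤p with ℚ-√ m p ℚₚ.<? ℚ-√ n q ℚ.+ 1/[1+ n ] ℚ.+ η
    ...   | yes s<u = s<u
    ...   | no  s≮u = contradiction (ℚₚ.<-≤-trans close η²≤) (ℚₚ.<-irrefl refl)
      where
      s = ℚ-√ m p
      t = ℚ-√ n q ℚ.+ 1/[1+ n ]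
      u = t ℚ.+ η
      u≤s = ℚₚ.≮⇒≥ s≮u
      0≤t : 0ℚ ℚ.≤ t
      0≤t = ℚₚ.+-mono-≤ (0≤ n q) (ℚₚ.<⇒≤ 0<1/[1+ n ])
      0≤u : 0ℚ ℚ.≤ u
      0≤u = ℚₚ.+-mono-≤ 0≤t (ℚₚ.<⇒≤ 0<η)
      0≤tη : 0ℚ ℚ.≤ t ℚ.* η
      0≤tη = ℚₚ.nonNegative⁻¹ (t ℚ.* η)
        {{ℚₚ.nonNeg*nonNeg⇒nonNeg t {{ℚ.nonNegative 0≤t}} η {{ℚ.nonNegative (ℚₚ.<⇒≤ 0<η)}}}}
      η²≤ : η ℚ.* η ℚ.≤ ∣ p ℚ.- q ∣
      η²≤ = begin
        η ℚ.* η
          ≡⟨ solve 2 (λ t η → η :* η := η :* η :+ con 0ℚ :+ con 0ℚ) refl t η ⟩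
        η ℚ.* η ℚ.+ 0ℚ ℚ.+ 0ℚ
          ≤⟨ ℚₚ.+-mono-≤ (ℚₚ.+-monoʳ-≤ (η ℚ.* η) 0≤tη) 0≤tη ⟩
        η ℚ.* η ℚ.+ t ℚ.* η ℚ.+ t ℚ.* η
          ≡⟨ solve 2 (λ t η → η :* η :+ t :* η :+ t :* η := (t :+ η) :* (t :+ η) :- t :* t) refl t η ⟩
        u ℚ.* u ℚ.- t ℚ.* t
          ≤⟨ ℚₚ.+-mono-≤
               (ℚₚ.≤-trans (ℚₚ.*-monoʳ-≤-nonNeg u {{ℚ.nonNegative 0≤u}} u≤s)
                 (ℚₚ.≤-trans (ℚₚ.*-monoˡ-≤-nonNeg s {{ℚ.nonNegative (0≤ m p)}} u≤s) s²≤p))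
               (ℚₚ.neg-antimono-≤ (ℚₚ.<⇒≤ (upper n q))) ⟩
        p ℚ.- q
          ≤⟨ p≤∣p∣ (p ℚ.- q) ⟩
        ∣ p ℚ.- q ∣ ∎

    1/[1+]-antitone : ∀ {m n} → m ℕ.≤ n → 1/[1+ n ] ℚ.≤ 1/[1+ m ]
    1/[1+]-antitone {m} {n} m≤n = ℚₚ.toℚᵘ-cancel-≤
      (ℚᵘₚ.≤-respˡ-≃ (ℚᵘₚ.≃-sym (ℚₚ.toℚᵘ-fromℚᵘ (ℚᵘ.mkℚᵘ (+ 1) n)))
      (ℚᵘₚ.≤-respʳ-≃ (ℚᵘₚ.≃-sym (ℚₚ.toℚᵘ-fromℚᵘ (ℚᵘ.mkℚᵘ (+ 1) m)))
        (ℚᵘ.*≤* (ℤ.+≤+ (ℕₚ.*-monoʳ-≤ 1 (s≤s m≤n))))))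

    archimedean : ∀ ε → 0ℚ ℚ.< ε → ∃[ n ] 1/[1+ n ] ℚ.≤ ε
    archimedean (mkℚ (+ suc a) d c) _ = d , ℚₚ.toℚᵘ-cancel-≤
      (ℚᵘₚ.≤-respˡ-≃ (ℚᵘₚ.≃-sym (ℚₚ.toℚᵘ-fromℚᵘ (ℚᵘ.mkℚᵘ (+ 1) d)))
        (ℚᵘ.*≤* (ℤ.+≤+ (ℕₚ.*-monoˡ-≤ (suc d) (s≤s (z≤n {a}))))))
    archimedean (mkℚ (+ zero) d c) 0<ε = contradiction (ℚₚ.drop-*<* 0<ε) λ { (ℤ.+<+ ()) }
    archimedean (mkℚ -[1+ a ] d c) 0<ε = contradiction (ℚₚ.drop-*<* 0<ε) λ ()

    cauchy-√ : ∀ x → IsCauchy (λ n → ℚ-√ n (seq x n))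
    cauchy-√ x ε 0<ε = M ℕ.⊔ N , close
      where
      η = ½ ℚ.* ε
      0<η = ½*-pos 0<ε
      M = proj₁ (archimedean η 0<η)
      N = proj₁ (cauchy x (η ℚ.* η) (*-pos 0<η 0<η))
      hN = proj₂ (cauchy x (η ℚ.* η) (*-pos 0<η 0<η))
      s : ℕ → ℚ
      s n = ℚ-√ n (seq x n)
      half : ∀ m n → M ℕ.⊔ N ℕ.≤ m → M ℕ.⊔ N ℕ.≤ n → s m ℚ.- s n ℚ.< ε
      half m n p q = begin-strict
        s m ℚ.- s n
          <⟨ ℚₚ.+-monoˡ-< (ℚ.- s n) (gap m n (seq x m) (seq x n) 0<η
               (hN m n (ℕₚ.m⊔n≤o⇒n≤o M N p) (ℕₚ.m⊔n≤o⇒n≤o M N q))) ⟩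
        s n ℚ.+ 1/[1+ n ] ℚ.+ η ℚ.- s n
          ≡⟨ solve 3 (λ s d η → s :+ d :+ η :- s := d :+ η) refl (s n) 1/[1+ n ] η ⟩
        1/[1+ n ] ℚ.+ η
          ≤⟨ ℚₚ.+-monoˡ-≤ η (ℚₚ.≤-trans (1/[1+]-antitone (ℕₚ.m⊔n≤o⇒m≤o M N q)) (proj₂ (archimedean η 0<η))) ⟩
        η ℚ.+ η
          ≡⟨ ½ε+½ε ε ⟩
        ε ∎
      close : ∀ m n → M ℕ.⊔ N ℕ.≤ m → M ℕ.⊔ N ℕ.≤ n → ∣ s m ℚ.- s n ∣ ℚ.< ε
      close m n p q = ∣p∣<r (half m n p q)
        (subst (ℚ._< ε) (solve 2 (λ a b → b :- a := :- (a :- b)) refl (s m) (s n)) (half n m q p))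

  -- the nonnegative square root of x, for x ≥ 0; 0 for x < 0
  √ : ℝ → ℝ
  √ x = mkℝ (λ n → ℚ-√ n (seq x n)) (ℚ-√-Lemmas.cauchy-√ x)

  -- n ^-½ is 1/√n; the value at 0 is a dummy
  _^-½ : ℕ → ℝ
  zero  ^-½ = 0#
  suc n ^-½ = √ (fromℚ 1/[1+ n ])

open Real public using (_^-½)

ℝ-rawRing : RawRing 0ℓ 0ℓ
ℝ-rawRing = record { Real }

record ℂ : Set where
  constructor _+i_
  field
    re im : ℝ

open ℂ public

module Complex where
  infix  4 _≈_
  infix  8 -_
  infixl 7 _*_
  infixl 6 _+_ _-_

  _≈_ : ℂ → ℂ → Set
  z ≈ w = re z Real.≈ re w × im z Real.≈ im w

  0# 1# : ℂ
  0# = Real.0# +i Real.0#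
  1# = Real.1# +i Real.0#

  _+_ _*_ : ℂ → ℂ → ℂ
  z + w = (re z Real.+ re w) +i (im z Real.+ im w)
  z * w = (re z Real.* re w Real.- im z Real.* im w) +i (re z Real.* im w Real.+ im z Real.* re w)

  -_ : ℂ → ℂ
  - z = (Real.- re z) +i (Real.- im z)

  _-_ : ℂ → ℂ → ℂ
  z - w = z + (- w)

  conj : ℂ → ℂ
  conj z = re z +i (Real.- im z)

  ∣_∣ : ℂ → ℝ
  ∣ z ∣ = Real.√ (re z Real.* re z Real.+ im z Real.* im z)

  fromℤ : ℤ → ℂ
  fromℤ a = Real.fromℤ a +i Real.0#

ℂ-rawRing : RawRing 0ℓ 0ℓ
ℂ-rawRing = record { Complex }

Matrix : Set → ℕ → ℕ → Set
Matrix A m n = Fin m → Fin n → A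

module LinearAlgebra (R : RawRing 0ℓ 0ℓ) where
  open RawRing R
  open RawSum +-rawMonoid public using (sum)
  open RawPower rawSemiring public using (_^_)

  infixl 7 _⊗_
  infixl 6 _⊕_

  _⊕_ : ∀ {m n} → Matrix Carrier m n → Matrix Carrier m n → Matrix Carrier m n
  (M ⊕ N) i j = M i j + N i j

  _⊗_ : ∀ {l m n} → Matrix Carrier l m → Matrix Carrier m n → Matrix Carrier l n
  (M ⊗ N) i j = sum (λ k → M i k * N k j)

  _ᵀ : ∀ {m n} → Matrix Carrier m n → Matrix Carrier n m
  (M ᵀ) i j = M j i

  det : ∀ {n} → Matrix Carrier n n → Carrier
  det {zero}  M = 1#
  det {suc n} M = sum λ j → (- 1#) ^ toℕ j * (M 0F j * det (λ i k → M (Fin.suc i) (punchIn j k)))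

-- The symplectic form of ℤ⁴ in a standard basis: J e₁ e₃ = J e₂ e₄ = 1.
J : Matrix ℤ 4 4
J i j = if does (toℕ j ℕₚ.≟ toℕ i ℕ.+ 2) then + 1
        else if does (toℕ i ℕₚ.≟ toℕ j ℕ.+ 2) then -[1+ 0 ]
        else + 0

module _ where
  open LinearAlgebra ℤ.+-*-rawRing

  IsSymplectic : Matrix ℤ 4 4 → Set
  IsSymplectic M = ∀ i j → (M ᵀ ⊗ J ⊗ M) i j ≡ J i j

lowerLeft lowerRight : Matrix ℤ 4 4 → Matrix ℤ 2 2
lowerLeft  M i j = M (2 ↑ʳ i) (j ↑ˡ 2)
lowerRight M i j = M (2 ↑ʳ i) (2 ↑ʳ j)

record Sym₂ℂ : Set where
  field
    z₁ z₁₂ z₂ : ℂ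

  toMatrix : Matrix ℂ 2 2
  toMatrix 0F 0F = z₁
  toMatrix 0F 1F = z₁₂
  toMatrix 1F 0F = z₁₂
  toMatrix 1F 1F = z₂

  x₁ x₁₂ x₂ y₁ y₁₂ y₂ : ℝ
  x₁ = re z₁
  x₁₂ = re z₁₂
  x₂ = re z₂
  y₁ = im z₁
  y₁₂ = im z₁₂
  y₂ = im z₂

module _ (Z : Sym₂ℂ) where
  open Sym₂ℂ Z
  open Real
  open LinearAlgebra ℂ-rawRing using (_⊕_; _⊗_; det)

  -- Z ∈ ℍ₂; apartness from 0 is the constructive form of (u , v) ≠ 0.
  InSiegelHalfSpace : Set
  InSiegelHalfSpace = ∀ u v → (u < 0# ⊎ 0# < u) ⊎ (v < 0# ⊎ 0# < v) →
    0# < y₁ * (u * u) + fromℤ (+ 2) * (y₁₂ * (u * v)) + y₂ * (v * v)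

  record InFundamentalDomain : Set where
    field
      siegel : InSiegelHalfSpace
      S1 : ∀ x → (x ≡ x₁ ⊎ x ≡ x₂ ⊎ x ≡ x₁₂) → fromℚ (ℚ.- ½) ≤ x × x < fromℚ ½
      S2 : 0# ≤ fromℤ (+ 2) * y₁₂ × fromℤ (+ 2) * y₁₂ ≤ y₁ × y₁ ≤ y₂
      S3 : ∀ M → IsSymplectic M →
           let C = λ i j → Complex.fromℤ (lowerLeft M i j)
               D = λ i j → Complex.fromℤ (lowerRight M i j)
           in 1# ≤ Complex.∣ det (C ⊗ toMatrix ⊕ D) ∣

open RingMorphisms using (IsRingHomomorphism; IsRingIsomorphism)

-- b is a basis over k of the k-submodule P of K, where k acts through f.
IsBasis : (k K : RawRing 0ℓ 0ℓ) → (RawRing.Carrier k → RawRing.Carrier K) →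
          (RawRing.Carrier K → Set) → ∀ {n} → Vector (RawRing.Carrier K) n → Set
IsBasis k K f P {n} b =
  (∀ i → P (b i)) ×
  (∀ x → P x → Σ (Vector k.Carrier n) λ c →
     x K.≈ combination c × (∀ c′ → x K.≈ combination c′ → ∀ i → c i k.≈ c′ i))
  where
  module k = RawRing k
  module K = RawRing K
  combination : Vector k.Carrier n → K.Carrier
  combination c = LinearAlgebra.sum K λ i → f (c i) K.* b i

record NumberField (n : ℕ) : Set₁ where
  field
    commutativeRing : CommutativeRing 0ℓ 0ℓ

  open CommutativeRing commutativeRing public

  field
    1≉0     : ¬ (1# ≈ 0#)
    inverse : ∀ x → ¬ (x ≈ 0#) → ∃[ y ] x * y ≈ 1#
    fromℚ   : ℚ → Carrier
    fromℚ-isRingHomomorphism : IsRingHomomorphism ℚ.+-*-rawRing rawRing fromℚ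
    basis   : Vector Carrier n
    isBasis : IsBasis ℚ.+-*-rawRing rawRing fromℚ (λ _ → ⊤) basis

  open LinearAlgebra rawRing public using (sum; _^_)

  fromℤ : ℤ → Carrier
  fromℤ a = fromℚ (a / 1)

  coordinates : Carrier → Vector ℚ n
  coordinates x = proj₁ (proj₂ isBasis x tt)

  -- Tr x is the trace of the ℚ-linear map y ↦ x * y.
  Tr : Carrier → ℚ
  Tr x = LinearAlgebra.sum ℚ.+-*-rawRing λ i → coordinates (x * basis i) i

  IsInteger : Carrier → Set
  IsInteger x = Σ ℕ λ m → Σ (Vector ℤ m) λ c → x ^ m + sum (λ i → fromℤ (c i) * x ^ toℕ i) ≈ 0#

  IsDiscriminant : ℤ → Set
  IsDiscriminant Δ = Σ (Vector Carrier n) λ ω →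
    IsBasis ℤ.+-*-rawRing rawRing fromℤ IsInteger ω ×
    LinearAlgebra.det ℚ.+-*-rawRing (λ i j → Tr (ω i * ω j)) ≡ Δ / 1

  _∈𝒟⁻¹ : Carrier → Set
  x ∈𝒟⁻¹ = ∀ y → IsInteger y → ∃[ a ] Tr (x * y) ≡ a / 1

  record FractionalIdeal : Set₁ where
    field
      _∈I         : Carrier → Set
      ∈-resp-≈    : ∀ {x y} → x ≈ y → x ∈I → y ∈I
      0∈          : 0# ∈I
      +-closed    : ∀ {x y} → x ∈I → y ∈I → (x + y) ∈I
      *-closed    : ∀ {a x} → IsInteger a → x ∈I → (a * x) ∈I
      nonzero     : ∃[ x ] x ∈I × ¬ (x ≈ 0#)
      denominator : ∃[ d ] IsInteger d × ¬ (d ≈ 0#) × (∀ {x} → x ∈I → IsInteger (d * x))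

  record Automorphism : Set where
    field
      map : Carrier → Carrier
      isRingIsomorphism : IsRingIsomorphism rawRing rawRing map

  -- Field automorphisms fix ℚ automatically.
  automorphisms : Setoid 0ℓ 0ℓ
  automorphisms = record
    { Carrier = Automorphism
    ; _≈_ = λ σ τ → ∀ x → Automorphism.map σ x ≈ Automorphism.map τ x
    ; isEquivalence = record
      { refl  = λ x → CommutativeRing.refl commutativeRing
      ; sym   = λ σ≈τ x → CommutativeRing.sym commutativeRing (σ≈τ x)
      ; trans = λ σ≈τ τ≈υ x → CommutativeRing.trans commutativeRing (σ≈τ x) (τ≈υ x)
      }
    }

  -- Galois over ℚ: as many automorphisms as the degree.
  IsGalois : Set
  IsGalois = Inverse (≡.setoid (Fin n)) automorphisms

record FieldHom {m n} (F : NumberField m) (K : NumberField n) : Set where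
  private
    module F = NumberField F
    module K = NumberField K
  field
    map : F.Carrier → K.Carrier
    isRingHomomorphism : IsRingHomomorphism F.rawRing K.rawRing map

record Embedding {n} (K : NumberField n) : Set where
  private module K = NumberField K
  field
    map : K.Carrier → ℂ
    isRingHomomorphism : IsRingHomomorphism K.rawRing ℂ-rawRing map

TotallyReal TotallyImaginary : ∀ {n} → NumberField n → Set
TotallyReal      K = (ψ : Embedding K) → ∀ x → im (Embedding.map ψ x) Real.≈ Real.0#
TotallyImaginary K = (ψ : Embedding K) → ¬ (∀ x → im (Embedding.map ψ x) Real.≈ Real.0#)

record CMField (n : ℕ) : Set₁ where
  field
    numberField : NumberField n

  open NumberField numberField public

  field
    {halfDegree}      : ℕ
    realSubfield      : NumberField halfDegree
    realSubfield-real : TotallyReal realSubfield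
    inclusion         : FieldHom realSubfield numberField
    relativeBasis     : Vector Carrier 2
    isRelativeBasis   : IsBasis (NumberField.rawRing realSubfield) rawRing (FieldHom.map inclusion)
                          (λ _ → ⊤) relativeBasis
    totallyImaginary  : TotallyImaginary numberField

    -- The complex conjugation of K: for a CM field it exists and is unique.
    bar      : Carrier → Carrier
    bar-conj : (ψ : Embedding numberField) → ∀ x →
               Embedding.map ψ (bar x) Complex.≈ Complex.conj (Embedding.map ψ x)

module _ (K : CMField 4) where
  open CMField K

  -- One embedding from each pair of complex conjugate embeddings.
  record CMType : Set where
    field
      φ : Fin 2 → Embedding numberField

    infixr 9 _$_
    _$_ : Fin 2 → Carrier → ℂ
    j $ x = Embedding.map (φ j) x

    field
      covers   : (ψ : Embedding numberField) → ∃[ j ]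
                 ((∀ x → Embedding.map ψ x Complex.≈ j $ x) ⊎
                  (∀ x → Embedding.map ψ x Complex.≈ Complex.conj (j $ x)))
      distinct : ¬ (∀ x → 0F $ x Complex.≈ 1F $ x)
      disjoint : ∀ i j → ¬ (∀ x → i $ x Complex.≈ Complex.conj (j $ x))

    Φ : Carrier → Vector ℂ 2
    Φ x j = j $ x

  -- A proper CM subfield of a quartic field is imaginary quadratic, and Φ is
  -- induced from it iff φ₁ and φ₂ agree on it.  For Φ not primitive a reduced
  -- matrix can have z₁₂ = 0: on K = ℚ(√5, i), with φ₁(i) = φ₂(i) = i, I = 𝒪_K
  -- and ξ = i (1 + √5) / (4√5), the symplectic basis (a, b, i a, i b) with a = 1,
  -- b = (√5 − 1) / 2 has Z = i times the identity.
  IsPrimitive : CMType → Set₁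
  IsPrimitive Φ = ¬ (Σ (NumberField 2) λ k → TotallyImaginary k × Σ (FieldHom k numberField) λ h →
    ∀ x → CMType.Φ Φ (FieldHom.map h x) 0F Complex.≈ CMType.Φ Φ (FieldHom.map h x) 1F)

  record CMTriple : Set₁ where
    field
      ideal  : FractionalIdeal
      ξ      : Carrier
      cmType : CMType

    open FractionalIdeal ideal public
    open CMType cmType public

    _∈ξĪI : Carrier → Set
    x ∈ξĪI = Σ ℕ λ m → Σ (Vector Carrier m) λ a → Σ (Vector Carrier m) λ b →
      (∀ i → a i ∈I) × (∀ i → b i ∈I) × x ≈ ξ * sum (λ i → bar (a i) * b i)

    field
      ξ-imaginary : (ψ : Embedding numberField) → re (Embedding.map ψ ξ) Real.≈ Real.0#
      ξ-positive  : ∀ j → Real.0# Real.< im (j $ ξ)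
      ξĪI⊆𝒟⁻¹    : ∀ x → x ∈ξĪI → x ∈𝒟⁻¹
      𝒟⁻¹⊆ξĪI    : ∀ x → x ∈𝒟⁻¹ → x ∈ξĪI

    E : Vector ℂ 2 → Vector ℂ 2 → ℂ
    E z w = LinearAlgebra.sum ℂ-rawRing λ j →
      j $ ξ Complex.* (z j Complex.* Complex.conj (w j) Complex.- Complex.conj (z j) Complex.* w j)

    IsSymplecticBasis : Vector Carrier 4 → Set
    IsSymplecticBasis e = IsBasis ℤ.+-*-rawRing rawRing fromℤ _∈I e ×
      (∀ i j → E (Φ (e i)) (Φ (e j)) Complex.≈ Complex.fromℤ (J i j))

    IsReducedMatrix : Sym₂ℂ → Set
    IsReducedMatrix Z = InFundamentalDomain Z × Σ (Vector Carrier 4) λ e →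
      IsSymplecticBasis e ×
      (∀ j → Φ (e 2F) j Complex.≈ z₁  Complex.* Φ (e 0F) j Complex.+ z₁₂ Complex.* Φ (e 1F) j) ×
      (∀ j → Φ (e 3F) j Complex.≈ z₁₂ Complex.* Φ (e 0F) j Complex.+ z₂  Complex.* Φ (e 1F) j)
      where open Sym₂ℂ Z

{-# OPTIONS --safe #-}

-- Write φ = φ₁ and φ₂ = φ ∘ σ with σ ∈ Gal (K/ℚ), and D = e₁ σ(e₃) − σ(e₁) e₃, so that φ(D) = z₁₂ w with
-- w = φ₁(e₁) φ₂(e₂) − φ₂(e₁) φ₁(e₂).  If D ≠ 0, then O (e₁ , σ e₁) + O (e₃ , σ e₃) is a sublattice of I ⊕ σ I of
-- index |Δ| N(D) N(ξ), which is therefore at least 1.  Here N(D) = |φ(D)|² |φ(σ D)|²; the factor |φ(σ D)| is bounded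
-- by Cauchy–Schwarz for the Hermitian form of (Φ , ξ), and |w| is computed from the Gram matrix of (e₁ , e₂), which
-- is (Im Z)⁻¹ because the basis is symplectic.  The inequalities of the fundamental domain then give |Δ| |z₁₂|² ≥ 2,
-- more than the 4/9 needed.  If D = 0, then z₁₂ = 0, so φ₁ and φ₂ agree on e₃ / e₁ with the common value z₁.
-- A rational translate of it is a square root of a negative rational, so Φ is not primitive.
module Submission where

open import Defs
open import Algebra.Bundles using (CommutativeRing; RawRing)
import Algebra.Definitions.RawSemiring as RawPower
import Algebra.Morphism.Construct.Composition as Composition
open import Algebra.Morphism.Structures using (module RingMorphisms)
import Algebra.Properties.CommutativeSemigroup as CommutativeSemigroupProperties
import Algebra.Properties.Ring as RingProperties
import Algebra.Properties.Semiring.Mult as Mult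
import Algebra.Properties.Semiring.Sum as Sum
import Algebra.Solver.Ring as Solver
open import Algebra.Solver.Ring.AlmostCommutativeRing using (_-Raw-AlmostCommutative⟶_; fromCommutativeRing)
open import Data.Fin.Base as Fin using (Fin; zero; suc; toℕ; inject₁; punchIn; punchOut; splitAt; _↑ˡ_; _↑ʳ_)
open import Data.Fin.Induction using (<-weakInduction)
open import Data.Fin.Patterns using (0F; 1F; 2F; 3F)
import Data.Fin.Properties as Finₚ
open import Data.Integer.Base as ℤ using (ℤ; +_; -[1+_])
import Data.Integer.Properties as ℤₚ
open import Data.Maybe.Base using (Maybe; just; nothing)
open import Data.Nat.Base as ℕ using (ℕ; zero; suc)
import Data.Nat.Properties as ℕₚ
open import Data.Product.Base using (Σ; ∃-syntax; _×_; _,_; proj₁; proj₂)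
open import Data.Rational.Base as ℚ using (ℚ; mkℚ; 0ℚ; 1ℚ; ½; _/_)
import Data.Rational.Properties as ℚₚ
open import Data.Rational.Solver using (module +-*-Solver)
import Data.Rational.Unnormalised.Base as ℚᵘ
import Data.Rational.Unnormalised.Properties as ℚᵘₚ
open import Data.Sum.Base using (_⊎_; inj₁; inj₂; [_,_]′)
open import Data.Unit.Base using (tt)
open import Data.Vec.Functional using (Vector; insertAt; updateAt; removeAt)
import Data.Vec.Functional.Properties as Vector
open import Function.Base using (_∘_; const; id; _⟨_⟩_)
open import Function.Bundles using (Inverse)
open import Level using (0ℓ)
open import Relation.Binary.Definitions using (tri<; tri≈; tri>)
import Relation.Binary.PropositionalEquality as ≡
open ≡ using (_≡_; _≢_)
import Relation.Binary.Reasoning.Setoid as SetoidReasoning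
open import Relation.Nullary using (¬_; Dec; yes; no; contradiction)
open import Relation.Nullary.Decidable using (map′; from-yes)
open RingMorphisms using (IsRingHomomorphism; IsRingIsomorphism)

-- The index is computed without norms of ideals. On the symplectic basis the trace form Tr (ξ x ȳ)
-- has Gram matrix `J`, of determinant 1, so |det (αₖ eᵢ)|² N(ξ) = 1, and the same holds for σ e
-- with σ ξ. Let p be the determinant of the integer matrix expressing generators of the sublattice
-- in the basis of I ⊕ σ I. Comparing determinants of conjugates gives p² = (Δ N(D) N(ξ))², and p is
-- a nonzero integer. For the constants, put Y = Im Z, r = 1 / det Y, let a and h be the Hermitian
-- norms of e₁ and e₃, and η₁, η₂ the imaginary parts of φ₁(ξ), φ₂(ξ). Then 4 η₁ η₂ |w|² = r ≤ 16/9
-- and 4 η₁ η₂ |φ(σ D)|² ≤ a h ≤ 28/9. Hence 16 ≤ |Δ| |z₁₂|² r a h, and the rounded bounds r ≤ 2 and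
-- a h ≤ 4 give the 2. Equality and order of real numbers are undecidable. Equality in K is
-- decidable, because rational coordinates are unique, and nonnegativity is stable under double
-- negation, so inequalities may still be proved by contradiction.

module _ {A B : RawRing 0ℓ 0ℓ} where
  private
    module A = RawRing A
    module B = RawRing B

  mkRingHomomorphism : (f : A.Carrier → B.Carrier) → (∀ {x y} → x A.≈ y → f x B.≈ f y) →
    (∀ x y → f (x A.+ y) B.≈ f x B.+ f y) → (∀ x y → f (x A.* y) B.≈ f x B.* f y) →
    (∀ x → f (A.- x) B.≈ B.- f x) → f A.0# B.≈ B.0# → f A.1# B.≈ B.1# → IsRingHomomorphism A B f
  mkRingHomomorphism f cong +-homo *-homo -‿homo 0-homo 1-homo = record
    { isSemiringHomomorphism = record
      { isNearSemiringHomomorphism = record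
        { +-isMonoidHomomorphism = record
          { isMagmaHomomorphism = record { isRelHomomorphism = record { cong = cong } ; homo = +-homo }
          ; ε-homo = 0-homo
          }
        ; *-homo = *-homo
        }
      ; 1#-homo = 1-homo
      }
    ; -‿homo = -‿homo
    }

-- Integer coefficients for ring identities.

module IntegerCoefficients (R : CommutativeRing 0ℓ 0ℓ) where
  open CommutativeRing R
  open Mult semiring using (×-homo-+; ×1-homo-*) renaming (_×_ to _·_)
  open RingProperties ring using (-‿involutive; -0#≈0#; -‿distribˡ-*; -‿+-comm)
  open SetoidReasoning setoid

  fromInt : ℤ → Carrier
  fromInt (+ n)    = n · 1#
  fromInt -[1+ n ] = - (suc n · 1#)

  neg-homo : ∀ a → fromInt (ℤ.- a) ≈ - fromInt a
  neg-homo (+ zero)  = sym -0#≈0#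
  neg-homo (+ suc n) = refl
  neg-homo -[1+ n ]  = sym (-‿involutive _)

  cancel-1 : ∀ x y → x - y ≈ (1# + x) - (1# + y)
  cancel-1 x y = begin
    x - y                    ≈⟨ +-identityˡ _ ⟨
    0# + (x - y)             ≈⟨ +-congʳ (-‿inverseʳ 1#) ⟨
    (1# - 1#) + (x - y)      ≈⟨ +-assoc 1# (- 1#) (x - y) ⟩
    1# + (- 1# + (x - y))    ≈⟨ +-congˡ (+-assoc (- 1#) x (- y)) ⟨
    1# + ((- 1# + x) - y)    ≈⟨ +-congˡ (+-congʳ (+-comm (- 1#) x)) ⟩
    1# + ((x - 1#) - y)      ≈⟨ +-congˡ (+-assoc x (- 1#) (- y)) ⟩
    1# + (x + (- 1# - y))    ≈⟨ +-assoc 1# x (- 1# - y) ⟨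
    (1# + x) + (- 1# - y)    ≈⟨ +-congˡ (-‿+-comm 1# y) ⟩
    (1# + x) - (1# + y)      ∎

  ⊖-homo : ∀ m n → fromInt (m ℤ.⊖ n) ≈ m · 1# - n · 1#
  ⊖-homo zero    zero    = sym (trans (+-identityˡ _) -0#≈0#)
  ⊖-homo zero    (suc n) = sym (+-identityˡ _)
  ⊖-homo (suc m) zero    = sym (trans (+-congˡ -0#≈0#) (+-identityʳ _))
  ⊖-homo (suc m) (suc n) = begin
    fromInt (suc m ℤ.⊖ suc n)        ≡⟨ ≡.cong fromInt (ℤₚ.[1+m]⊖[1+n]≡m⊖n m n) ⟩
    fromInt (m ℤ.⊖ n)                ≈⟨ ⊖-homo m n ⟩
    m · 1# - n · 1#                  ≈⟨ cancel-1 _ _ ⟩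
    suc m · 1# - suc n · 1#          ∎

  +-homo : ∀ a b → fromInt (a ℤ.+ b) ≈ fromInt a + fromInt b
  +-homo (+ m)    (+ n)    = ×-homo-+ 1# m n
  +-homo (+ m)    -[1+ n ] = ⊖-homo m (suc n)
  +-homo -[1+ m ] (+ n)    = trans (⊖-homo n (suc m)) (+-comm _ _)
  +-homo -[1+ m ] -[1+ n ] = begin
    - (suc (suc (m ℕ.+ n)) · 1#)      ≡⟨ ≡.cong (λ k → - (suc k · 1#)) (ℕₚ.+-suc m n) ⟨
    - ((suc m ℕ.+ suc n) · 1#)        ≈⟨ -‿cong (×-homo-+ 1# (suc m) (suc n)) ⟩
    - (suc m · 1# + suc n · 1#)       ≈⟨ -‿+-comm _ _ ⟨
    - (suc m · 1#) - suc n · 1#       ∎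

  *-homo-pos : ∀ m b → fromInt (+ m ℤ.* b) ≈ m · 1# * fromInt b
  *-homo-pos m (+ n) = begin
    fromInt (+ m ℤ.* + n)   ≡⟨ ≡.cong fromInt (ℤₚ.pos-* m n) ⟨
    (m ℕ.* n) · 1#          ≈⟨ ×1-homo-* m n ⟩
    m · 1# * (n · 1#)       ∎
  *-homo-pos m -[1+ n ] = begin
    fromInt (+ m ℤ.* -[1+ n ])        ≡⟨ ≡.cong fromInt (ℤₚ.neg-distribʳ-* (+ m) (+ suc n)) ⟨
    fromInt (ℤ.- (+ m ℤ.* + suc n))   ≈⟨ neg-homo (+ m ℤ.* + suc n) ⟩
    - fromInt (+ m ℤ.* + suc n)       ≈⟨ -‿cong (*-homo-pos m (+ suc n)) ⟩
    - (m · 1# * (suc n · 1#))         ≈⟨ RingProperties.-‿distribʳ-* ring _ _ ⟩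
    m · 1# * - (suc n · 1#)           ∎

  *-homo : ∀ a b → fromInt (a ℤ.* b) ≈ fromInt a * fromInt b
  *-homo (+ m)    b = *-homo-pos m b
  *-homo -[1+ m ] b = begin
    fromInt (-[1+ m ] ℤ.* b)          ≡⟨ ≡.cong fromInt (ℤₚ.neg-distribˡ-* (+ suc m) b) ⟨
    fromInt (ℤ.- (+ suc m ℤ.* b))     ≈⟨ neg-homo (+ suc m ℤ.* b) ⟩
    - fromInt (+ suc m ℤ.* b)         ≈⟨ -‿cong (*-homo-pos (suc m) b) ⟩
    - (suc m · 1# * fromInt b)        ≈⟨ -‿distribˡ-* _ _ ⟩
    - (suc m · 1#) * fromInt b        ∎

  1-homo : fromInt (+ 1) ≈ 1#
  1-homo = +-identityʳ 1#

-- Coefficients are taken from ℤ, where equality is decidable, so that the solver also normalises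
-- identities over rings such as the real numbers.
module RingSolver (R : CommutativeRing 0ℓ 0ℓ) where
  open IntegerCoefficients R
  open CommutativeRing R using (_≈_; refl; reflexive)

  private
    weakly : ∀ a b → Maybe (fromInt a ≈ fromInt b)
    weakly a b with a ℤₚ.≟ b
    ... | yes a≡b = just (reflexive (≡.cong fromInt a≡b))
    ... | no  _   = nothing

    fromInt-homomorphism : ℤ.+-*-rawRing -Raw-AlmostCommutative⟶ fromCommutativeRing R
    fromInt-homomorphism = record
      { ⟦_⟧ = fromInt ; +-homo = +-homo ; *-homo = *-homo ; -‿homo = neg-homo ; 0-homo = refl ; 1-homo = 1-homo }

  open Solver ℤ.+-*-rawRing (fromCommutativeRing R) fromInt-homomorphism weakly public
    using (solve; _:=_; _:+_; _:*_; _:-_; :-_; con)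

-- Neighbouring indices and deletion of an index.

-- Alternation is checked on neighbours only, where the sign of an exchange is visible in a Laplace
-- expansion. An inductive relation lets deletion of a column be followed by pattern matching.
data Adjacent : ∀ {n} → Fin n → Fin n → Set where
  zero : ∀ {n} → Adjacent {suc (suc n)} 0F 1F
  suc  : ∀ {n} {a b : Fin n} → Adjacent a b → Adjacent (suc a) (suc b)

inject₁-adjacent : ∀ {n} (i : Fin n) → Adjacent (inject₁ i) (suc i)
inject₁-adjacent zero    = zero
inject₁-adjacent (suc i) = suc (inject₁-adjacent i)

toℕ-adjacent : ∀ {n} {a b : Fin n} → Adjacent a b → toℕ b ≡ suc (toℕ a)
toℕ-adjacent zero      = ≡.refl
toℕ-adjacent (suc a~b) = ≡.cong suc (toℕ-adjacent a~b)

-- Compares the minors left by deleting column `a` and column `b`: they use the same columns except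
-- in the place of the survivor of the pair. If the two columns are equal, so are the minors.
punchIn-adjacent : ∀ {n} {a b : Fin (suc n)} → Adjacent a b → ∀ k →
  punchIn a k ≡ punchIn b k ⊎ (punchIn a k ≡ b × punchIn b k ≡ a)
punchIn-adjacent zero            zero    = inj₂ (≡.refl , ≡.refl)
punchIn-adjacent zero            (suc k) = inj₁ ≡.refl
punchIn-adjacent {suc n} (suc a~b) zero  = inj₁ ≡.refl
punchIn-adjacent {suc n} (suc a~b) (suc k) with punchIn-adjacent a~b k
... | inj₁ eq        = inj₁ (≡.cong suc eq)
... | inj₂ (eq , eq′) = inj₂ (≡.cong suc eq , ≡.cong suc eq′)

punchOut-adjacent : ∀ {n} {a b : Fin (suc n)} → Adjacent a b → ∀ j (j≢a : j ≢ a) (j≢b : j ≢ b) →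
  Adjacent (punchOut j≢a) (punchOut j≢b)
punchOut-adjacent zero zero          j≢a _ = contradiction ≡.refl j≢a
punchOut-adjacent zero (suc zero)    _ j≢b = contradiction ≡.refl j≢b
punchOut-adjacent {suc (suc n)} zero (suc (suc j)) _ _ = zero
punchOut-adjacent {suc n} (suc a~b) zero    _   _   = a~b
punchOut-adjacent {suc n} (suc a~b) (suc j) j≢a j≢b =
  suc (punchOut-adjacent a~b j (j≢a ∘ ≡.cong suc) (j≢b ∘ ≡.cong suc))

-- The strict order as a chain of neighbours, because `vanishes-≪` brings two equal rows together by
-- one exchange of neighbours at a time.
data _≪_ {n} (a : Fin n) : Fin n → Set where
  adjacent : ∀ {b} → Adjacent a b → a ≪ b
  step     : ∀ {b c} → a ≪ b → Adjacent b c → a ≪ c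

≪⇒< : ∀ {n} {a b : Fin n} → a ≪ b → toℕ a ℕ.< toℕ b
≪⇒< (adjacent a~b)   = ℕₚ.≤-reflexive (≡.sym (toℕ-adjacent a~b))
≪⇒< (step a≪b b~c) = ℕₚ.<-trans (≪⇒< a≪b) (ℕₚ.≤-reflexive (≡.sym (toℕ-adjacent b~c)))

≪⇒≢ : ∀ {n} {a b : Fin n} → a ≪ b → a ≢ b
≪⇒≢ a≪b ≡.refl = ℕₚ.<-irrefl ≡.refl (≪⇒< a≪b)

suc-≪ : ∀ {n} {a b : Fin n} → a ≪ b → suc a ≪ suc b
suc-≪ (adjacent a~b) = adjacent (suc a~b)
suc-≪ (step a≪b b~c) = step (suc-≪ a≪b) (suc b~c)

0≪suc : ∀ {n} (k : Fin n) → zero ≪ suc k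
0≪suc zero    = adjacent zero
0≪suc (suc k) = <-weakInduction (λ k → zero ≪ suc k) (adjacent zero)
  (λ i 0≪i → step 0≪i (inject₁-adjacent (suc i))) (suc k)

≢⇒≪ : ∀ {n} (a b : Fin n) → a ≢ b → a ≪ b ⊎ b ≪ a
≢⇒≪ zero    zero    a≢b = contradiction ≡.refl a≢b
≢⇒≪ zero    (suc b) _   = inj₁ (0≪suc b)
≢⇒≪ (suc a) zero    _   = inj₂ (0≪suc a)
≢⇒≪ (suc a) (suc b) a≢b with ≢⇒≪ a b (a≢b ∘ ≡.cong suc)
... | inj₁ a≪b = inj₁ (suc-≪ a≪b)
... | inj₂ b≪a = inj₂ (suc-≪ b≪a)

punchIn-inject₁-same : ∀ {n} (i : Fin n) → punchIn (inject₁ i) i ≡ suc i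
punchIn-inject₁-same zero    = ≡.refl
punchIn-inject₁-same (suc i) = ≡.cong suc (punchIn-inject₁-same i)

punchIn-suc-same : ∀ {n} (i : Fin n) → punchIn (suc i) i ≡ inject₁ i
punchIn-suc-same zero    = ≡.refl
punchIn-suc-same (suc i) = ≡.cong suc (punchIn-suc-same i)

punchIn-inject₁-other : ∀ {n} (i j : Fin n) → j ≢ i → punchIn (inject₁ i) j ≡ punchIn (suc i) j
punchIn-inject₁-other zero    zero    j≢i = contradiction ≡.refl j≢i
punchIn-inject₁-other zero    (suc j) _   = ≡.refl
punchIn-inject₁-other (suc i) zero    _   = ≡.refl
punchIn-inject₁-other (suc i) (suc j) j≢i = ≡.cong suc (punchIn-inject₁-other i j (j≢i ∘ ≡.cong suc))

punchIn-↑ˡ : ∀ {m} n (j : Fin (suc m)) (k : Fin m) → punchIn (j ↑ˡ n) (k ↑ˡ n) ≡ punchIn j k ↑ˡ n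
punchIn-↑ˡ n zero    k       = ≡.refl
punchIn-↑ˡ n (suc j) zero    = ≡.refl
punchIn-↑ˡ n (suc j) (suc k) = ≡.cong suc (punchIn-↑ˡ n j k)

punchIn-↑ʳ : ∀ {m} n (j : Fin (suc m)) (k : Fin n) → punchIn (j ↑ˡ n) (m ↑ʳ k) ≡ suc m ↑ʳ k
punchIn-↑ʳ {zero}  n zero    k = ≡.refl
punchIn-↑ʳ {suc m} n zero    k = ≡.refl
punchIn-↑ʳ {suc m} n (suc j) k = ≡.cong suc (punchIn-↑ʳ n j k)

-- Alternating functions and determinants over a commutative ring.

module Determinant (R : CommutativeRing 0ℓ 0ℓ) where
  open CommutativeRing R hiding (zero)
  open LinearAlgebra rawRing using (sum; _^_; det; _⊗_; _ᵀ)
  open Sum semiring using (sum-cong-≋; ∑-distrib-+; ∑-comm; *-distribˡ-sum; *-distribʳ-sum; sum-replicate-zero; sum-remove)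
  open RingProperties ring using (-1*x≈-x)
  open SetoidReasoning setoid
  open RingSolver R

  infix 4 _≋_
  _≋_ : ∀ {m n} → Matrix Carrier m n → Matrix Carrier m n → Set
  M ≋ N = ∀ i j → M i j ≈ N i j

  sum-zero : ∀ {n} {f : Vector Carrier n} → (∀ i → f i ≈ 0#) → sum f ≈ 0#
  sum-zero {n} h = trans (sum-cong-≋ h) (sum-replicate-zero n)

  sum-cong : ∀ {n} (f g : Vector Carrier n) → (∀ i → f i ≈ g i) → sum f ≈ sum g
  sum-cong f g = sum-cong-≋

  sum-single : ∀ {n} {f : Vector Carrier n} c → (∀ i → i ≢ c → f i ≈ 0#) → sum f ≈ f c
  sum-single {suc n} {f} c h = begin
    sum f                       ≈⟨ sum-remove {i = c} f ⟩
    f c + sum (removeAt f c)    ≈⟨ +-congˡ (sum-zero λ k → h _ (Finₚ.punchInᵢ≢i c k)) ⟩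
    f c + 0#                    ≈⟨ +-identityʳ _ ⟩
    f c                         ∎

  sum-linear : ∀ {n} a b (f g : Vector Carrier n) → sum (λ i → a * f i + b * g i) ≈ a * sum f + b * sum g
  sum-linear a b f g = trans (∑-distrib-+ (λ i → a * f i) (λ i → b * g i))
    (+-cong (sym (*-distribˡ-sum a f)) (sym (*-distribˡ-sum b g)))

  sum-++ : ∀ m {n} (f : Vector Carrier (m ℕ.+ n)) → sum f ≈ sum (f ∘ (_↑ˡ n)) + sum (f ∘ (m ↑ʳ_))
  sum-++ zero    f = sym (+-identityˡ _)
  sum-++ (suc m) f = trans (+-congˡ (sum-++ m (f ∘ suc))) (sym (+-assoc _ _ _))

  -- Linearity speaks of three matrices that agree off row `c`, not of updated ones, so it applies
  -- however they are presented. Equal neighbouring rows give 0, which is the form of alternation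
  -- that is correct in every characteristic.
  record IsAlternating {n m} (f : Matrix Carrier n m → Carrier) : Set where
    field
      cong   : ∀ {v w} → v ≋ w → f v ≈ f w
      linear : ∀ c {u v w} a b →
               (∀ i → i ≢ c → ∀ j → u i j ≈ v i j) → (∀ i → i ≢ c → ∀ j → u i j ≈ w i j) →
               (∀ j → u c j ≈ a * v c j + b * w c j) → f u ≈ a * f v + b * f w
      repeated : ∀ {a b v} → Adjacent a b → (∀ j → v a j ≈ v b j) → f v ≈ 0#

  _[_≔_] : ∀ {m n} → Matrix Carrier m n → Fin m → Vector Carrier n → Matrix Carrier m n
  M [ c ≔ w ] = updateAt M c (const w)

  ≔-same : ∀ {m n} (M : Matrix Carrier m n) c w j → (M [ c ≔ w ]) c j ≈ w j
  ≔-same M c w j = reflexive (≡.cong-app (Vector.updateAt-updates c M) j)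

  ≔-other : ∀ {m n} (M : Matrix Carrier m n) c w i → i ≢ c → ∀ j → (M [ c ≔ w ]) i j ≈ M i j
  ≔-other M c w i i≢c j = reflexive (≡.cong-app (Vector.updateAt-minimal i c M i≢c) j)

  ≔-≔ : ∀ {m n} (M : Matrix Carrier m n) c w w′ i → i ≢ c → ∀ j → (M [ c ≔ w ]) i j ≈ (M [ c ≔ w′ ]) i j
  ≔-≔ M c w w′ i i≢c j = trans (≔-other M c w i i≢c j) (sym (≔-other M c w′ i i≢c j))

  module Alternating {n m} {f : Matrix Carrier n m → Carrier} (alt : IsAlternating f) where
    open IsAlternating alt

    VanishesAt : Fin n → Fin n → Set
    VanishesAt a b = ∀ v → (∀ j → v a j ≈ v b j) → f v ≈ 0#

    set-+ : ∀ v c x y → f (v [ c ≔ (λ j → x j + y j) ]) ≈ f (v [ c ≔ x ]) + f (v [ c ≔ y ])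
    set-+ v c x y = trans (linear c 1# 1# (≔-≔ v c _ x) (≔-≔ v c _ y)
      (λ j → trans (≔-same v c _ j) (+-cong
        (sym (trans (*-identityˡ _) (≔-same v c x j))) (sym (trans (*-identityˡ _) (≔-same v c y j))))))
      (+-cong (*-identityˡ _) (*-identityˡ _))

    set-self : ∀ v c x → (∀ j → v c j ≈ x j) → f (v [ c ≔ x ]) ≈ f v
    set-self v c x h = cong λ i j → lemma i j
      where
      lemma : ∀ i j → (v [ c ≔ x ]) i j ≈ v i j
      lemma i j with i Finₚ.≟ c
      ... | yes ≡.refl = trans (≔-same v c x j) (sym (h j))
      ... | no  i≢c    = ≔-other v c x i i≢c j

    set₂ : Matrix Carrier n m → Fin n → Fin n → Vector Carrier m → Vector Carrier m → Matrix Carrier n m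
    set₂ v a b x y = (v [ a ≔ x ]) [ b ≔ y ]

    -- Polarisation: with `x + y` in both rows the value is 0, and of the four terms of its
    -- expansion the two with equal rows vanish as well.
    swap : ∀ {a b} → a ≢ b → VanishesAt a b → ∀ {v w} →
      (∀ j → v a j ≈ w b j) → (∀ j → v b j ≈ w a j) → (∀ i → i ≢ a → i ≢ b → ∀ j → v i j ≈ w i j) →
      f v ≈ - f w
    swap {a} {b} a≢b vanish {v} {w} vw wv other = begin
      f v                                        ≈⟨ solve 2 (λ p q → p := con (+ 0) :+ p :+ q :+ con (+ 0) :- q) refl (f v) (f w) ⟩
      0# + f v + f w + 0# - f w                  ≈⟨ +-congʳ (+-cong (+-cong (+-cong (sym xx≈0) (sym xy≈v)) (sym yx≈w)) (sym yy≈0)) ⟩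
      F x x + F x y + F y x + F y y - f w        ≈⟨ +-congʳ (+-assoc _ _ _) ⟩
      F x x + F x y + (F y x + F y y) - f w      ≈⟨ +-congʳ expand ⟨
      F z z - f w                                ≈⟨ +-congʳ (vanishes z) ⟩
      0# - f w                                   ≈⟨ +-identityˡ _ ⟩
      - f w                                      ∎
      where
      x y z : Vector Carrier m
      x = v a
      y = v b
      z j = x j + y j
      F : Vector Carrier m → Vector Carrier m → Carrier
      F p q = f (set₂ v a b p q)
      at-a : ∀ p q j → set₂ v a b p q a j ≈ p j
      at-a p q j = trans (≔-other (v [ a ≔ p ]) b q a a≢b j) (≔-same v a p j)
      at-b : ∀ p q j → set₂ v a b p q b j ≈ q j
      at-b p q j = ≔-same (v [ a ≔ p ]) b q j
      elsewhere : ∀ p q i → i ≢ a → i ≢ b → ∀ j → set₂ v a b p q i j ≈ v i j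
      elsewhere p q i i≢a i≢b j = trans (≔-other (v [ a ≔ p ]) b q i i≢b j) (≔-other v a p i i≢a j)
      vanishes : ∀ p → F p p ≈ 0#
      vanishes p = vanish _ λ j → trans (at-a p p j) (sym (at-b p p j))
      xx≈0 = vanishes x
      yy≈0 = vanishes y
      F≈ : ∀ p q u → (∀ j → p j ≈ u a j) → (∀ j → q j ≈ u b j) → (∀ i → i ≢ a → i ≢ b → ∀ j → v i j ≈ u i j) → F p q ≈ f u
      F≈ p q u ha hb ho = cong lemma
        where
        lemma : ∀ i j → set₂ v a b p q i j ≈ u i j
        lemma i j with i Finₚ.≟ a | i Finₚ.≟ b
        ... | yes ≡.refl | _          = trans (at-a p q j) (ha j)
        ... | no _       | yes ≡.refl = trans (at-b p q j) (hb j)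
        ... | no i≢a     | no i≢b     = trans (elsewhere p q i i≢a i≢b j) (ho i i≢a i≢b j)
      xy≈v : F x y ≈ f v
      xy≈v = F≈ x y v (λ _ → refl) (λ _ → refl) (λ _ _ _ _ → refl)
      yx≈w : F y x ≈ f w
      yx≈w = F≈ y x w wv vw other
      left : ∀ q → F z q ≈ F x q + F y q
      left q = trans (linear a 1# 1# (off x) (off y)
          (λ j → trans (at-a z q j) (+-cong (sym (trans (*-identityˡ _) (at-a x q j))) (sym (trans (*-identityˡ _) (at-a y q j))))))
        (+-cong (*-identityˡ _) (*-identityˡ _))
        where
        off : ∀ p i → i ≢ a → ∀ j → set₂ v a b z q i j ≈ set₂ v a b p q i j
        off p i i≢a j with i Finₚ.≟ b
        ... | yes ≡.refl = trans (at-b z q j) (sym (at-b p q j))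
        ... | no i≢b     = trans (elsewhere z q i i≢a i≢b j) (sym (elsewhere p q i i≢a i≢b j))
      expand : F z z ≈ F x x + F x y + (F y x + F y y)
      expand = trans (left z) (+-cong (set-+ (v [ a ≔ x ]) b x y) (set-+ (v [ a ≔ y ]) b x y))

    -- In a longer chain, exchanging the last two rows moves the copy of row `a` one place closer,
    -- at the cost of a sign, and the shorter chain applies.
    vanishes-≪ : ∀ {a b} → a ≪ b → VanishesAt a b
    vanishes-≪ (adjacent a~b)         v h = repeated a~b h
    vanishes-≪ {a} {c} (step {b} a≪b b~c) v h = begin
      f v      ≈⟨ swap b≢c (λ u → repeated b~c) (λ j → sym (at-c j)) (λ j → sym (at-b j)) (λ i i≢b i≢c j → sym (elsewhere i i≢b i≢c j)) ⟩
      - f w    ≈⟨ -‿cong (vanishes-≪ a≪b w (λ j → trans (elsewhere a (≪⇒≢ a≪b) (≪⇒≢ (step a≪b b~c)) j) (trans (h j) (sym (at-b j))))) ⟩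
      - 0#     ≈⟨ solve 0 (:- con (+ 0) := con (+ 0)) refl ⟩
      0#       ∎
      where
      b≢c : b ≢ c
      b≢c = ≪⇒≢ (adjacent b~c)
      w = set₂ v b c (v c) (v b)
      at-b : ∀ j → w b j ≈ v c j
      at-b j = trans (≔-other (v [ b ≔ v c ]) c (v b) b b≢c j) (≔-same v b (v c) j)
      at-c : ∀ j → w c j ≈ v b j
      at-c j = ≔-same (v [ b ≔ v c ]) c (v b) j
      elsewhere : ∀ i → i ≢ b → i ≢ c → ∀ j → w i j ≈ v i j
      elsewhere i i≢b i≢c j = trans (≔-other (v [ b ≔ v c ]) c (v b) i i≢c j) (≔-other v b (v c) i i≢b j)

    vanishes : ∀ a b → a ≢ b → VanishesAt a b
    vanishes a b a≢b v h with ≢⇒≪ a b a≢b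
    ... | inj₁ a≪b = vanishes-≪ a≪b v h
    ... | inj₂ b≪a = vanishes-≪ b≪a v (sym ∘ h)

    set-sum : ∀ {k} v c (a : Vector Carrier k) (x : Matrix Carrier k m) →
      f (v [ c ≔ (λ j → sum (λ i → a i * x i j)) ]) ≈ sum (λ i → a i * f (v [ c ≔ x i ]))
    -- The empty sum is the zero row, a combination with both coefficients 0, where linearity forces
    -- the value 0.
    set-sum {zero} v c a x = trans (linear c {v = u} {w = u} 0# 0# (λ _ _ _ → refl) (λ _ _ _ → refl)
        (λ j → trans (≔-same v c _ j) (sym (trans (+-cong (zeroˡ _) (zeroˡ _)) (+-identityˡ _)))))
      (trans (+-cong (zeroˡ _) (zeroˡ _)) (+-identityˡ 0#))
      where u = v [ c ≔ (λ j → 0#) ]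
    set-sum {suc k} v c a x = begin
      f (v [ c ≔ (λ j → sum (λ i → a i * x i j)) ])
        ≈⟨ linear c (a zero) 1# (≔-≔ v c _ (x zero)) (≔-≔ v c _ rest)
             (λ j → trans (≔-same v c _ j) (+-cong (*-congˡ (sym (≔-same v c (x zero) j)))
               (sym (trans (*-identityˡ _) (≔-same v c rest j))))) ⟩
      a zero * f (v [ c ≔ x zero ]) + 1# * f (v [ c ≔ rest ])
        ≈⟨ +-congˡ (trans (*-identityˡ _) (set-sum v c (a ∘ suc) (x ∘ suc))) ⟩
      sum (λ i → a i * f (v [ c ≔ x i ])) ∎
      where rest = λ j → sum (λ i → a (suc i) * x (suc i) j)

    add-multiple : ∀ {b} c → b ≢ c → ∀ {v w} a → (∀ i → i ≢ c → ∀ j → v i j ≈ w i j) →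
      (∀ j → v c j ≈ w c j + a * w b j) → f v ≈ f w
    add-multiple {b} c b≢c {v} {w} a off at = begin
      f v                                ≈⟨ linear c 1# a off (λ i i≢c j → trans (off i i≢c j) (sym (≔-other w c (w b) i i≢c j)))
                                              (λ j → trans (at j) (+-cong (sym (*-identityˡ _)) (*-congˡ (sym (≔-same w c (w b) j))))) ⟩
      1# * f w + a * f (w [ c ≔ w b ])   ≈⟨ +-cong (*-identityˡ _) (*-congˡ (vanishes c b (b≢c ∘ ≡.sym) (w [ c ≔ w b ])
                                              (λ j → trans (≔-same w c (w b) j) (sym (≔-other w c (w b) b b≢c j))))) ⟩
      f w + a * 0#                       ≈⟨ solve 2 (λ p a → p :+ a :* con (+ 0) := p) refl (f w) a ⟩
      f w                                ∎

  module _ {n m} {f : Matrix Carrier (suc n) m → Carrier} (alt : IsAlternating f) where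
    open IsAlternating alt
    open Alternating alt

    -- The rows of v are replaced one at a time.
    add-multiples : ∀ {v w} (a : Vector Carrier n) → (∀ j → v zero j ≈ w zero j) →
      (∀ i j → v (suc i) j ≈ w (suc i) j + a i * w zero j) → f v ≈ f w
    add-multiples {v} {w} a v₀≈w₀ v≈w+aw₀ = begin
      f v           ≈⟨ cong hybrid-0 ⟨
      f (hybrid 0)  ≈⟨ all n ℕₚ.≤-refl ⟩
      f (hybrid n)  ≈⟨ cong hybrid-n ⟩
      f w           ∎
      where
      hybrid : ℕ → Matrix Carrier (suc n) m
      hybrid k zero    j = w zero j
      hybrid k (suc i) j with toℕ i ℕₚ.<? k
      ... | yes _ = w (suc i) j
      ... | no  _ = v (suc i) j
      hybrid-0 : hybrid 0 ≋ v
      hybrid-0 zero    j = sym (v₀≈w₀ j)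
      hybrid-0 (suc i) j = refl
      hybrid-n : hybrid n ≋ w
      hybrid-n zero    j = refl
      hybrid-n (suc i) j with toℕ i ℕₚ.<? n
      ... | yes _ = refl
      ... | no i≮n = contradiction (Finₚ.toℕ<n i) i≮n
      next : ∀ k → k ℕ.< n → f (hybrid k) ≈ f (hybrid (suc k))
      next k k<n = add-multiple {zero} (suc c) (λ ()) (a c) off at
        where
        c = Fin.fromℕ< k<n
        toℕc : toℕ c ≡ k
        toℕc = Finₚ.toℕ-fromℕ< k<n
        off : ∀ i → i ≢ suc c → ∀ j → hybrid k i j ≈ hybrid (suc k) i j
        off zero    _     j = refl
        off (suc i) i≢c j with toℕ i ℕₚ.<? k | toℕ i ℕₚ.<? suc k
        ... | yes _   | yes _     = refl
        ... | no  _   | no _      = refl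
        ... | yes i<k | no i≮1+k  = contradiction (ℕₚ.m<n⇒m<1+n i<k) i≮1+k
        ... | no i≮k  | yes i<1+k = contradiction (≡.cong suc (Finₚ.toℕ-injective
                (≡.trans (ℕₚ.≤-antisym (ℕ.s≤s⁻¹ i<1+k) (ℕₚ.≮⇒≥ i≮k)) (≡.sym toℕc)))) i≢c
        at : ∀ j → hybrid k (suc c) j ≈ hybrid (suc k) (suc c) j + a c * hybrid (suc k) zero j
        at j with toℕ c ℕₚ.<? k | toℕ c ℕₚ.<? suc k
        ... | yes c<k | _        = contradiction toℕc (ℕₚ.<⇒≢ c<k)
        ... | no _    | no c≮1+k = contradiction (ℕ.s≤s (ℕₚ.≤-reflexive toℕc)) c≮1+k
        ... | no _    | yes _    = v≈w+aw₀ c j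
      all : ∀ k → k ℕ.≤ n → f (hybrid 0) ≈ f (hybrid k)
      all zero    _   = refl
      all (suc k) k<n = trans (all k (ℕₚ.<⇒≤ k<n)) (next k k<n)

  𝟙 : ∀ {n} → Matrix Carrier n n
  𝟙 zero    zero    = 1#
  𝟙 zero    (suc _) = 0#
  𝟙 (suc _) zero    = 0#
  𝟙 (suc i) (suc j) = 𝟙 i j

  𝟙-diagonal : ∀ {n} (i : Fin n) → 𝟙 i i ≈ 1#
  𝟙-diagonal zero    = refl
  𝟙-diagonal (suc i) = 𝟙-diagonal i

  𝟙-off-diagonal : ∀ {n} (i j : Fin n) → i ≢ j → 𝟙 i j ≈ 0#
  𝟙-off-diagonal zero    zero    i≢j = contradiction ≡.refl i≢j
  𝟙-off-diagonal zero    (suc j) _   = refl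
  𝟙-off-diagonal (suc i) zero    _   = refl
  𝟙-off-diagonal (suc i) (suc j) i≢j = 𝟙-off-diagonal i j (i≢j ∘ ≡.cong suc)

  sum-𝟙ʳ : ∀ {n} (a : Vector Carrier n) j → sum (λ i → a i * 𝟙 i j) ≈ a j
  sum-𝟙ʳ a j = trans (sum-single j λ i i≢j → trans (*-congˡ (𝟙-off-diagonal i j i≢j)) (zeroʳ _))
    (trans (*-congˡ (𝟙-diagonal j)) (*-identityʳ _))

  sum-𝟙ˡ : ∀ {n} (a : Vector Carrier n) i → sum (λ j → 𝟙 i j * a j) ≈ a i
  sum-𝟙ˡ a i = trans (sum-single i λ j j≢i → trans (*-congʳ (𝟙-off-diagonal i j (j≢i ∘ ≡.sym))) (zeroˡ _))
    (trans (*-congʳ (𝟙-diagonal i)) (*-identityˡ _))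

  insertAt-zeros : ∀ {n} (i j : Fin (suc n)) → insertAt (const 0#) i 0# j ≈ 0#
  insertAt-zeros         zero    zero    = refl
  insertAt-zeros         zero    (suc j) = refl
  insertAt-zeros {suc n} (suc i) zero    = refl
  insertAt-zeros {suc n} (suc i) (suc j) = insertAt-zeros i j

  insertAt-𝟙 : ∀ {n} (j : Fin (suc n)) r l → insertAt (𝟙 r) j 0# l ≈ 𝟙 (punchIn j r) l
  insertAt-𝟙 zero    r       zero    = refl
  insertAt-𝟙 zero    r       (suc l) = refl
  insertAt-𝟙 (suc j) zero    zero    = refl
  insertAt-𝟙 (suc j) zero    (suc l) = insertAt-zeros j l
  insertAt-𝟙 (suc j) (suc r) zero    = refl
  insertAt-𝟙 (suc j) (suc r) (suc l) = insertAt-𝟙 j r l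

  data PunchView {n} (j : Fin (suc n)) : Fin (suc n) → Set where
    here  : PunchView j j
    there : ∀ k → PunchView j (punchIn j k)

  punchView : ∀ {n} (j l : Fin (suc n)) → PunchView j l
  punchView j l with j Finₚ.≟ l
  ... | yes ≡.refl = here
  ... | no  j≢l    = ≡.subst (PunchView j) (Finₚ.punchIn-punchOut j≢l) (there (punchOut j≢l))

  insertAt-linear : ∀ {n} {u v w : Vector Carrier n} a b j → (∀ k → u k ≈ a * v k + b * w k) →
    ∀ l → insertAt u j 0# l ≈ a * insertAt v j 0# l + b * insertAt w j 0# l
  insertAt-linear {u = u} {v} {w} a b j h l with punchView j l
  ... | here rewrite Vector.insertAt-lookup u j 0# | Vector.insertAt-lookup v j 0# | Vector.insertAt-lookup w j 0# =
    solve 2 (λ a b → con (+ 0) := a :* con (+ 0) :+ b :* con (+ 0)) refl a b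
  ... | there k rewrite Vector.insertAt-punchIn u j 0# k | Vector.insertAt-punchIn v j 0# k | Vector.insertAt-punchIn w j 0# k = h k

  insertAt-cong : ∀ {n} {u v : Vector Carrier n} j → (∀ k → u k ≈ v k) →
    ∀ l → insertAt u j 0# l ≈ insertAt v j 0# l
  insertAt-cong {u = u} {v} j h l with punchView j l
  ... | here rewrite Vector.insertAt-lookup u j 0# | Vector.insertAt-lookup v j 0# = refl
  ... | there k rewrite Vector.insertAt-punchIn u j 0# k | Vector.insertAt-punchIn v j 0# k = h k

  minor : ∀ {n} → Fin (suc n) → Matrix Carrier (suc n) (suc n) → Matrix Carrier n n
  minor j M i k = M (suc i) (punchIn j k)

  -- What is left of a matrix once its first row is replaced by the unit vector `j` and column `j`
  -- is cleared below it.
  bordered : ∀ {n} → Fin (suc n) → Matrix Carrier n n → Matrix Carrier (suc n) (suc n)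
  bordered j N zero    = 𝟙 j
  bordered j N (suc i) = insertAt (N i) j 0#

  sign : ∀ {n} → Fin n → Carrier
  sign j = (- 1#) ^ toℕ j

  laplace : ∀ {n} → Matrix Carrier (suc n) (suc n) → Vector Carrier (suc n)
  laplace M j = sign j * (M zero j * det (minor j M))

  module _ {n} {f : Matrix Carrier (suc n) (suc n) → Carrier} (alt : IsAlternating f) where
    open IsAlternating alt
    open Alternating alt

    bordered-alternating : ∀ j → IsAlternating (f ∘ bordered j)
    bordered-alternating j = record
      { cong   = λ v≋w → cong λ { zero l → refl ; (suc i) l → insertAt-cong j (v≋w i) l }
      ; linear = λ c a b uv uw at → linear (suc c) a b
          (λ { zero _ l → refl ; (suc i) i≢c l → insertAt-cong j (uv i (i≢c ∘ ≡.cong suc)) l })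
          (λ { zero _ l → refl ; (suc i) i≢c l → insertAt-cong j (uw i (i≢c ∘ ≡.cong suc)) l })
          (insertAt-linear a b j at)
      ; repeated = λ a~b eq → repeated (suc a~b) (insertAt-cong j eq)
      }

    -- Passing from `inject₁ i` to `suc i` exchanges row `zero` with row `suc i`, and each such
    -- exchange contributes one sign.
    bordered-𝟙 : ∀ j → f (bordered j 𝟙) ≈ sign j * f 𝟙
    bordered-𝟙 = <-weakInduction (λ j → f (bordered j 𝟙) ≈ sign j * f 𝟙) base induction
      where
      base : f (bordered zero 𝟙) ≈ 1# * f 𝟙
      base = trans (cong λ { zero l → refl ; (suc i) l → insertAt-𝟙 zero i l }) (sym (*-identityˡ _))
      induction : ∀ i → f (bordered (inject₁ i) 𝟙) ≈ sign (inject₁ i) * f 𝟙 →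
                  f (bordered (suc i) 𝟙) ≈ sign (suc i) * f 𝟙
      induction i ih = begin
        f (bordered (suc i) 𝟙)             ≈⟨ swap {zero} {suc i} (λ ()) (vanishes zero (suc i) (λ ())) row₀ rowᵢ other ⟩
        - f (bordered (inject₁ i) 𝟙)       ≈⟨ -‿cong ih ⟩
        - (sign (inject₁ i) * f 𝟙)         ≈⟨ solve 2 (λ s x → :- (s :* x) := :- con (+ 1) :* s :* x) refl _ _ ⟩
        - fromInt (+ 1) * sign (inject₁ i) * f 𝟙   ≈⟨ *-congʳ (*-cong (-‿cong 1-homo) (reflexive (≡.cong ((- 1#) ^_) (Finₚ.toℕ-inject₁ i)))) ⟩
        sign (suc i) * f 𝟙                 ∎
        where
        open IntegerCoefficients R using (fromInt; 1-homo)
        row₀ : ∀ l → 𝟙 (suc i) l ≈ insertAt (𝟙 i) (inject₁ i) 0# l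
        row₀ l = sym (trans (insertAt-𝟙 (inject₁ i) i l) (reflexive (≡.cong (λ r → 𝟙 r l) (punchIn-inject₁-same i))))
        rowᵢ : ∀ l → insertAt (𝟙 i) (suc i) 0# l ≈ 𝟙 (inject₁ i) l
        rowᵢ l = trans (insertAt-𝟙 (suc i) i l) (reflexive (≡.cong (λ r → 𝟙 r l) (punchIn-suc-same i)))
        other : ∀ r → r ≢ zero → r ≢ suc i → ∀ l → bordered (suc i) 𝟙 r l ≈ bordered (inject₁ i) 𝟙 r l
        other zero    r≢0 _   l = contradiction ≡.refl r≢0
        other (suc r) _   r≢i l = trans (insertAt-𝟙 (suc i) r l) (trans
          (reflexive (≡.cong (λ p → 𝟙 p l) (≡.sym (punchIn-inject₁-other i r (r≢i ∘ ≡.cong suc)))))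
          (sym (insertAt-𝟙 (inject₁ i) r l)))

    -- The Laplace expansion for an arbitrary alternating function: write the first row in unit
    -- vectors, then use each unit vector to clear its column.
    expand-row₀ : ∀ M → f M ≈ sum (λ j → M zero j * f (bordered j (minor j M)))
    expand-row₀ M = begin
      f M                                              ≈⟨ set-self M zero _ (λ l → sym (sum-𝟙ʳ (M zero) l)) ⟨
      f (M [ zero ≔ _ ])                               ≈⟨ set-sum M zero (M zero) 𝟙 ⟩
      sum (λ j → M zero j * f (M [ zero ≔ 𝟙 j ]))      ≈⟨ sum-cong (λ j → M zero j * f (M [ zero ≔ 𝟙 j ]))
                                                            (λ j → M zero j * f (bordered j (minor j M))) (λ j → *-congˡ (clear j)) ⟩
      sum (λ j → M zero j * f (bordered j (minor j M))) ∎
      where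
      clear : ∀ j → f (M [ zero ≔ 𝟙 j ]) ≈ f (bordered j (minor j M))
      clear j = add-multiples alt (λ i → M (suc i) j) (λ _ → refl) entry
        where
        entry : ∀ i l → M (suc i) l ≈ insertAt (minor j M i) j 0# l + M (suc i) j * 𝟙 j l
        entry i l with punchView j l
        ... | here rewrite Vector.insertAt-lookup (minor j M i) j 0# =
          sym (trans (+-identityˡ _) (trans (*-congˡ (𝟙-diagonal j)) (*-identityʳ _)))
        ... | there k rewrite Vector.insertAt-punchIn (minor j M i) j 0# k =
          sym (trans (+-congˡ (trans (*-congˡ (𝟙-off-diagonal j _ (Finₚ.punchInᵢ≢i j k ∘ ≡.sym))) (zeroʳ _))) (+-identityʳ _))

  -- `expand-row₀` gives `f` the recursion that defines `det`, because `f ∘ bordered j` is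
  -- alternating of one size less. Transposes and products of determinants both follow from this
  -- uniqueness.
  alternating-unique : ∀ {n} {f : Matrix Carrier n n → Carrier} → IsAlternating f → ∀ M → f M ≈ det M * f 𝟙
  alternating-unique {zero}  {f} alt M = trans (IsAlternating.cong alt λ ()) (sym (*-identityˡ _))
  alternating-unique {suc n} {f} alt M = begin
    f M
      ≈⟨ expand-row₀ alt M ⟩
    sum (λ j → M zero j * f (bordered j (minor j M)))
      ≈⟨ sum-cong (λ j → M zero j * f (bordered j (minor j M))) (λ j → M zero j * (det (minor j M) * (sign j * f 𝟙)))
           (λ j → *-congˡ (trans (alternating-unique (bordered-alternating alt j) (minor j M)) (*-congˡ (bordered-𝟙 alt j)))) ⟩
    sum (λ j → M zero j * (det (minor j M) * (sign j * f 𝟙)))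
      ≈⟨ sum-cong (λ j → M zero j * (det (minor j M) * (sign j * f 𝟙))) (λ j → laplace M j * f 𝟙)
           (λ j → solve 4 (λ a d s x → a :* (d :* (s :* x)) := s :* (a :* d) :* x) refl (M zero j) (det (minor j M)) (sign j) (f 𝟙)) ⟩
    sum (λ j → sign j * (M zero j * det (minor j M)) * f 𝟙)
      ≈⟨ *-distribʳ-sum (f 𝟙) (laplace M) ⟨
    det M * f 𝟙 ∎

  det-cong : ∀ {n} {M N : Matrix Carrier n n} → M ≋ N → det M ≈ det N
  det-cong {zero}  h = refl
  det-cong {suc n} {M} {N} h = sum-cong (laplace M) (laplace N) λ j → *-congˡ (*-cong (h zero j) (det-cong λ i k → h (suc i) (punchIn j k)))

  det-linear-column : ∀ {n} c {L M N : Matrix Carrier n n} a b →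
    (∀ i j → j ≢ c → L i j ≈ M i j) → (∀ i j → j ≢ c → L i j ≈ N i j) →
    (∀ i → L i c ≈ a * M i c + b * N i c) → det L ≈ a * det M + b * det N
  det-linear-column {suc n} c {L} {M} {N} a b LM LN at =
    trans (sum-cong (laplace L) (λ j → a * laplace M j + b * laplace N j) term) (sum-linear a b (laplace M) (laplace N))
    where
    term : ∀ j → sign j * (L zero j * det (minor j L)) ≈
      a * (sign j * (M zero j * det (minor j M))) + b * (sign j * (N zero j * det (minor j N)))
    term j with j Finₚ.≟ c
    ... | yes ≡.refl = begin
      sign j * (L zero j * det (minor j L))
        ≈⟨ *-congˡ (*-congʳ (at zero)) ⟩
      sign j * ((a * M zero j + b * N zero j) * det (minor j L))
        ≈⟨ solve 6 (λ s a m b n d → s :* ((a :* m :+ b :* n) :* d) := a :* (s :* (m :* d)) :+ b :* (s :* (n :* d))) refl _ _ _ _ _ _ ⟩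
      a * (sign j * (M zero j * det (minor j L))) + b * (sign j * (N zero j * det (minor j L)))
        ≈⟨ +-cong (*-congˡ (*-congˡ (*-congˡ (det-cong λ i k → LM (suc i) _ (Finₚ.punchInᵢ≢i j k)))))
                  (*-congˡ (*-congˡ (*-congˡ (det-cong λ i k → LN (suc i) _ (Finₚ.punchInᵢ≢i j k))))) ⟩
      a * (sign j * (M zero j * det (minor j M))) + b * (sign j * (N zero j * det (minor j N))) ∎
    ... | no j≢c = begin
      sign j * (L zero j * det (minor j L))
        ≈⟨ *-congˡ (*-congˡ (det-linear-column (punchOut j≢c) a b
             (λ i k k≢ → LM (suc i) _ (k≢ ∘ off k)) (λ i k k≢ → LN (suc i) _ (k≢ ∘ off k))
             (λ i → ≡.subst (λ l → L (suc i) l ≈ a * M (suc i) l + b * N (suc i) l) (≡.sym (Finₚ.punchIn-punchOut j≢c)) (at (suc i))))) ⟩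
      sign j * (L zero j * (a * det (minor j M) + b * det (minor j N)))
        ≈⟨ solve 6 (λ s l a m b n → s :* (l :* (a :* m :+ b :* n)) := a :* (s :* (l :* m)) :+ b :* (s :* (l :* n))) refl _ _ _ _ _ _ ⟩
      a * (sign j * (L zero j * det (minor j M))) + b * (sign j * (L zero j * det (minor j N)))
        ≈⟨ +-cong (*-congˡ (*-congˡ (*-congʳ (LM zero j j≢c)))) (*-congˡ (*-congˡ (*-congʳ (LN zero j j≢c)))) ⟩
      a * (sign j * (M zero j * det (minor j M))) + b * (sign j * (N zero j * det (minor j N))) ∎
      where
      off : ∀ k → punchIn j k ≡ c → k ≡ punchOut j≢c
      off k eq = Finₚ.punchIn-injective j k _ (≡.trans eq (≡.sym (Finₚ.punchIn-punchOut j≢c)))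

  sum-adjacent : ∀ {n} {a b : Fin n} {f : Vector Carrier n} → Adjacent a b →
    (∀ j → j ≢ a → j ≢ b → f j ≈ 0#) → f a + f b ≈ 0# → sum f ≈ 0#
  sum-adjacent {f = f} zero h fa+fb = begin
    f 0F + (f 1F + sum (f ∘ Fin.suc ∘ Fin.suc))  ≈⟨ +-assoc _ _ _ ⟨
    f 0F + f 1F + sum (f ∘ Fin.suc ∘ Fin.suc)    ≈⟨ +-cong fa+fb (sum-zero {f = f ∘ Fin.suc ∘ Fin.suc} λ i → h (suc (suc i)) (λ ()) (λ ())) ⟩
    0# + 0#                              ≈⟨ +-identityˡ 0# ⟩
    0#                                   ∎
  sum-adjacent (suc a~b) h fa+fb = trans (+-cong (h zero (λ ()) (λ ()))
    (sum-adjacent a~b (λ j j≢a j≢b → h (suc j) (j≢a ∘ Finₚ.suc-injective) (j≢b ∘ Finₚ.suc-injective)) fa+fb))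
    (+-identityˡ 0#)

  -- Deleting any other column leaves two equal neighbours, so by induction only the terms of `a`
  -- and `b` survive. Their minors agree and their signs are opposite.
  det-repeated-column : ∀ {n} {a b} {M : Matrix Carrier n n} → Adjacent a b → (∀ i → M i a ≈ M i b) → det M ≈ 0#
  det-repeated-column {suc n} {a} {b} {M} a~b eq = sum-adjacent a~b other cancel
    where
    other : ∀ j → j ≢ a → j ≢ b → sign j * (M zero j * det (minor j M)) ≈ 0#
    other j j≢a j≢b = begin
      sign j * (M zero j * det (minor j M))   ≈⟨ *-congˡ (*-congˡ (det-repeated-column (punchOut-adjacent a~b j j≢a j≢b) eq′)) ⟩
      sign j * (M zero j * 0#)                ≈⟨ trans (*-congˡ (zeroʳ _)) (zeroʳ _) ⟩
      0#                                      ∎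
      where
      eq′ : ∀ i → minor j M i (punchOut j≢a) ≈ minor j M i (punchOut j≢b)
      eq′ i rewrite Finₚ.punchIn-punchOut j≢a | Finₚ.punchIn-punchOut j≢b = eq (suc i)
    minors : minor a M ≋ minor b M
    minors i k with punchIn-adjacent a~b k
    ... | inj₁ p       = reflexive (≡.cong (M (suc i)) p)
    ... | inj₂ (p , q) rewrite p | q = sym (eq (suc i))
    cancel : sign a * (M zero a * det (minor a M)) + sign b * (M zero b * det (minor b M)) ≈ 0#
    cancel = begin
      sign a * (M zero a * det (minor a M)) + sign b * (M zero b * det (minor b M))
        ≈⟨ +-congˡ (*-cong (trans (reflexive (≡.cong ((- 1#) ^_) (toℕ-adjacent a~b)))
             (-1*x≈-x (sign a))) (*-cong (sym (eq zero)) (sym (det-cong minors)))) ⟩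
      sign a * (M zero a * det (minor a M)) + (- sign a) * (M zero a * det (minor a M))
        ≈⟨ solve 2 (λ s x → s :* x :+ (:- s) :* x := con (+ 0)) refl _ _ ⟩
      0# ∎

  -- Expansion along the first row shows alternation in the columns; alternation in the rows is
  -- deduced from it through `det-ᵀ`.
  detᵀ-alternating : ∀ {n} → IsAlternating {n} {n} (λ M → det (M ᵀ))
  detᵀ-alternating = record
    { cong     = λ h → det-cong λ i j → h j i
    ; linear   = λ c a b uv uw at → det-linear-column c a b (λ i j j≢c → uv j j≢c i) (λ i j j≢c → uw j j≢c i) at
    ; repeated = det-repeated-column
    }

  det-𝟙 : ∀ {n} → det (𝟙 {n}) ≈ 1#
  det-𝟙 {zero}  = refl
  det-𝟙 {suc n} = begin
    det (𝟙 {suc n})          ≈⟨ sum-single {f = laplace (𝟙 {suc n})} zero (λ { zero i≢0 → contradiction ≡.refl i≢0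
                                  ; (suc i) _ → trans (*-congˡ (zeroˡ _)) (zeroʳ _) }) ⟩
    1# * (1# * det (𝟙 {n}))  ≈⟨ trans (*-identityˡ _) (*-identityˡ _) ⟩
    det (𝟙 {n})              ≈⟨ det-𝟙 {n} ⟩
    1#                       ∎

  𝟙-symmetric : ∀ {n} (i j : Fin n) → 𝟙 i j ≈ 𝟙 j i
  𝟙-symmetric zero    zero    = refl
  𝟙-symmetric zero    (suc j) = refl
  𝟙-symmetric (suc i) zero    = refl
  𝟙-symmetric (suc i) (suc j) = 𝟙-symmetric i j

  det-ᵀ : ∀ {n} (M : Matrix Carrier n n) → det (M ᵀ) ≈ det M
  det-ᵀ {n} M = begin
    det (M ᵀ)              ≈⟨ alternating-unique detᵀ-alternating M ⟩
    det M * det (𝟙 {n} ᵀ)  ≈⟨ *-congˡ (trans (det-cong {n} (λ i j → 𝟙-symmetric j i)) (det-𝟙 {n})) ⟩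
    det M * 1#             ≈⟨ *-identityʳ _ ⟩
    det M                  ∎

  det-alternating : ∀ {n} → IsAlternating {n} {n} det
  det-alternating = record
    { cong     = det-cong
    ; linear   = λ c {u} {v} {w} a b uv uw at → trans (sym (det-ᵀ u)) (trans (ᵀ.linear c a b uv uw at)
                   (+-cong (*-congˡ (det-ᵀ v)) (*-congˡ (det-ᵀ w))))
    ; repeated = λ {a} {b} {v} a~b eq → trans (sym (det-ᵀ v)) (ᵀ.repeated a~b eq)
    }
    where module ᵀ {n} = IsAlternating (detᵀ-alternating {n})

  -- As a function of `M` the left side is alternating, with value `det N` at `𝟙`.
  det-⊗ : ∀ {n} (M N : Matrix Carrier n n) → det (M ⊗ N) ≈ det M * det N
  det-⊗ {n} M N = trans (alternating-unique alt M) (*-congˡ (det-cong λ i j → sum-𝟙ˡ (λ k → N k j) i))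
    where
    module det = IsAlternating (det-alternating {n})
    alt : IsAlternating (λ M → det (M ⊗ N))
    alt = record
      { cong     = λ h → det-cong λ i j → sum-cong-≋ λ k → *-congʳ (h i k)
      ; linear   = λ c {u} {v} {w} a b uv uw at → det.linear c a b
          (λ i i≢c j → sum-cong-≋ λ k → *-congʳ (uv i i≢c k)) (λ i i≢c j → sum-cong-≋ λ k → *-congʳ (uw i i≢c k))
          λ j → trans (sum-cong-≋ λ k → trans (*-congʳ (at k))
            (solve 5 (λ a x b y n → (a :* x :+ b :* y) :* n := a :* (x :* n) :+ b :* (y :* n)) refl _ _ _ _ _))
            (sum-linear a b (λ k → v c k * N k j) (λ k → w c k * N k j))
      ; repeated = λ a~b eq → det.repeated a~b λ j → sum-cong-≋ λ k → *-congʳ (eq k)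
      }

  ⊗-assoc : ∀ {k l m n} (A : Matrix Carrier k l) (B : Matrix Carrier l m) (C : Matrix Carrier m n) →
    A ⊗ B ⊗ C ≋ A ⊗ (B ⊗ C)
  ⊗-assoc A B C i j = begin
    sum (λ p → sum (λ q → A i q * B q p) * C p j)
      ≈⟨ sum-cong-≋ (λ p → *-distribʳ-sum (C p j) (λ q → A i q * B q p)) ⟩
    sum (λ p → sum (λ q → A i q * B q p * C p j))
      ≈⟨ ∑-comm (λ p q → A i q * B q p * C p j) ⟩
    sum (λ q → sum (λ p → A i q * B q p * C p j))
      ≈⟨ sum-cong-≋ (λ q → trans (sum-cong-≋ λ p → *-assoc (A i q) (B q p) (C p j)) (sym (*-distribˡ-sum (A i q) (λ p → B q p * C p j)))) ⟩
    sum (λ q → A i q * sum (λ p → B q p * C p j)) ∎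

  ⊗-congˡ : ∀ {k l m} (A : Matrix Carrier k l) {B C : Matrix Carrier l m} → B ≋ C → A ⊗ B ≋ A ⊗ C
  ⊗-congˡ A h i j = sum-cong-≋ λ k → *-congˡ (h k j)

  -- Cramer: replacing row c of U by the vanishing combination of the rows multiplies det U by x c.
  kernel-trivial : ∀ {n} (U : Matrix Carrier n n) (x : Vector Carrier n) → (∀ j → sum (λ i → x i * U i j) ≈ 0#) →
    ∀ c → x c * det U ≈ 0#
  kernel-trivial {n} U x xU≈0 c = begin
    x c * det U                              ≈⟨ *-congˡ (set-self U c (U c) (λ _ → refl)) ⟨
    x c * det (U [ c ≔ U c ])                ≈⟨ sum-single c (λ i i≢c → trans (*-congˡ (vanishes c i (i≢c ∘ ≡.sym) (U [ c ≔ U i ])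
                                                 (λ j → trans (≔-same U c (U i) j) (sym (≔-other U c (U i) i i≢c j))))) (zeroʳ _)) ⟨
    sum (λ i → x i * det (U [ c ≔ U i ]))    ≈⟨ set-sum U c x U ⟨
    det (U [ c ≔ _ ])                        ≈⟨ linear c {v = U′} {w = U′} 0# 0# (λ _ _ _ → refl) (λ _ _ _ → refl)
                                                  (λ j → trans (≔-same U c _ j)
                                                      (trans (xU≈0 j) (sym (trans (+-cong (zeroˡ _) (zeroˡ _)) (+-identityˡ _))))) ⟩
    0# * det U′ + 0# * det U′                ≈⟨ trans (+-cong (zeroˡ _) (zeroˡ _)) (+-identityˡ _) ⟩
    0#                                       ∎
    where
    open IsAlternating (det-alternating {n})
    open Alternating (det-alternating {n})
    U′ = U [ c ≔ (λ j → sum (λ i → x i * U i j)) ]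

  -- The rows of X = V U - 1 are killed by V, because V U V = V. By `kernel-trivial` they are then
  -- killed by `det V`, a unit since det U det V = 1.
  left-inverse⇒right-inverse : ∀ {n} (U V : Matrix Carrier n n) → U ⊗ V ≋ 𝟙 → V ⊗ U ≋ 𝟙
  left-inverse⇒right-inverse {n} U V UV≋𝟙 i j = begin
    (V ⊗ U) i j                          ≈⟨ solve 2 (λ p q → p := p :- q :+ q) refl ((V ⊗ U) i j) (𝟙 i j) ⟩
    X i j + 𝟙 i j                        ≈⟨ +-congʳ (X≈0 i j) ⟩
    0# + 𝟙 i j                           ≈⟨ +-identityˡ _ ⟩
    𝟙 i j                                ∎
    where
    open IntegerCoefficients R using (fromInt)
    X : Matrix Carrier n n
    X i j = (V ⊗ U) i j - 𝟙 i j
    detV*detU : det V * det U ≈ 1#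
    detV*detU = trans (*-comm _ _) (trans (sym (det-⊗ U V)) (trans (det-cong UV≋𝟙) (det-𝟙 {n})))
    VUV≋V : V ⊗ U ⊗ V ≋ V
    VUV≋V i l = trans (⊗-assoc V U V i l) (trans (⊗-congˡ V UV≋𝟙 i l) (sum-𝟙ʳ (V i) l))
    XV≈0 : ∀ i l → sum (λ k → X i k * V k l) ≈ 0#
    XV≈0 i l = begin
      sum (λ k → X i k * V k l)
        ≈⟨ sum-cong-≋ (λ k → solve 3 (λ p q u → (p :- q) :* u := con (+ 1) :* (p :* u) :+ (:- con (+ 1)) :* (q :* u)) refl ((V ⊗ U) i k) (𝟙 i k) (V k l)) ⟩
      sum (λ k → fromInt (+ 1) * ((V ⊗ U) i k * V k l) + - fromInt (+ 1) * (𝟙 i k * V k l))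
        ≈⟨ sum-linear (fromInt (+ 1)) (- fromInt (+ 1)) (λ k → (V ⊗ U) i k * V k l) (λ k → 𝟙 i k * V k l) ⟩
      fromInt (+ 1) * (V ⊗ U ⊗ V) i l + - fromInt (+ 1) * sum (λ k → 𝟙 i k * V k l)
        ≈⟨ +-cong (*-congˡ (VUV≋V i l)) (*-congˡ (sum-𝟙ˡ (λ k → V k l) i)) ⟩
      fromInt (+ 1) * V i l + - fromInt (+ 1) * V i l
        ≈⟨ solve 1 (λ u → con (+ 1) :* u :+ (:- con (+ 1)) :* u := con (+ 0)) refl (V i l) ⟩
      0# ∎
    X≈0 : ∀ i j → X i j ≈ 0#
    X≈0 i j = begin
      X i j                      ≈⟨ *-identityʳ _ ⟨
      X i j * 1#                 ≈⟨ *-congˡ detV*detU ⟨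
      X i j * (det V * det U)    ≈⟨ *-assoc _ _ _ ⟨
      X i j * det V * det U      ≈⟨ *-congʳ (kernel-trivial V (X i) (XV≈0 i) j) ⟩
      0# * det U                 ≈⟨ zeroˡ _ ⟩
      0#                         ∎

  -- The first row vanishes outside the left block, and each minor that remains in the expansion has
  -- the same shape with the same lower right block.
  det-block-lower : ∀ m {n} (M : Matrix Carrier (m ℕ.+ n) (m ℕ.+ n)) → (∀ i j → M (i ↑ˡ n) (m ↑ʳ j) ≈ 0#) →
    det M ≈ det (λ i j → M (i ↑ˡ n) (j ↑ˡ n)) * det (λ i j → M (m ↑ʳ i) (m ↑ʳ j))
  det-block-lower zero    M h = sym (*-identityˡ _)
  det-block-lower (suc m) {n} M h = begin
    det M
      ≈⟨ sum-++ (suc m) (λ j → sign j * (M zero j * det (minor j M))) ⟩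
    sum (λ j → sign (j ↑ˡ n) * (M zero (j ↑ˡ n) * det (minor (j ↑ˡ n) M))) +
    sum (λ j → sign (suc m ↑ʳ j) * (M zero (suc m ↑ʳ j) * det (minor (suc m ↑ʳ j) M)))
      ≈⟨ +-cong (sum-cong-≋ left) (sum-zero λ j → trans (*-congˡ (trans (*-congʳ (h zero j)) (zeroˡ _))) (zeroʳ _)) ⟩
    sum (λ j → sign j * (A zero j * det (minor j A)) * det D) + 0#
      ≈⟨ trans (+-identityʳ _) (sym (*-distribʳ-sum (det D) (laplace A))) ⟩
    det A * det D ∎
    where
    A = λ i j → M (i ↑ˡ n) (j ↑ˡ n)
    D = λ i j → M (suc m ↑ʳ i) (suc m ↑ʳ j)
    left : ∀ j → sign (j ↑ˡ n) * (M zero (j ↑ˡ n) * det (minor (j ↑ˡ n) M)) ≈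
                 sign j * (A zero j * det (minor j A)) * det D
    left j = begin
      sign (j ↑ˡ n) * (M zero (j ↑ˡ n) * det (minor (j ↑ˡ n) M))
        ≈⟨ *-cong (reflexive (≡.cong ((- 1#) ^_) (Finₚ.toℕ-↑ˡ j n))) (*-congˡ (det-block-lower m (minor (j ↑ˡ n) M)
             (λ i k → trans (reflexive (≡.cong (M (suc i ↑ˡ n)) (punchIn-↑ʳ n j k))) (h (suc i) k)))) ⟩
      sign j * (A zero j * (det (λ i k → minor (j ↑ˡ n) M (i ↑ˡ n) (k ↑ˡ n)) * det (λ i k → minor (j ↑ˡ n) M (m ↑ʳ i) (m ↑ʳ k))))
        ≈⟨ *-congˡ (*-congˡ (*-cong
             (det-cong λ i k → reflexive (≡.cong (M (suc i ↑ˡ n)) (punchIn-↑ˡ n j k)))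
             (det-cong λ i k → reflexive (≡.cong (M (suc m ↑ʳ i)) (punchIn-↑ʳ n j k))))) ⟩
      sign j * (A zero j * (det (minor j A) * det D))
        ≈⟨ trans (*-congˡ (sym (*-assoc _ _ _))) (sym (*-assoc _ _ _)) ⟩
      sign j * (A zero j * det (minor j A)) * det D ∎

  det-block-upper : ∀ m {n} (M : Matrix Carrier (m ℕ.+ n) (m ℕ.+ n)) → (∀ i j → M (m ↑ʳ i) (j ↑ˡ n) ≈ 0#) →
    det M ≈ det (λ i j → M (i ↑ˡ n) (j ↑ˡ n)) * det (λ i j → M (m ↑ʳ i) (m ↑ʳ j))
  det-block-upper m {n} M h = begin
    det M        ≈⟨ det-ᵀ M ⟨
    det (M ᵀ)    ≈⟨ det-block-lower m (M ᵀ) (λ i j → h j i) ⟩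
    _            ≈⟨ *-cong (det-ᵀ (λ i j → M (i ↑ˡ n) (j ↑ˡ n))) (det-ᵀ (λ i j → M (m ↑ʳ i) (m ↑ʳ j))) ⟩
    det (λ i j → M (i ↑ˡ n) (j ↑ˡ n)) * det (λ i j → M (m ↑ʳ i) (m ↑ʳ j)) ∎

-- Inequalities between rational numbers.

open RationalLemmas
open ℝ using (seq; cauchy)

module RationalOrder where
  open import Data.Rational.Base using (_+_; _*_; -_; _-_; ∣_∣; _≤_; _<_)
  open +-*-Solver

  p≤q⇒0≤q-p : ∀ {p q} → p ≤ q → 0ℚ ≤ q - p
  p≤q⇒0≤q-p {p} {q} p≤q = ≡.subst (_≤ q - p) (ℚₚ.+-inverseʳ p) (ℚₚ.+-monoˡ-≤ (- p) p≤q)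

  0≤q-p⇒p≤q : ∀ {p q} → 0ℚ ≤ q - p → p ≤ q
  0≤q-p⇒p≤q {p} {q} h = ≡.subst₂ _≤_ (ℚₚ.+-identityˡ p)
    (solve 2 (λ p q → q :- p :+ p := q) ≡.refl p q) (ℚₚ.+-monoˡ-≤ p h)

  p<q⇒0<q-p : ∀ {p q} → p < q → 0ℚ < q - p
  p<q⇒0<q-p {p} {q} p<q = ≡.subst (_< q - p) (ℚₚ.+-inverseʳ p) (ℚₚ.+-monoˡ-< (- p) p<q)

  0<q-p⇒p<q : ∀ {p q} → 0ℚ < q - p → p < q
  0<q-p⇒p<q {p} {q} h = ≡.subst₂ _<_ (ℚₚ.+-identityˡ p)
    (solve 2 (λ p q → q :- p :+ p := q) ≡.refl p q) (ℚₚ.+-monoˡ-< p h)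

  0≤+ : ∀ {p q} → 0ℚ ≤ p → 0ℚ ≤ q → 0ℚ ≤ p + q
  0≤+ = ℚₚ.+-mono-≤

  0≤* : ∀ {p q} → 0ℚ ≤ p → 0ℚ ≤ q → 0ℚ ≤ p * q
  0≤* {p} {q} 0≤p 0≤q = ℚₚ.nonNegative⁻¹ (p * q)
    {{ℚₚ.nonNeg*nonNeg⇒nonNeg p {{ℚ.nonNegative 0≤p}} q {{ℚ.nonNegative 0≤q}}}}

  0≤p² : ∀ p → 0ℚ ≤ p * p
  0≤p² p with ℚₚ.≤-total 0ℚ p
  ... | inj₁ 0≤p = 0≤* 0≤p 0≤p
  ... | inj₂ p≤0 = ≡.subst (0ℚ ≤_) (solve 1 (λ p → (con 0ℚ :- p) :* (con 0ℚ :- p) := p :* p) ≡.refl p)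
    (0≤* (p≤q⇒0≤q-p p≤0) (p≤q⇒0≤q-p p≤0))

  quotient : ∀ {p q} → 0ℚ < p → 0ℚ < q → ∃[ r ] (0ℚ < r × r * q ≡ p)
  quotient {p} {q} 0<p 0<q = p * ℚ.1/ q , *-pos 0<p (ℚₚ.positive⁻¹ (ℚ.1/ q) {{ℚₚ.1/pos⇒pos q}}) ,
    ≡.trans (ℚₚ.*-assoc p (ℚ.1/ q) q) (≡.trans (≡.cong (p *_) (ℚₚ.*-inverseˡ q)) (ℚₚ.*-identityʳ p))
    where
    instance
      q-positive : ℚ.Positive q
      q-positive = ℚ.positive 0<q
      q-nonZero : ℚ.NonZero q
      q-nonZero = ℚₚ.pos⇒nonZero q

  ∣p∣<r⇒p<r : ∀ {p r} → ∣ p ∣ < r → p < r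
  ∣p∣<r⇒p<r {p} h = ℚₚ.≤-<-trans (p≤∣p∣ p) h

open RationalOrder

-- The commutative ring of real numbers.

module RealEquality where
  open Real
  open import Data.Rational.Base using (∣_∣)
  open +-*-Solver

  ≗⇒≈ : ∀ {x y} → (∀ n → seq x n ≡ seq y n) → x ≈ y
  ≗⇒≈ {x} {y} h ε 0<ε = 0 , λ n _ → ≡.subst (ℚ._< ε)
    (≡.sym (≡.cong ∣_∣ (≡.trans (≡.cong (ℚ._- seq y n) (h n)) (ℚₚ.+-inverseʳ (seq y n))))) 0<ε

  ≈-refl : ∀ {x} → x ≈ x
  ≈-refl {x} = ≗⇒≈ {x} {x} λ _ → ≡.refl

  ≈-sym : ∀ {x y} → x ≈ y → y ≈ x
  ≈-sym {x} {y} h ε 0<ε = proj₁ (h ε 0<ε) , λ n N≤n →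
    ≡.subst (ℚ._< ε) (∣-∣-sym (seq x n) (seq y n)) (proj₂ (h ε 0<ε) n N≤n)

  -- A sum of two null sequences is null.
  ≈-by : ∀ {x y u v s t} → x ≈ y → u ≈ v →
    (∀ n → (seq x n ℚ.- seq y n) ℚ.+ (seq u n ℚ.- seq v n) ≡ seq s n ℚ.- seq t n) → s ≈ t
  ≈-by {x} {y} {u} {v} {s} {t} x≈y u≈v h ε 0<ε with x≈y (½ ℚ.* ε) (½*-pos 0<ε) | u≈v (½ ℚ.* ε) (½*-pos 0<ε)
  ... | N , hN | M , hM = N ℕ.⊔ M , λ n p → begin-strict
    ∣ seq s n ℚ.- seq t n ∣                                  ≡⟨ ≡.cong ∣_∣ (h n) ⟨
    ∣ (seq x n ℚ.- seq y n) ℚ.+ (seq u n ℚ.- seq v n) ∣      ≤⟨ ℚₚ.∣p+q∣≤∣p∣+∣q∣ (seq x n ℚ.- seq y n) (seq u n ℚ.- seq v n) ⟩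
    ∣ seq x n ℚ.- seq y n ∣ ℚ.+ ∣ seq u n ℚ.- seq v n ∣      <⟨ ℚₚ.+-mono-< (hN n (ℕₚ.m⊔n≤o⇒m≤o N M p)) (hM n (ℕₚ.m⊔n≤o⇒n≤o N M p)) ⟩
    ½ ℚ.* ε ℚ.+ ½ ℚ.* ε                                      ≡⟨ ½ε+½ε ε ⟩
    ε                                                        ∎
    where open ℚₚ.≤-Reasoning

  ≈-trans : ∀ {x y z} → x ≈ y → y ≈ z → x ≈ z
  ≈-trans {x} {y} {z} x≈y y≈z = ≈-by {x} {y} {y} {z} {x} {z} x≈y y≈z λ n →
    solve 3 (λ x y z → (x :- y) :+ (y :- z) := x :- z) ≡.refl (seq x n) (seq y n) (seq z n)

  +-cong : ∀ {x y u v} → x ≈ y → u ≈ v → x + u ≈ y + v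
  +-cong {x} {y} {u} {v} x≈y u≈v = ≈-by {x} {y} {u} {v} {x + u} {y + v} x≈y u≈v λ n →
    solve 4 (λ x y u v → (x :- y) :+ (u :- v) := (x :+ u) :- (y :+ v)) ≡.refl (seq x n) (seq y n) (seq u n) (seq v n)

  -‿cong : ∀ {x y} → x ≈ y → - x ≈ - y
  -‿cong {x} {y} x≈y = ≈-by {y} {x} {0#} {0#} { - x} { - y} (≈-sym {x} {y} x≈y) (≈-refl {0#}) λ n →
    solve 2 (λ x y → (y :- x) :+ (con 0ℚ :- con 0ℚ) := (:- x) :- (:- y)) ≡.refl (seq x n) (seq y n)

  *-congˡ : ∀ {x u v} → u ≈ v → x * u ≈ x * v
  *-congˡ {x} {u} {v} u≈v ε 0<ε = N ℕ.⊔ M , λ n p → close n (ℕₚ.m⊔n≤o⇒m≤o N M p) (ℕₚ.m⊔n≤o⇒n≤o N M p)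
    where
    open ℚₚ.≤-Reasoning
    B = proj₁ (bounded x)
    0<B = proj₁ (proj₂ (bounded x))
    N = proj₁ (proj₂ (proj₂ (bounded x)))
    x≤B = proj₂ (proj₂ (proj₂ (bounded x)))
    δ = proj₁ (quotient 0<ε 0<B)
    0<δ = proj₁ (proj₂ (quotient 0<ε 0<B))
    M = proj₁ (u≈v δ 0<δ)
    hM = proj₂ (u≈v δ 0<δ)
    close : ∀ n → N ℕ.≤ n → M ℕ.≤ n → ∣ seq x n ℚ.* seq u n ℚ.- seq x n ℚ.* seq v n ∣ ℚ.< ε
    close n N≤n M≤n = begin-strict
      ∣ seq x n ℚ.* seq u n ℚ.- seq x n ℚ.* seq v n ∣
        ≡⟨ ≡.cong ∣_∣ (solve 3 (λ x u v → x :* u :- x :* v := x :* (u :- v)) ≡.refl (seq x n) (seq u n) (seq v n)) ⟩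
      ∣ seq x n ℚ.* (seq u n ℚ.- seq v n) ∣
        ≡⟨ ℚₚ.∣p*q∣≡∣p∣*∣q∣ (seq x n) (seq u n ℚ.- seq v n) ⟩
      ∣ seq x n ∣ ℚ.* ∣ seq u n ℚ.- seq v n ∣
        ≤⟨ ℚₚ.*-monoʳ-≤-nonNeg ∣ seq u n ℚ.- seq v n ∣ {{ℚₚ.∣-∣-nonNeg (seq u n ℚ.- seq v n)}} (x≤B n N≤n) ⟩
      B ℚ.* ∣ seq u n ℚ.- seq v n ∣
        <⟨ ℚₚ.*-monoʳ-<-pos B {{ℚ.positive 0<B}} (hM n M≤n) ⟩
      B ℚ.* δ                            ≡⟨ ℚₚ.*-comm B δ ⟩
      δ ℚ.* B                            ≡⟨ proj₂ (proj₂ (quotient 0<ε 0<B)) ⟩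
      ε ∎

  *-comm : ∀ x y → x * y ≈ y * x
  *-comm x y = ≗⇒≈ {x * y} {y * x} λ n → ℚₚ.*-comm (seq x n) (seq y n)

  *-cong : ∀ {x y u v} → x ≈ y → u ≈ v → x * u ≈ y * v
  *-cong {x} {y} {u} {v} x≈y u≈v = ≈-trans {x * u} {x * v} {y * v} (*-congˡ {x} {u} {v} u≈v)
    (≈-trans {x * v} {v * x} {y * v} (*-comm x v) (≈-trans {v * x} {v * y} {y * v} (*-congˡ {v} {x} {y} x≈y) (*-comm v y)))

ℝ-commutativeRing : CommutativeRing 0ℓ 0ℓ
ℝ-commutativeRing = record
  { Carrier = ℝ
  ; _≈_ = _≈_
  ; _+_ = _+_
  ; _*_ = _*_
  ; -_ = -_
  ; 0# = 0#
  ; 1# = 1#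
  ; isCommutativeRing = record
    { isRing = record
      { +-isAbelianGroup = record
        { isGroup = record
          { isMonoid = record
            { isSemigroup = record
              { isMagma = record
                { isEquivalence = record
                  { refl  = λ {x} → ≈-refl {x}
                  ; sym   = λ {x} {y} → ≈-sym {x} {y}
                  ; trans = λ {x} {y} {z} → ≈-trans {x} {y} {z}
                  }
                ; ∙-cong = λ {x} {y} {u} {v} → +-cong {x} {y} {u} {v}
                }
              ; assoc = λ x y z → ≗⇒≈ {x + y + z} {x + (y + z)} λ n → ℚₚ.+-assoc (seq x n) (seq y n) (seq z n)
              }
            ; identity = (λ x → ≗⇒≈ {0# + x} {x} λ n → ℚₚ.+-identityˡ (seq x n))
                       , (λ x → ≗⇒≈ {x + 0#} {x} λ n → ℚₚ.+-identityʳ (seq x n))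
            }
          ; inverse = (λ x → ≗⇒≈ {(- x) + x} {0#} λ n → ℚₚ.+-inverseˡ (seq x n))
                    , (λ x → ≗⇒≈ {x + (- x)} {0#} λ n → ℚₚ.+-inverseʳ (seq x n))
          ; ⁻¹-cong = λ {x} {y} → -‿cong {x} {y}
          }
        ; comm = λ x y → ≗⇒≈ {x + y} {y + x} λ n → ℚₚ.+-comm (seq x n) (seq y n)
        }
      ; *-cong = λ {x} {y} {u} {v} → *-cong {x} {y} {u} {v}
      ; *-assoc = λ x y z → ≗⇒≈ {x * y * z} {x * (y * z)} λ n → ℚₚ.*-assoc (seq x n) (seq y n) (seq z n)
      ; *-identity = (λ x → ≗⇒≈ {1# * x} {x} λ n → ℚₚ.*-identityˡ (seq x n))
                   , (λ x → ≗⇒≈ {x * 1#} {x} λ n → ℚₚ.*-identityʳ (seq x n))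
      ; distrib = (λ x y z → ≗⇒≈ {x * (y + z)} {x * y + x * z} λ n → ℚₚ.*-distribˡ-+ (seq x n) (seq y n) (seq z n))
                , (λ x y z → ≗⇒≈ {(y + z) * x} {y * x + z * x} λ n → ℚₚ.*-distribʳ-+ (seq x n) (seq y n) (seq z n))
      }
    ; *-comm = *-comm
    }
  }
  where
  open Real
  open RealEquality

-- The order of the real numbers, and square roots.

-- A positively formulated version of 0 ≤ x. The order itself is a negation, from which sums and
-- products of inequalities cannot be formed directly; `≤⇒nonNeg` and `nonNeg⇒≤` translate.
NonNegative : ℝ → Set
NonNegative x = ∀ ε → 0ℚ ℚ.< ε → ∃[ N ] (∀ n → N ℕ.≤ n → 0ℚ ℚ.≤ seq x n ℚ.+ ε)

module RealOrder where
  open Real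
  open +-*-Solver

  nonNeg-pointwise : ∀ {x} → (∀ n → 0ℚ ℚ.≤ seq x n) → NonNegative x
  nonNeg-pointwise h ε 0<ε = 0 , λ n _ → 0≤+ (h n) (ℚₚ.<⇒≤ 0<ε)

  nonNeg-fromℚ : ∀ {q} → 0ℚ ℚ.≤ q → NonNegative (fromℚ q)
  nonNeg-fromℚ {q} h = nonNeg-pointwise {fromℚ q} λ _ → h

  fromℚ-nonNeg : ∀ {q} → NonNegative (fromℚ q) → 0ℚ ℚ.≤ q
  fromℚ-nonNeg {q} h = ℚₚ.≮⇒≥ λ q<0 →
    -- With ε = -q/2 the condition reads q/2 ≥ 0, which contradicts q < 0.
    let r = ½ ℚ.* (0ℚ ℚ.- q)
        (N , hN) = h r (½*-pos (p<q⇒0<q-p q<0))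
    in ℚₚ.<-irrefl ≡.refl (ℚₚ.<-≤-trans q<0 (≡.subst (0ℚ ℚ.≤_) (double q)
         (0≤+ (hN N ℕₚ.≤-refl) (hN N ℕₚ.≤-refl))))
    where
    double : ∀ q → (q ℚ.+ ½ ℚ.* (0ℚ ℚ.- q)) ℚ.+ (q ℚ.+ ½ ℚ.* (0ℚ ℚ.- q)) ≡ q
    double = solve 1 (λ q → (q :+ con ½ :* (con 0ℚ :- q)) :+ (q :+ con ½ :* (con 0ℚ :- q)) := q) ≡.refl

  nonNeg-resp-≈ : ∀ {x y} → x ≈ y → NonNegative x → NonNegative y
  nonNeg-resp-≈ {x} {y} x≈y 0≤x ε 0<ε with x≈y (½ ℚ.* ε) (½*-pos 0<ε) | 0≤x (½ ℚ.* ε) (½*-pos 0<ε)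
  ... | N , hN | M , hM = N ℕ.⊔ M , λ n p → ≡.subst (0ℚ ℚ.≤_)
    (≡.trans (solve 3 (λ x y ε → (x :+ ε) :+ (ε :- (x :- y)) := y :+ (ε :+ ε)) ≡.refl (seq x n) (seq y n) (½ ℚ.* ε))
      (≡.cong (seq y n ℚ.+_) (½ε+½ε ε)))
    (0≤+ (hM n (ℕₚ.m⊔n≤o⇒n≤o N M p)) (ℚₚ.<⇒≤ (p<q⇒0<q-p (∣p∣<r⇒p<r (hN n (ℕₚ.m⊔n≤o⇒m≤o N M p))))))

  nonNeg-+ : ∀ {x y} → NonNegative x → NonNegative y → NonNegative (x + y)
  nonNeg-+ {x} {y} 0≤x 0≤y ε 0<ε with 0≤x (½ ℚ.* ε) (½*-pos 0<ε) | 0≤y (½ ℚ.* ε) (½*-pos 0<ε)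
  ... | N , hN | M , hM = N ℕ.⊔ M , λ n p → ≡.subst (0ℚ ℚ.≤_)
    (≡.trans (solve 3 (λ x y ε → (x :+ ε) :+ (y :+ ε) := (x :+ y) :+ (ε :+ ε)) ≡.refl (seq x n) (seq y n) (½ ℚ.* ε))
      (≡.cong (seq x n ℚ.+ seq y n ℚ.+_) (½ε+½ε ε)))
    (0≤+ (hN n (ℕₚ.m⊔n≤o⇒m≤o N M p)) (hM n (ℕₚ.m⊔n≤o⇒n≤o N M p)))

  nonNeg-square : ∀ x → NonNegative (x * x)
  nonNeg-square x = nonNeg-pointwise {x * x} λ n → 0≤p² (seq x n)

  -- Only factors of opposite sign can make the product negative. Then the negative one is at least
  -- -δ and the other at most C.
  product-bound : ∀ {p q δ C} → 0ℚ ℚ.≤ δ → 0ℚ ℚ.≤ C → p ℚ.≤ C → q ℚ.≤ C → 0ℚ ℚ.≤ p ℚ.+ δ → 0ℚ ℚ.≤ q ℚ.+ δ →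
    0ℚ ℚ.≤ p ℚ.* q ℚ.+ δ ℚ.* C
  product-bound {p} {q} {δ} {C} 0≤δ 0≤C p≤C q≤C 0≤p+δ 0≤q+δ with ℚₚ.≤-total 0ℚ p | ℚₚ.≤-total 0ℚ q
  ... | inj₁ 0≤p | inj₁ 0≤q = 0≤+ (0≤* 0≤p 0≤q) (0≤* 0≤δ 0≤C)
  ... | inj₂ p≤0 | inj₂ q≤0 = 0≤+ (≡.subst (0ℚ ℚ.≤_) (solve 2 (λ p q → (con 0ℚ :- p) :* (con 0ℚ :- q) := p :* q) ≡.refl p q)
                                 (0≤* (p≤q⇒0≤q-p p≤0) (p≤q⇒0≤q-p q≤0))) (0≤* 0≤δ 0≤C)
  ... | inj₁ 0≤p | inj₂ q≤0 = ≡.subst (0ℚ ℚ.≤_) (solve 4 (λ p q δ C → p :* (q :+ δ) :+ δ :* (C :- p) := p :* q :+ δ :* C) ≡.refl p q δ C)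
                                 (0≤+ (0≤* 0≤p 0≤q+δ) (0≤* 0≤δ (p≤q⇒0≤q-p p≤C)))
  ... | inj₂ p≤0 | inj₁ 0≤q = ≡.subst (0ℚ ℚ.≤_) (solve 4 (λ p q δ C → (p :+ δ) :* q :+ δ :* (C :- q) := p :* q :+ δ :* C) ≡.refl p q δ C)
                                 (0≤+ (0≤* 0≤p+δ 0≤q) (0≤* 0≤δ (p≤q⇒0≤q-p q≤C)))

  nonNeg-* : ∀ {x y} → NonNegative x → NonNegative y → NonNegative (x * y)
  nonNeg-* {x} {y} 0≤x 0≤y ε 0<ε = (K ℕ.⊔ L) ℕ.⊔ (N ℕ.⊔ M) , λ n p →
    bound n (ℕₚ.m⊔n≤o⇒m≤o K L (ℕₚ.m⊔n≤o⇒m≤o (K ℕ.⊔ L) (N ℕ.⊔ M) p)) (ℕₚ.m⊔n≤o⇒n≤o K L (ℕₚ.m⊔n≤o⇒m≤o (K ℕ.⊔ L) (N ℕ.⊔ M) p))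
            (ℕₚ.m⊔n≤o⇒m≤o N M (ℕₚ.m⊔n≤o⇒n≤o (K ℕ.⊔ L) (N ℕ.⊔ M) p)) (ℕₚ.m⊔n≤o⇒n≤o N M (ℕₚ.m⊔n≤o⇒n≤o (K ℕ.⊔ L) (N ℕ.⊔ M) p))
    where
    A = proj₁ (bounded x)
    0<A = proj₁ (proj₂ (bounded x))
    K = proj₁ (proj₂ (proj₂ (bounded x)))
    x≤A = proj₂ (proj₂ (proj₂ (bounded x)))
    B = proj₁ (bounded y)
    0<B = proj₁ (proj₂ (bounded y))
    L = proj₁ (proj₂ (proj₂ (bounded y)))
    y≤B = proj₂ (proj₂ (proj₂ (bounded y)))
    C = A ℚ.+ B
    0<C : 0ℚ ℚ.< C
    0<C = ℚₚ.+-mono-< 0<A 0<B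
    δ = proj₁ (quotient 0<ε 0<C)
    0<δ = proj₁ (proj₂ (quotient 0<ε 0<C))
    N = proj₁ (0≤x δ 0<δ)
    M = proj₁ (0≤y δ 0<δ)
    bound : ∀ n → K ℕ.≤ n → L ℕ.≤ n → N ℕ.≤ n → M ℕ.≤ n → 0ℚ ℚ.≤ seq x n ℚ.* seq y n ℚ.+ ε
    bound n K≤n L≤n N≤n M≤n = ≡.subst (λ t → 0ℚ ℚ.≤ seq x n ℚ.* seq y n ℚ.+ t) (proj₂ (proj₂ (quotient 0<ε 0<C)))
      (product-bound (ℚₚ.<⇒≤ 0<δ) (ℚₚ.<⇒≤ 0<C)
        (ℚₚ.≤-trans (p≤∣p∣ _) (ℚₚ.≤-trans (x≤A n K≤n) (0≤q-p⇒p≤q (≡.subst (0ℚ ℚ.≤_) (solve 2 (λ a b → b := a :+ b :- a) ≡.refl A B) (ℚₚ.<⇒≤ 0<B)))))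
        (ℚₚ.≤-trans (p≤∣p∣ _) (ℚₚ.≤-trans (y≤B n L≤n) (0≤q-p⇒p≤q (≡.subst (0ℚ ℚ.≤_) (solve 2 (λ a b → a := a :+ b :- b) ≡.refl A B) (ℚₚ.<⇒≤ 0<A)))))
        (proj₂ (0≤x δ 0<δ) n N≤n) (proj₂ (0≤y δ 0<δ) n M≤n))

  nonNeg⇒≤ : ∀ {x y} → NonNegative (y - x) → x ≤ y
  nonNeg⇒≤ {x} {y} h (ε , 0<ε , M , hM) = ℚₚ.<-irrefl ≡.refl (ℚₚ.<-≤-trans (hM n (ℕₚ.m≤n⊔m N M))
    (0≤q-p⇒p≤q (≡.subst (0ℚ ℚ.≤_) (rearrange (seq x n) (seq y n) ε) (proj₂ (h ε 0<ε) n (ℕₚ.m≤m⊔n N M)))))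
    where
    N = proj₁ (h ε 0<ε)
    n = N ℕ.⊔ M
    rearrange : ∀ a b e → (b ℚ.+ ℚ.- a) ℚ.+ e ≡ (b ℚ.+ e) ℚ.- a
    rearrange = solve 3 (λ a b e → (b :+ :- a) :+ e := (b :+ e) :- a) ≡.refl

  -- From an index N on, the terms of y - x vary by less than ε/4. The rational comparison of term N
  -- with -ε/2 is decidable: either all later terms are at least -ε, or y lies below x by the gap
  -- ε/4, which is excluded.
  ≤⇒nonNeg : ∀ {x y} → x ≤ y → NonNegative (y - x)
  ≤⇒nonNeg {x} {y} x≤y ε 0<ε = decide (0ℚ ℚₚ.≤? d N ℚ.+ ½ ℚ.* ε)
    where
    d = seq (y - x)
    δ = ½ ℚ.* (½ ℚ.* ε)
    0<δ = ½*-pos (½*-pos 0<ε)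
    N = proj₁ (cauchy (y - x) δ 0<δ)
    hN = proj₂ (cauchy (y - x) δ 0<δ)
    above : ∀ a b e → (a ℚ.+ ½ ℚ.* e) ℚ.+ (½ ℚ.* (½ ℚ.* e) ℚ.- (a ℚ.- b)) ℚ.+ ½ ℚ.* (½ ℚ.* e) ≡ b ℚ.+ e
    above = solve 3 (λ a b e → (a :+ con ½ :* e) :+ (con ½ :* (con ½ :* e) :- (a :- b)) :+ con ½ :* (con ½ :* e) := b :+ e) ≡.refl
    below : ∀ a x y e → (0ℚ ℚ.- (a ℚ.+ ½ ℚ.* e)) ℚ.+ (½ ℚ.* (½ ℚ.* e) ℚ.- ((y ℚ.+ ℚ.- x) ℚ.- a)) ≡ x ℚ.- (y ℚ.+ ½ ℚ.* (½ ℚ.* e))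
    below = solve 4 (λ a x y e → (con 0ℚ :- (a :+ con ½ :* e)) :+ (con ½ :* (con ½ :* e) :- ((y :+ :- x) :- a)) := x :- (y :+ con ½ :* (con ½ :* e))) ≡.refl
    decide : Dec (0ℚ ℚ.≤ d N ℚ.+ ½ ℚ.* ε) → ∃[ N ] (∀ n → N ℕ.≤ n → 0ℚ ℚ.≤ d n ℚ.+ ε)
    decide (yes 0≤) = N , λ n N≤n → ≡.subst (0ℚ ℚ.≤_) (above (d N) (d n) ε)
      (0≤+ (0≤+ 0≤ (ℚₚ.<⇒≤ (p<q⇒0<q-p (∣p∣<r⇒p<r (hN N n ℕₚ.≤-refl N≤n))))) (ℚₚ.<⇒≤ 0<δ))
    decide (no 0≰) = contradiction (δ , 0<δ , N , λ n N≤n → 0<q-p⇒p<q (≡.subst (0ℚ ℚ.<_)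
      (below (d N) (seq x n) (seq y n) ε)
      (ℚₚ.+-mono-< (p<q⇒0<q-p (ℚₚ.≰⇒> 0≰)) (p<q⇒0<q-p (∣p∣<r⇒p<r (hN n N N≤n ℕₚ.≤-refl)))))) x≤y

  <⇒gap : ∀ {x y} → x < y → ∃[ ε ] (0ℚ ℚ.< ε × NonNegative (y - x - fromℚ ε))
  <⇒gap {x} {y} (ε , 0<ε , N , hN) = ε , 0<ε , λ η 0<η → N , λ n N≤n → ≡.subst (0ℚ ℚ.≤_)
    (solve 4 (λ x y ε η → (y :- (x :+ ε)) :+ η := y :+ :- x :+ :- ε :+ η) ≡.refl (seq x n) (seq y n) ε η)
    (0≤+ (ℚₚ.<⇒≤ (p<q⇒0<q-p (hN n N≤n))) (ℚₚ.<⇒≤ 0<η))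

  -- Inherited from `_≤_`, which is a negation.
  nonNeg-stable : ∀ {x} → ¬ ¬ NonNegative x → NonNegative x
  nonNeg-stable {x} ¬¬0≤x = nonNeg-resp-≈ {x - 0#} {x} (RealEquality.≗⇒≈ {x - 0#} {x} λ n → ℚₚ.+-identityʳ (seq x n))
    (≤⇒nonNeg {0#} {x} λ x<0 → ¬¬0≤x λ 0≤x → nonNeg⇒≤ {0#} {x}
      (nonNeg-resp-≈ {x} {x - 0#} (RealEquality.≗⇒≈ {x} {x - 0#} λ n → ≡.sym (ℚₚ.+-identityʳ (seq x n))) 0≤x) x<0)

  -- A representative of 0 whose terms are the errors allowed to the approximate roots, so that
  -- `√ x + reciprocals` overestimates the root in every term.
  reciprocals : ℝ
  reciprocals = mkℝ 1/[1+_] λ ε 0<ε → let (M , hM) = ℚ-√-Lemmas.archimedean (½ ℚ.* ε) (½*-pos 0<ε) in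
    M , λ m n M≤m M≤n → ∣p∣<r (half ε 0<ε M hM m n M≤m M≤n)
      (≡.subst (ℚ._< ε) (solve 2 (λ a b → b :- a := :- (a :- b)) ≡.refl 1/[1+ m ] 1/[1+ n ]) (half ε 0<ε M hM n m M≤n M≤m))
    where
    half : ∀ ε → 0ℚ ℚ.< ε → ∀ M → 1/[1+ M ] ℚ.≤ ½ ℚ.* ε → ∀ m n → M ℕ.≤ m → M ℕ.≤ n → 1/[1+ m ] ℚ.- 1/[1+ n ] ℚ.< ε
    half ε 0<ε M hM m n M≤m M≤n = begin-strict
      1/[1+ m ] ℚ.- 1/[1+ n ]   <⟨ ℚₚ.+-monoʳ-< 1/[1+ m ] (ℚₚ.neg-antimono-< (ℚ-√-Lemmas.0<1/[1+_] n)) ⟩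
      1/[1+ m ] ℚ.+ 0ℚ          ≡⟨ ℚₚ.+-identityʳ _ ⟩
      1/[1+ m ]                 ≤⟨ ℚₚ.≤-trans (ℚ-√-Lemmas.1/[1+]-antitone M≤m) hM ⟩
      ½ ℚ.* ε                   ≡⟨ ℚₚ.+-identityʳ _ ⟨
      ½ ℚ.* ε ℚ.+ 0ℚ            <⟨ ℚₚ.+-monoʳ-< (½ ℚ.* ε) (½*-pos 0<ε) ⟩
      ½ ℚ.* ε ℚ.+ ½ ℚ.* ε       ≡⟨ ½ε+½ε ε ⟩
      ε                         ∎
      where open ℚₚ.≤-Reasoning

  nonNeg-√ : ∀ x → NonNegative (√ x)
  nonNeg-√ x = nonNeg-pointwise {√ x} λ n → ℚ-√-Lemmas.0≤ n (seq x n)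

  reciprocals≈0 : reciprocals ≈ 0#
  reciprocals≈0 ε 0<ε = M , λ n M≤n → ∣p∣<r (upper n M≤n) (lower n)
    where
    M = proj₁ (ℚ-√-Lemmas.archimedean (½ ℚ.* ε) (½*-pos 0<ε))
    hM = proj₂ (ℚ-√-Lemmas.archimedean (½ ℚ.* ε) (½*-pos 0<ε))
    p-0 : ∀ p → p ℚ.- 0ℚ ≡ p
    p-0 = solve 1 (λ p → p :- con 0ℚ := p) ≡.refl
    -p : ∀ p e → (e ℚ.+ p) ≡ e ℚ.- ℚ.- (p ℚ.- 0ℚ)
    -p = solve 2 (λ p e → e :+ p := e :- :- (p :- con 0ℚ)) ≡.refl
    ½ε<ε : ½ ℚ.* ε ℚ.< ε
    ½ε<ε = 0<q-p⇒p<q (≡.subst (0ℚ ℚ.<_) (solve 1 (λ e → con ½ :* e := e :- con ½ :* e) ≡.refl ε) (½*-pos 0<ε))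
    upper : ∀ n → M ℕ.≤ n → 1/[1+ n ] ℚ.- 0ℚ ℚ.< ε
    upper n M≤n = ≡.subst (ℚ._< ε) (≡.sym (p-0 1/[1+ n ]))
      (ℚₚ.≤-<-trans (ℚₚ.≤-trans (ℚ-√-Lemmas.1/[1+]-antitone M≤n) hM) ½ε<ε)
    lower : ∀ n → ℚ.- (1/[1+ n ] ℚ.- 0ℚ) ℚ.< ε
    lower n = 0<q-p⇒p<q (≡.subst (0ℚ ℚ.<_) (-p 1/[1+ n ] ε) (ℚₚ.+-mono-< 0<ε (ℚ-√-Lemmas.0<1/[1+_] n)))

  -- Approximate roots are rounded down. Where the approximation is 0, possibly because the term of
  -- `x` is negative, `ε` covers the difference.
  √-lower : ∀ {x} → NonNegative x → NonNegative (x - √ x * √ x)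
  √-lower {x} 0≤x ε 0<ε = N , λ n N≤n → case n N≤n (ℚ-√-Lemmas.lower n (seq x n))
    where
    N = proj₁ (0≤x ε 0<ε)
    hN = proj₂ (0≤x ε 0<ε)
    vanish : ∀ x e → x ℚ.+ e ≡ (x ℚ.+ ℚ.- (0ℚ ℚ.* 0ℚ)) ℚ.+ e
    vanish = solve 2 (λ x e → x :+ e := (x :+ :- (con 0ℚ :* con 0ℚ)) :+ e) ≡.refl
    case : ∀ n → N ℕ.≤ n → let s = ℚ-√ n (seq x n) in s ≡ 0ℚ ⊎ s ℚ.* s ℚ.≤ seq x n → 0ℚ ℚ.≤ (seq x n ℚ.+ ℚ.- (s ℚ.* s)) ℚ.+ ε
    case n N≤n (inj₁ s≡0)  = ≡.subst (λ s → 0ℚ ℚ.≤ (seq x n ℚ.+ ℚ.- (s ℚ.* s)) ℚ.+ ε) (≡.sym s≡0)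
      (≡.subst (0ℚ ℚ.≤_) (vanish (seq x n) ε) (hN n N≤n))
    case n _   (inj₂ s²≤x) = 0≤+ (p≤q⇒0≤q-p s²≤x) (ℚₚ.<⇒≤ 0<ε)

  -- Adding `reciprocals` does not change the real number `√ x`, and then the square exceeds `x`
  -- term by term.
  √-upper : ∀ x → NonNegative (√ x * √ x - x)
  √-upper x = nonNeg-resp-≈ {t * t - x} {√ x * √ x - x} (R.+-congʳ { - x} {t * t} {√ x * √ x} (R.*-cong {t} {√ x} {t} {√ x} t≈√x t≈√x))
    (nonNeg-pointwise {t * t - x} λ n → ℚₚ.<⇒≤ (p<q⇒0<q-p (ℚ-√-Lemmas.upper n (seq x n))))
    where
    module R = CommutativeRing ℝ-commutativeRing
    t = √ x + reciprocals
    t≈√x : t ≈ √ x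
    t≈√x = R.trans {t} {√ x + 0#} {√ x} (R.+-congˡ {√ x} {reciprocals} {0#} reciprocals≈0) (R.+-identityʳ (√ x))

-- Ordered rings and division of inequalities.

-- What the argument uses of the real numbers. Without a decidable order, a proof by contradiction
-- goes through `nonNeg-stable`, and `gap` then supplies a rational ε > 0 by which the inequality
-- would fail.
record OrderedRing : Set₁ where
  field
    commutativeRing : CommutativeRing 0ℓ 0ℓ

  open CommutativeRing commutativeRing hiding (zero) public

  field
    NonNeg         : Carrier → Set
    nonNeg-resp-≈  : ∀ {x y} → x ≈ y → NonNeg x → NonNeg y
    nonNeg-+       : ∀ {x y} → NonNeg x → NonNeg y → NonNeg (x + y)
    nonNeg-*       : ∀ {x y} → NonNeg x → NonNeg y → NonNeg (x * y)
    nonNeg-square  : ∀ x → NonNeg (x * x)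
    nonNeg-stable  : ∀ {x} → ¬ ¬ NonNeg x → NonNeg x
    fromℚ          : ℚ → Carrier
    fromℚ-isRingHomomorphism : IsRingHomomorphism ℚ.+-*-rawRing rawRing fromℚ
    nonNeg-fromℚ   : ∀ {q} → 0ℚ ℚ.≤ q → NonNeg (fromℚ q)
    fromℚ-nonNeg   : ∀ {q} → NonNeg (fromℚ q) → 0ℚ ℚ.≤ q
    gap            : ∀ {x} → ¬ NonNeg x → ¬ ¬ (∃[ ε ] (0ℚ ℚ.< ε × NonNeg (- x - fromℚ ε)))

ℝ-orderedRing : OrderedRing
ℝ-orderedRing = record
  { commutativeRing = ℝ-commutativeRing
  ; NonNeg = NonNegative
  ; nonNeg-resp-≈ = λ {x} {y} → RealOrder.nonNeg-resp-≈ {x} {y}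
  ; nonNeg-+ = λ {x} {y} → RealOrder.nonNeg-+ {x} {y}
  ; nonNeg-* = λ {x} {y} → RealOrder.nonNeg-* {x} {y}
  ; nonNeg-square = RealOrder.nonNeg-square
  ; nonNeg-stable = λ {x} → RealOrder.nonNeg-stable {x}
  ; fromℚ = Real.fromℚ
  ; fromℚ-isRingHomomorphism = mkRingHomomorphism Real.fromℚ
      (λ {p} {q} p≡q → RealEquality.≗⇒≈ {Real.fromℚ p} {Real.fromℚ q} λ _ → p≡q)
      (λ p q → RealEquality.≈-refl {Real.fromℚ (p ℚ.+ q)})
      (λ p q → RealEquality.≗⇒≈ {Real.fromℚ (p ℚ.* q)} {Real.fromℚ p Real.* Real.fromℚ q} λ _ → ≡.refl)
      (λ p → RealEquality.≈-refl {Real.fromℚ (ℚ.- p)})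
      (RealEquality.≈-refl {Real.0#})
      (RealEquality.≈-refl {Real.1#})
  ; nonNeg-fromℚ = RealOrder.nonNeg-fromℚ
  ; fromℚ-nonNeg = RealOrder.fromℚ-nonNeg
  ; gap = λ {x} x≱0 ¬gap → x≱0 (RealOrder.nonNeg-resp-≈ {x Real.- Real.0#} {x}
      (RealEquality.≗⇒≈ {x Real.- Real.0#} {x} λ n → ℚₚ.+-identityʳ (ℝ.seq x n))
      (RealOrder.≤⇒nonNeg {Real.0#} {x} λ { x<0 → let (ε , 0<ε , h) = RealOrder.<⇒gap {x} {Real.0#} x<0 in
        ¬gap (ε , 0<ε , RealOrder.nonNeg-resp-≈ {Real.0# Real.- x Real.- Real.fromℚ ε} {(Real.- x) Real.- Real.fromℚ ε}
          (RealEquality.≗⇒≈ {Real.0# Real.- x Real.- Real.fromℚ ε} {(Real.- x) Real.- Real.fromℚ ε}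
            λ n → ≡.cong (ℚ._- ε) (ℚₚ.+-identityˡ (ℚ.- ℝ.seq x n))) h) }))
  }

module OrderedRingProperties (R : OrderedRing) where
  open OrderedRing R
  open RingSolver commutativeRing
  open IntegerCoefficients commutativeRing using (fromInt)
  module fromℚ = IsRingHomomorphism fromℚ-isRingHomomorphism

  nonNeg-1 : NonNeg 1#
  nonNeg-1 = nonNeg-resp-≈ (*-identityˡ 1#) (nonNeg-square 1#)

  nonNeg-0 : NonNeg 0#
  nonNeg-0 = nonNeg-resp-≈ (zeroˡ 0#) (nonNeg-square 0#)

  nonNeg-ℕ : ∀ n → NonNeg (fromInt (+ n))
  nonNeg-ℕ zero    = nonNeg-0
  nonNeg-ℕ (suc n) = nonNeg-+ nonNeg-1 (nonNeg-ℕ n)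

  -positive-impossible : ∀ {ε} → 0ℚ ℚ.< ε → ¬ NonNeg (- fromℚ ε)
  -positive-impossible {ε} 0<ε h = ℚₚ.<-irrefl ≡.refl (ℚₚ.≤-<-trans
    (fromℚ-nonNeg (nonNeg-resp-≈ (sym (fromℚ.-‿homo ε)) h)) (ℚₚ.neg-antimono-< 0<ε))

  -- Otherwise b ≤ -ε, and a ≥ 1 would give a b ≤ -ε.
  cancelˡ : ∀ {a b} → NonNeg (a - 1#) → NonNeg (a * b) → NonNeg b
  cancelˡ {a} {b} 1≤a 0≤ab = nonNeg-stable λ b≱0 → gap b≱0 λ { (ε , 0<ε , h) → -positive-impossible 0<ε
    (nonNeg-resp-≈ (solve 4 (λ a b e o → a :* b :+ (a :- o) :* (:- b :- e) :+ o :* (:- b :- e) :+ (a :- o) :* e := (:- o) :* e) refl a b (fromℚ ε) 1#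
      ⟨ trans ⟩ trans (sym (RingProperties.-‿distribˡ-* ring 1# (fromℚ ε))) (-‿cong (*-identityˡ _)))
      (nonNeg-+ (nonNeg-+ (nonNeg-+ 0≤ab (nonNeg-* 1≤a h)) (nonNeg-* nonNeg-1 h)) (nonNeg-* 1≤a (nonNeg-fromℚ (ℚₚ.<⇒≤ 0<ε))))) }

  -- Otherwise p ≥ q + ε, and then p² ≥ q² + ε².
  squares-cancel : ∀ {p q} → NonNeg p → NonNeg q → NonNeg (q * q - p * p) → NonNeg (q - p)
  squares-cancel {p} {q} 0≤p 0≤q h = nonNeg-stable λ q≱p → gap q≱p λ { (ε , 0<ε , k) →
    let e = fromℚ ε
        0≤e = nonNeg-fromℚ (ℚₚ.<⇒≤ 0<ε)
    in -positive-impossible (RationalLemmas.*-pos 0<ε 0<ε) (nonNeg-resp-≈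
      (trans (solve 3 (λ p q e → (q :* q :- p :* p) :+ (:- (q :- p) :- e) :* (p :+ q) :+ e :* (:- (q :- p) :- e) :+ (e :* q :+ e :* q) := :- (e :* e)) refl p q e)
             (-‿cong (sym (fromℚ.*-homo ε ε))))
      (nonNeg-+ (nonNeg-+ (nonNeg-+ h (nonNeg-* k (nonNeg-+ 0≤p 0≤q))) (nonNeg-* 0≤e k)) (nonNeg-+ (nonNeg-* 0≤e 0≤q) (nonNeg-* 0≤e 0≤q)))) }

  -- The explicit argument is one less than the factor that is divided out.
  cancelˡ-ℕ : ∀ n {x} → NonNeg (fromInt (+ suc n) * x) → NonNeg x
  cancelˡ-ℕ n = cancelˡ (nonNeg-resp-≈ (sym (solve 2 (λ n o → o :+ n :- o := n) refl (fromInt (+ n)) 1#)) (nonNeg-ℕ n))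

-- The numerical estimate in the fundamental domain.

module Estimate (R : OrderedRing) where
  open OrderedRing R
  open RingSolver commutativeRing
  open OrderedRingProperties R
  open IntegerCoefficients commutativeRing using (fromInt)
  open import Relation.Binary.Reasoning.Setoid setoid

  private
    ⟨_⟩ : ℕ → Carrier
    ⟨ n ⟩ = fromInt (+ n)

  -- [[a , b] , [b , g]] is the inverse of Im Z, so r below is the inverse of d = det Im Z.
  record ReducedForm : Set where
    field
      x₁ x₁₂ y₁ y₁₂ y₂ a b g : Carrier
      1-4x₁²≥0  : NonNeg (⟨ 1 ⟩ - ⟨ 4 ⟩ * (x₁ * x₁))
      1-4x₁₂²≥0 : NonNeg (⟨ 1 ⟩ - ⟨ 4 ⟩ * (x₁₂ * x₁₂))
      y₁₂≥0     : NonNeg y₁₂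
      2y₁₂≤y₁   : NonNeg (y₁ - ⟨ 2 ⟩ * y₁₂)
      y₁≤y₂     : NonNeg (y₂ - y₁)
      ∣z₁∣≥1    : NonNeg (x₁ * x₁ + y₁ * y₁ - ⟨ 1 ⟩)
      e₁₃       : y₁ * a + y₁₂ * b ≈ ⟨ 1 ⟩
      e₁₄       : y₁₂ * a + y₂ * b ≈ ⟨ 0 ⟩
      e₂₃       : y₁ * b + y₁₂ * g ≈ ⟨ 0 ⟩
      e₂₄       : y₁₂ * b + y₂ * g ≈ ⟨ 1 ⟩
      r≥0       : NonNeg (a * g - b * b)

  module InverseImaginaryPart (Y : ReducedForm) where
    open ReducedForm Y

    -- `h` is |z₁|² a + |z₁₂|² g + 2 Re(z₁ z̄₁₂) b, the norm of e₃ = z₁ e₁ + z₁₂ e₂ when (e₁ , e₂)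
    -- has the real Gram matrix [[a , b] , [b , g]].
    d r h : Carrier
    d = y₁ * y₂ - y₁₂ * y₁₂
    r = a * g - b * b
    h = (x₁ * x₁ + y₁ * y₁) * a + (x₁₂ * x₁₂ + y₁₂ * y₁₂) * g + ⟨ 2 ⟩ * ((x₁ * x₁₂ + y₁ * y₁₂) * b)

    rd≈1 : d * r ≈ ⟨ 1 ⟩
    rd≈1 = begin
      d * r
        ≈⟨ solve 6 (λ y₁ y₁₂ y₂ a b g → (y₁ :* y₂ :- y₁₂ :* y₁₂) :* (a :* g :- b :* b) :=
             (y₁ :* a :+ y₁₂ :* b) :* (y₁₂ :* b :+ y₂ :* g) :- (y₁ :* b :+ y₁₂ :* g) :* (y₁₂ :* a :+ y₂ :* b)) refl y₁ y₁₂ y₂ a b g ⟩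
      (y₁ * a + y₁₂ * b) * (y₁₂ * b + y₂ * g) - (y₁ * b + y₁₂ * g) * (y₁₂ * a + y₂ * b)
        ≈⟨ +-cong (*-cong e₁₃ e₂₄) (-‿cong (*-cong e₂₃ e₁₄)) ⟩
      ⟨ 1 ⟩ * ⟨ 1 ⟩ - ⟨ 0 ⟩ * ⟨ 0 ⟩
        ≈⟨ solve 0 (con (+ 1) :* con (+ 1) :- con (+ 0) :* con (+ 0) := con (+ 1)) refl ⟩
      ⟨ 1 ⟩ ∎

    by-rd : ∀ {x} p → x * d ≈ p → x ≈ p * r
    by-rd {x} p xd≈p = begin
      x                ≈⟨ solve 1 (λ x → x := x :* con (+ 1)) refl x ⟩
      x * ⟨ 1 ⟩        ≈⟨ *-congˡ rd≈1 ⟨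
      x * (d * r)      ≈⟨ *-assoc x d r ⟨
      x * d * r        ≈⟨ *-congʳ xd≈p ⟩
      p * r            ∎

    a≈y₂r : a ≈ y₂ * r
    a≈y₂r = by-rd y₂ (begin
      a * d                                                   ≈⟨ solve 5 (λ y₁ y₁₂ y₂ a b → a :* (y₁ :* y₂ :- y₁₂ :* y₁₂) :=
                                                                   y₂ :* (y₁ :* a :+ y₁₂ :* b) :- y₁₂ :* (y₁₂ :* a :+ y₂ :* b)) refl y₁ y₁₂ y₂ a b ⟩
      y₂ * (y₁ * a + y₁₂ * b) - y₁₂ * (y₁₂ * a + y₂ * b)      ≈⟨ +-cong (*-congˡ e₁₃) (-‿cong (*-congˡ e₁₄)) ⟩
      y₂ * ⟨ 1 ⟩ - y₁₂ * ⟨ 0 ⟩                                ≈⟨ solve 2 (λ y₂ y₁₂ → y₂ :* con (+ 1) :- y₁₂ :* con (+ 0) := y₂) refl y₂ y₁₂ ⟩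
      y₂                                                      ∎)

    b≈-y₁₂r : b ≈ (- y₁₂) * r
    b≈-y₁₂r = by-rd (- y₁₂) (begin
      b * d                                                   ≈⟨ solve 5 (λ y₁ y₁₂ y₂ a b → b :* (y₁ :* y₂ :- y₁₂ :* y₁₂) :=
                                                                   y₁ :* (y₁₂ :* a :+ y₂ :* b) :- y₁₂ :* (y₁ :* a :+ y₁₂ :* b)) refl y₁ y₁₂ y₂ a b ⟩
      y₁ * (y₁₂ * a + y₂ * b) - y₁₂ * (y₁ * a + y₁₂ * b)      ≈⟨ +-cong (*-congˡ e₁₄) (-‿cong (*-congˡ e₁₃)) ⟩
      y₁ * ⟨ 0 ⟩ - y₁₂ * ⟨ 1 ⟩                                ≈⟨ solve 2 (λ y₁ y₁₂ → y₁ :* con (+ 0) :- y₁₂ :* con (+ 1) := :- y₁₂) refl y₁ y₁₂ ⟩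
      - y₁₂                                                   ∎)

    g≈y₁r : g ≈ y₁ * r
    g≈y₁r = by-rd y₁ (begin
      g * d                                                   ≈⟨ solve 5 (λ y₁ y₁₂ y₂ b g → g :* (y₁ :* y₂ :- y₁₂ :* y₁₂) :=
                                                                   y₁ :* (y₁₂ :* b :+ y₂ :* g) :- y₁₂ :* (y₁ :* b :+ y₁₂ :* g)) refl y₁ y₁₂ y₂ b g ⟩
      y₁ * (y₁₂ * b + y₂ * g) - y₁₂ * (y₁ * b + y₁₂ * g)      ≈⟨ +-cong (*-congˡ e₂₄) (-‿cong (*-congˡ e₂₃)) ⟩
      y₁ * ⟨ 1 ⟩ - y₁₂ * ⟨ 0 ⟩                                ≈⟨ solve 2 (λ y₁ y₁₂ → y₁ :* con (+ 1) :- y₁₂ :* con (+ 0) := y₁) refl y₁ y₁₂ ⟩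
      y₁                                                      ∎)

    -- With X = Re Z and Y = Im Z, `q * r` is the entry (1,1) of X Y⁻¹ X. Thus `t * r` is that of Y
    -- + X Y⁻¹ X, the usual form of the norm `h`.
    q t : Carrier
    q = y₂ * (x₁ * x₁) - ⟨ 2 ⟩ * (y₁₂ * (x₁ * x₁₂)) + y₁ * (x₁₂ * x₁₂)
    t = d * y₁ + q

    h≈tr : h ≈ t * r
    h≈tr = begin
      h
        ≈⟨ +-cong (+-cong (*-congˡ a≈y₂r) (*-congˡ g≈y₁r)) (*-congˡ (*-congˡ b≈-y₁₂r)) ⟩
      (x₁ * x₁ + y₁ * y₁) * (y₂ * r) + (x₁₂ * x₁₂ + y₁₂ * y₁₂) * (y₁ * r) + ⟨ 2 ⟩ * ((x₁ * x₁₂ + y₁ * y₁₂) * ((- y₁₂) * r))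
        ≈⟨ solve 6 (λ x₁ x₁₂ y₁ y₁₂ y₂ r →
             (x₁ :* x₁ :+ y₁ :* y₁) :* (y₂ :* r) :+ (x₁₂ :* x₁₂ :+ y₁₂ :* y₁₂) :* (y₁ :* r) :+ con (+ 2) :* ((x₁ :* x₁₂ :+ y₁ :* y₁₂) :* ((:- y₁₂) :* r)) :=
             ((y₁ :* y₂ :- y₁₂ :* y₁₂) :* y₁ :+ (y₂ :* (x₁ :* x₁) :- con (+ 2) :* (y₁₂ :* (x₁ :* x₁₂)) :+ y₁ :* (x₁₂ :* x₁₂))) :* r) refl x₁ x₁₂ y₁ y₁₂ y₂ r ⟩
      t * r ∎

    4y₁²≥3 : NonNeg (⟨ 4 ⟩ * (y₁ * y₁) - ⟨ 3 ⟩)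
    4y₁²≥3 = nonNeg-resp-≈
      (solve 2 (λ x y → con (+ 4) :* (x :+ y :- con (+ 1)) :+ (con (+ 1) :- con (+ 4) :* x) := con (+ 4) :* y :- con (+ 3)) refl (x₁ * x₁) (y₁ * y₁))
      (nonNeg-+ (nonNeg-* (nonNeg-ℕ 4) ∣z₁∣≥1) 1-4x₁²≥0)

    y₁≥0 : NonNeg y₁
    y₁≥0 = nonNeg-resp-≈ (solve 2 (λ y₁ y₁₂ → (y₁ :- con (+ 2) :* y₁₂) :+ con (+ 2) :* y₁₂ := y₁) refl y₁ y₁₂)
      (nonNeg-+ 2y₁₂≤y₁ (nonNeg-* (nonNeg-ℕ 2) y₁₂≥0))

    y₂≥0 : NonNeg y₂
    y₂≥0 = nonNeg-resp-≈ (solve 2 (λ y₁ y₂ → (y₂ :- y₁) :+ y₁ := y₂) refl y₁ y₂) (nonNeg-+ y₁≤y₂ y₁≥0)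

    y₁y₂≥0 : NonNeg (y₁ * y₂)
    y₁y₂≥0 = nonNeg-* y₁≥0 y₂≥0

    -- From 2 y₁₂ ≤ y₁ ≤ y₂ one has y₁₂² ≤ y₁² / 4 ≤ y₁ y₂ / 4.
    4d≥3y₁y₂ : NonNeg (⟨ 4 ⟩ * d - ⟨ 3 ⟩ * (y₁ * y₂))
    4d≥3y₁y₂ = nonNeg-resp-≈
      (solve 3 (λ y₁ y₁₂ y₂ → y₁ :* (y₂ :- y₁) :+ (y₁ :- con (+ 2) :* y₁₂) :* (y₁ :+ con (+ 2) :* y₁₂) :=
        con (+ 4) :* (y₁ :* y₂ :- y₁₂ :* y₁₂) :- con (+ 3) :* (y₁ :* y₂)) refl y₁ y₁₂ y₂)
      (nonNeg-+ (nonNeg-* y₁≥0 y₁≤y₂) (nonNeg-* 2y₁₂≤y₁ (nonNeg-+ y₁≥0 (nonNeg-* (nonNeg-ℕ 2) y₁₂≥0))))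

    16d≥9 : NonNeg (⟨ 16 ⟩ * d - ⟨ 9 ⟩)
    16d≥9 = nonNeg-resp-≈
      (solve 3 (λ y₁ y₂ d → con (+ 4) :* (con (+ 4) :* d :- con (+ 3) :* (y₁ :* y₂)) :+ con (+ 12) :* (y₁ :* (y₂ :- y₁)) :+
        con (+ 3) :* (con (+ 4) :* (y₁ :* y₁) :- con (+ 3)) := con (+ 16) :* d :- con (+ 9)) refl y₁ y₂ d)
      (nonNeg-+ (nonNeg-+ (nonNeg-* (nonNeg-ℕ 4) 4d≥3y₁y₂) (nonNeg-* (nonNeg-ℕ 12) (nonNeg-* y₁≥0 y₁≤y₂)))
        (nonNeg-* (nonNeg-ℕ 3) 4y₁²≥3))

    d≥0 : NonNeg d
    d≥0 = cancelˡ-ℕ 15 (nonNeg-resp-≈ (solve 1 (λ d → con (+ 16) :* d :- con (+ 9) :+ con (+ 9) := con (+ 16) :* d) refl d)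
      (nonNeg-+ 16d≥9 (nonNeg-ℕ 9)))

    -- The bound 16 d ≥ 9 gives r ≤ 16/9, and the 2 that is added rounds 16/9 up to 18/9.
    r≤2 : NonNeg (⟨ 2 ⟩ - r)
    r≤2 = cancelˡ-ℕ 8 (nonNeg-resp-≈ (begin
      (⟨ 16 ⟩ * d - ⟨ 9 ⟩) * r + ⟨ 2 ⟩           ≈⟨ solve 2 (λ d r → (con (+ 16) :* d :- con (+ 9)) :* r :+ con (+ 2) :=
                                                       con (+ 16) :* (d :* r) :- con (+ 9) :* r :+ con (+ 2)) refl d r ⟩
      ⟨ 16 ⟩ * (d * r) - ⟨ 9 ⟩ * r + ⟨ 2 ⟩       ≈⟨ +-congʳ (+-congʳ (*-congˡ rd≈1)) ⟩
      ⟨ 16 ⟩ * ⟨ 1 ⟩ - ⟨ 9 ⟩ * r + ⟨ 2 ⟩         ≈⟨ solve 1 (λ r → con (+ 16) :* con (+ 1) :- con (+ 9) :* r :+ con (+ 2) :=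
                                                       con (+ 9) :* (con (+ 2) :- r)) refl r ⟩
      ⟨ 9 ⟩ * (⟨ 2 ⟩ - r)                        ∎)
      (nonNeg-+ (nonNeg-* 16d≥9 r≥0) (nonNeg-ℕ 2)))

    -- |x₁| and |x₁₂| are at most 1/2, so 4 q ≤ y₂ + 2 y₁₂ + y₁, and both 2 y₁₂ and y₁ are at most
    -- y₂.
    4q≤3y₂ : NonNeg (⟨ 3 ⟩ * y₂ - ⟨ 4 ⟩ * q)
    4q≤3y₂ = nonNeg-resp-≈
      (solve 5 (λ x₁ x₁₂ y₁ y₁₂ y₂ →
        y₂ :* (con (+ 1) :- con (+ 4) :* (x₁ :* x₁)) :+ y₁ :* (con (+ 1) :- con (+ 4) :* (x₁₂ :* x₁₂)) :+
        con (+ 4) :* (y₁₂ :* ((x₁ :+ x₁₂) :* (x₁ :+ x₁₂))) :+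
        y₁₂ :* ((con (+ 1) :- con (+ 4) :* (x₁ :* x₁)) :+ (con (+ 1) :- con (+ 4) :* (x₁₂ :* x₁₂))) :+
        (con (+ 2) :* (y₂ :- y₁) :+ (y₁ :- con (+ 2) :* y₁₂)) :=
        con (+ 3) :* y₂ :- con (+ 4) :* (y₂ :* (x₁ :* x₁) :- con (+ 2) :* (y₁₂ :* (x₁ :* x₁₂)) :+ y₁ :* (x₁₂ :* x₁₂)))
        refl x₁ x₁₂ y₁ y₁₂ y₂)
      (nonNeg-+ (nonNeg-+ (nonNeg-+ (nonNeg-+ (nonNeg-* y₂≥0 1-4x₁²≥0) (nonNeg-* y₁≥0 1-4x₁₂²≥0))
        (nonNeg-* (nonNeg-ℕ 4) (nonNeg-* y₁₂≥0 (nonNeg-square (x₁ + x₁₂)))))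
        (nonNeg-* y₁₂≥0 (nonNeg-+ 1-4x₁²≥0 1-4x₁₂²≥0)))
        (nonNeg-+ (nonNeg-* (nonNeg-ℕ 2) y₁≤y₂) 2y₁₂≤y₁))

    -- In y₂ t = d y₁ y₂ + y₂ q the first term is at most (4/3) d². The second is at most (3/4) y₂²
    -- ≤ (y₁ y₂)² ≤ (16/9) d², where the middle step is y₁² ≥ 3/4. The sum is 28/9 = 112/36.
    36y₂t≤112d² : NonNeg (⟨ 112 ⟩ * (d * d) - ⟨ 36 ⟩ * (y₂ * t))
    36y₂t≤112d² = nonNeg-resp-≈
      (solve 4 (λ y₁ y₂ d q →
        con (+ 9) :* (y₂ :* (con (+ 3) :* y₂ :- con (+ 4) :* q)) :+ con (+ 9) :* ((y₂ :* y₂) :* (con (+ 4) :* (y₁ :* y₁) :- con (+ 3))) :+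
        con (+ 12) :* (d :* (con (+ 4) :* d :- con (+ 3) :* (y₁ :* y₂))) :+
        con (+ 4) :* ((con (+ 4) :* d :- con (+ 3) :* (y₁ :* y₂)) :* (con (+ 4) :* d :+ con (+ 3) :* (y₁ :* y₂))) :=
        con (+ 112) :* (d :* d) :- con (+ 36) :* (y₂ :* (d :* y₁ :+ q))) refl y₁ y₂ d q)
      (nonNeg-+ (nonNeg-+ (nonNeg-+ (nonNeg-* (nonNeg-ℕ 9) (nonNeg-* y₂≥0 4q≤3y₂))
        (nonNeg-* (nonNeg-ℕ 9) (nonNeg-* (nonNeg-square y₂) 4y₁²≥3)))
        (nonNeg-* (nonNeg-ℕ 12) (nonNeg-* d≥0 4d≥3y₁y₂)))
        (nonNeg-* (nonNeg-ℕ 4) (nonNeg-* 4d≥3y₁y₂ (nonNeg-+ (nonNeg-* (nonNeg-ℕ 4) d≥0) (nonNeg-* (nonNeg-ℕ 3) y₁y₂≥0)))))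

    -- Multiplying the previous bound by r³ turns d² into r and y₂ t into r a h, by d r = 1. The
    -- term 32 r rounds 112 up to 144 = 4 · 36.
    rah≤4r : NonNeg (⟨ 4 ⟩ * r - r * (a * h))
    rah≤4r = cancelˡ-ℕ 35 (nonNeg-resp-≈ (begin
      (r * r * r) * (⟨ 112 ⟩ * (d * d) - ⟨ 36 ⟩ * (y₂ * t)) + ⟨ 32 ⟩ * r
        ≈⟨ solve 4 (λ r d y₂ t → (r :* r :* r) :* (con (+ 112) :* (d :* d) :- con (+ 36) :* (y₂ :* t)) :+ con (+ 32) :* r :=
             con (+ 112) :* (d :* r :* (d :* r) :* r) :- con (+ 36) :* (r :* ((y₂ :* r) :* (t :* r))) :+ con (+ 32) :* r) refl r d y₂ t ⟩
      ⟨ 112 ⟩ * (d * r * (d * r) * r) - ⟨ 36 ⟩ * (r * ((y₂ * r) * (t * r))) + ⟨ 32 ⟩ * r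
        ≈⟨ +-congʳ (+-cong (*-congˡ (*-congʳ (*-cong rd≈1 rd≈1))) (-‿cong (*-congˡ (*-congˡ (*-cong (sym a≈y₂r) (sym h≈tr)))))) ⟩
      ⟨ 112 ⟩ * (⟨ 1 ⟩ * ⟨ 1 ⟩ * r) - ⟨ 36 ⟩ * (r * (a * h)) + ⟨ 32 ⟩ * r
        ≈⟨ solve 2 (λ r x → con (+ 112) :* (con (+ 1) :* con (+ 1) :* r) :- con (+ 36) :* x :+ con (+ 32) :* r :=
             con (+ 36) :* (con (+ 4) :* r :- x)) refl r (r * (a * h)) ⟩
      ⟨ 36 ⟩ * (⟨ 4 ⟩ * r - r * (a * h)) ∎)
      (nonNeg-+ (nonNeg-* (nonNeg-* (nonNeg-* r≥0 r≥0) r≥0) 36y₂t≤112d²) (nonNeg-* (nonNeg-ℕ 32) r≥0)))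

    -- The chain is 16 ≤ m r f ≤ m r a h ≤ 4 m r ≤ 8 m.
    estimate : ∀ {m f} → NonNeg m → NonNeg (a * h - f) → NonNeg (m * (r * f) - ⟨ 16 ⟩) → NonNeg (m - ⟨ 2 ⟩)
    estimate {m} {f} m≥0 f≤ah mrf≥16 = cancelˡ-ℕ 7 (nonNeg-resp-≈
      (solve 5 (λ m r f a h →
        (m :* (r :* f) :- con (+ 16)) :+ m :* (r :* (a :* h :- f)) :+ m :* (con (+ 4) :* r :- r :* (a :* h)) :+
        con (+ 4) :* (m :* (con (+ 2) :- r)) := con (+ 8) :* (m :- con (+ 2))) refl m r f a h)
      (nonNeg-+ (nonNeg-+ (nonNeg-+ mrf≥16 (nonNeg-* m≥0 (nonNeg-* r≥0 f≤ah))) (nonNeg-* m≥0 rah≤4r))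
        (nonNeg-* (nonNeg-ℕ 4) (nonNeg-* m≥0 r≤2))))

-- Homomorphic images of sums and determinants, and block matrices.

module Homomorphism (A : RawRing 0ℓ 0ℓ) (B : CommutativeRing 0ℓ 0ℓ)
  {f : RawRing.Carrier A → CommutativeRing.Carrier B}
  (hom : IsRingHomomorphism A (CommutativeRing.rawRing B) f) where
  private
    module A = RawRing A
    module LA = LinearAlgebra A
  open CommutativeRing B hiding (zero)
  open LinearAlgebra rawRing using (sum; det; _^_)
  open IsRingHomomorphism hom

  sum-homo : ∀ {n} (v : Vector A.Carrier n) → f (LA.sum v) ≈ sum (f ∘ v)
  sum-homo {zero}  v = 0#-homo
  sum-homo {suc n} v = trans (+-homo _ _) (+-congˡ (sum-homo (v ∘ suc)))

  ^-homo : ∀ x k → f (x LA.^ k) ≈ f x ^ k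
  ^-homo x zero    = 1#-homo
  ^-homo x (suc k) = trans (*-homo _ _) (*-congˡ (^-homo x k))

  det-homo : ∀ {n} (M : Matrix A.Carrier n n) → f (LA.det M) ≈ det (λ i j → f (M i j))
  det-homo {zero}  M = 1#-homo
  det-homo {suc n} M = trans (sum-homo (λ j → (A.- A.1#) LA.^ toℕ j A.* (M zero j A.* LA.det (λ i k → M (suc i) (punchIn j k)))))
    (Determinant.sum-cong B _ (Determinant.laplace B (λ i j → f (M i j))) λ j → trans (*-homo _ _) (*-cong
      (trans (^-homo (A.- A.1#) (toℕ j)) (^-cong (toℕ j) (trans (-‿homo A.1#) (-‿cong 1#-homo))))
      (trans (*-homo _ _) (*-congˡ (det-homo (λ i k → M (suc i) (punchIn j k)))))))
    where
    ^-cong : ∀ k {x y} → x ≈ y → x ^ k ≈ y ^ k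
    ^-cong zero    _ = refl
    ^-cong (suc k) h = *-cong h (^-cong k h)

  combination-homo : ∀ {x} z u w v → x A.≈ z A.* u A.+ w A.* v → f x ≈ f z * f u + f w * f v
  combination-homo z u w v h = trans (⟦⟧-cong h) (trans (+-homo (z A.* u) (w A.* v)) (+-cong (*-homo z u) (*-homo w v)))

module BlockMatrix (R : CommutativeRing 0ℓ 0ℓ) where
  open CommutativeRing R hiding (zero)
  open LinearAlgebra rawRing using (sum; det; _⊗_; _⊕_)
  open RawPower (RawRing.rawSemiring rawRing) using (product)
  open Sum semiring using (sum-cong-≋)
  open Determinant R
  open SetoidReasoning setoid

  module _ {n} (A B C D : Matrix Carrier n n) where
    private
      row : Vector Carrier n → Vector Carrier n → Vector Carrier (n ℕ.+ n)
      row u v j = [ u , v ]′ (splitAt n j)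

    block : Matrix Carrier (n ℕ.+ n) (n ℕ.+ n)
    block i = [ (λ i → row (A i) (B i)) , (λ i → row (C i) (D i)) ]′ (splitAt n i)

    block-ˡˡ : ∀ i j → block (i ↑ˡ n) (j ↑ˡ n) ≈ A i j
    block-ˡˡ i j rewrite Finₚ.splitAt-↑ˡ n i n | Finₚ.splitAt-↑ˡ n j n = refl

    block-ˡʳ : ∀ i j → block (i ↑ˡ n) (n ↑ʳ j) ≈ B i j
    block-ˡʳ i j rewrite Finₚ.splitAt-↑ˡ n i n | Finₚ.splitAt-↑ʳ n n j = refl

    block-ʳˡ : ∀ i j → block (n ↑ʳ i) (j ↑ˡ n) ≈ C i j
    block-ʳˡ i j rewrite Finₚ.splitAt-↑ʳ n n i | Finₚ.splitAt-↑ˡ n j n = refl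

    block-ʳʳ : ∀ i j → block (n ↑ʳ i) (n ↑ʳ j) ≈ D i j
    block-ʳʳ i j rewrite Finₚ.splitAt-↑ʳ n n i | Finₚ.splitAt-↑ʳ n n j = refl

  split-cases : ∀ {m n} (P : Fin (m ℕ.+ n) → Set) → (∀ i → P (i ↑ˡ n)) → (∀ i → P (m ↑ʳ i)) → ∀ i → P i
  split-cases {m} {n} P l r i with splitAt m i in eq
  ... | inj₁ j = ≡.subst P (Finₚ.splitAt⁻¹-↑ˡ eq) (l j)
  ... | inj₂ j = ≡.subst P (Finₚ.splitAt⁻¹-↑ʳ eq) (r j)

  block-cong : ∀ {n} {A B C D A′ B′ C′ D′ : Matrix Carrier n n} → A ≋ A′ → B ≋ B′ → C ≋ C′ → D ≋ D′ →
    block A B C D ≋ block A′ B′ C′ D′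
  block-cong {n} {A} {B} {C} {D} {A′} {B′} {C′} {D′} hA hB hC hD = split-cases _
    (λ i → split-cases _
      (λ j → trans (block-ˡˡ A B C D i j) (trans (hA i j) (sym (block-ˡˡ A′ B′ C′ D′ i j))))
      (λ j → trans (block-ˡʳ A B C D i j) (trans (hB i j) (sym (block-ˡʳ A′ B′ C′ D′ i j)))))
    (λ i → split-cases _
      (λ j → trans (block-ʳˡ A B C D i j) (trans (hC i j) (sym (block-ʳˡ A′ B′ C′ D′ i j))))
      (λ j → trans (block-ʳʳ A B C D i j) (trans (hD i j) (sym (block-ʳʳ A′ B′ C′ D′ i j)))))

  block-⊗ : ∀ {n} (A B C D A′ B′ C′ D′ : Matrix Carrier n n) → block A B C D ⊗ block A′ B′ C′ D′ ≋
    block (A ⊗ A′ ⊕ B ⊗ C′) (A ⊗ B′ ⊕ B ⊗ D′) (C ⊗ A′ ⊕ D ⊗ C′) (C ⊗ B′ ⊕ D ⊗ D′)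
  block-⊗ {n} A B C D A′ B′ C′ D′ = split-cases _
    (λ i → split-cases _
      (λ j → trans (entry (i ↑ˡ n) (j ↑ˡ n) (A i) (B i) (λ k → A′ k j) (λ k → C′ k j) (block-ˡˡ A B C D i)
          (block-ˡʳ A B C D i) (λ k → block-ˡˡ A′ B′ C′ D′ k j) (λ k → block-ʳˡ A′ B′ C′ D′ k j))
                   (sym (block-ˡˡ AA AB CA CB i j)))
      (λ j → trans (entry (i ↑ˡ n) (n ↑ʳ j) (A i) (B i) (λ k → B′ k j) (λ k → D′ k j) (block-ˡˡ A B C D i)
          (block-ˡʳ A B C D i) (λ k → block-ˡʳ A′ B′ C′ D′ k j) (λ k → block-ʳʳ A′ B′ C′ D′ k j))
                   (sym (block-ˡʳ AA AB CA CB i j))))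
    (λ i → split-cases _
      (λ j → trans (entry (n ↑ʳ i) (j ↑ˡ n) (C i) (D i) (λ k → A′ k j) (λ k → C′ k j) (block-ʳˡ A B C D i)
          (block-ʳʳ A B C D i) (λ k → block-ˡˡ A′ B′ C′ D′ k j) (λ k → block-ʳˡ A′ B′ C′ D′ k j))
                   (sym (block-ʳˡ AA AB CA CB i j)))
      (λ j → trans (entry (n ↑ʳ i) (n ↑ʳ j) (C i) (D i) (λ k → B′ k j) (λ k → D′ k j) (block-ʳˡ A B C D i)
          (block-ʳʳ A B C D i) (λ k → block-ˡʳ A′ B′ C′ D′ k j) (λ k → block-ʳʳ A′ B′ C′ D′ k j))
                   (sym (block-ʳʳ AA AB CA CB i j))))
    where
    AA = A ⊗ A′ ⊕ B ⊗ C′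
    AB = A ⊗ B′ ⊕ B ⊗ D′
    CA = C ⊗ A′ ⊕ D ⊗ C′
    CB = C ⊗ B′ ⊕ D ⊗ D′
    M = block A B C D
    N = block A′ B′ C′ D′
    entry : ∀ i j (u v s t : Vector Carrier n) → (∀ k → M i (k ↑ˡ n) ≈ u k) → (∀ k → M i (n ↑ʳ k) ≈ v k) →
      (∀ k → N (k ↑ˡ n) j ≈ s k) → (∀ k → N (n ↑ʳ k) j ≈ t k) →
      (M ⊗ N) i j ≈ sum (λ k → u k * s k) + sum (λ k → v k * t k)
    entry i j u v s t hu hv hs ht = trans (sum-++ n (λ k → M i k * N k j))
      (+-cong (sum-cong (λ k → M i (k ↑ˡ n) * N (k ↑ˡ n) j) (λ k → u k * s k) λ k → *-cong (hu k) (hs k))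
              (sum-cong (λ k → M i (n ↑ʳ k) * N (n ↑ʳ k) j) (λ k → v k * t k) λ k → *-cong (hv k) (ht k)))

  𝟘 : ∀ {m n} → Matrix Carrier m n
  𝟘 _ _ = 0#

  det-block-lower′ : ∀ {n} (A C D : Matrix Carrier n n) → det (block A 𝟘 C D) ≈ det A * det D
  det-block-lower′ {n} A C D = trans (det-block-lower n (block A 𝟘 C D) (block-ˡʳ A 𝟘 C D))
    (*-cong (det-cong (block-ˡˡ A 𝟘 C D)) (det-cong (block-ʳʳ A 𝟘 C D)))

  det-block-upper′ : ∀ {n} (A B D : Matrix Carrier n n) → det (block A B 𝟘 D) ≈ det A * det D
  det-block-upper′ {n} A B D = trans (det-block-upper n (block A B 𝟘 D) (block-ʳˡ A B 𝟘 D))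
    (*-cong (det-cong (block-ˡˡ A B 𝟘 D)) (det-cong (block-ʳʳ A B 𝟘 D)))

  diagonal : ∀ {n} → Vector Carrier n → Matrix Carrier n n
  diagonal v i j = v i * 𝟙 i j

  ⊗-diagonal : ∀ {m n} (M : Matrix Carrier m n) v i j → (M ⊗ diagonal v) i j ≈ M i j * v j
  ⊗-diagonal M v i j = trans (sum-cong-≋ λ k → sym (*-assoc (M i k) (v k) (𝟙 k j))) (sum-𝟙ʳ (λ k → M i k * v k) j)

  det-diagonal : ∀ {n} (v : Vector Carrier n) → det (diagonal v) ≈ product v
  det-diagonal {zero}  v = refl
  det-diagonal {suc n} v = begin
    det (diagonal v)
      ≈⟨ sum-single {f = laplace (diagonal v)} zero (λ j j≢0 → trans
           (*-congˡ (trans (*-congʳ (trans (*-congˡ (𝟙-off-diagonal zero j (j≢0 ∘ ≡.sym))) (zeroʳ _))) (zeroˡ _))) (zeroʳ _)) ⟩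
    1# * (v zero * 1# * det (diagonal (v ∘ suc)))
      ≈⟨ trans (*-identityˡ _) (*-cong (*-identityʳ _) (det-diagonal (v ∘ suc))) ⟩
    product v ∎

  -- The right factor clears the upper right block.
  det-block-diagonals : ∀ {n} (x x′ y y′ : Vector Carrier n) →
    det (block (diagonal x) (diagonal x′) (diagonal y) (diagonal y′)) * product x ≈
    product x * product (λ k → x k * y′ k - x′ k * y k)
  det-block-diagonals {n} x x′ y y′ = begin
    det Q * product x
      ≈⟨ *-congˡ (trans (det-block-upper′ 𝟙 (diagonal (λ k → - x′ k)) (diagonal x)) (trans (*-cong (det-𝟙 {n}) (det-diagonal x)) (*-identityˡ _))) ⟨
    det Q * det U
      ≈⟨ det-⊗ Q U ⟨
    det (Q ⊗ U)
      ≈⟨ det-cong (λ i j → trans (block-⊗ (diagonal x) (diagonal x′) (diagonal y) (diagonal y′) 𝟙 (diagonal (λ k → - x′ k)) 𝟘 (diagonal x) i j)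
           (block-cong (λ i j → refl) upper (λ i j → refl) lower i j)) ⟩
    det (block (diagonal x ⊗ 𝟙 ⊕ diagonal x′ ⊗ 𝟘) 𝟘 (diagonal y ⊗ 𝟙 ⊕ diagonal y′ ⊗ 𝟘) (diagonal (λ k → x k * y′ k - x′ k * y k)))
      ≈⟨ det-block-lower′ (diagonal x ⊗ 𝟙 ⊕ diagonal x′ ⊗ 𝟘) (diagonal y ⊗ 𝟙 ⊕ diagonal y′ ⊗ 𝟘) (diagonal (λ k → x k * y′ k - x′ k * y k)) ⟩
    det (diagonal x ⊗ 𝟙 ⊕ diagonal x′ ⊗ 𝟘) * det (diagonal (λ k → x k * y′ k - x′ k * y k))
      ≈⟨ *-cong (trans (det-cong left) (det-diagonal x)) (det-diagonal (λ k → x k * y′ k - x′ k * y k)) ⟩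
    product x * product (λ k → x k * y′ k - x′ k * y k) ∎
    where
    open RingSolver R
    Q = block (diagonal x) (diagonal x′) (diagonal y) (diagonal y′)
    U = block 𝟙 (diagonal (λ k → - x′ k)) 𝟘 (diagonal x)
    𝟙-swap : ∀ (v : Vector Carrier n) i j → 𝟙 i j * v j ≈ 𝟙 i j * v i
    𝟙-swap v i j with i Finₚ.≟ j
    ... | yes ≡.refl = refl
    ... | no  i≢j    = trans (trans (*-congʳ (𝟙-off-diagonal i j i≢j)) (zeroˡ _)) (sym (trans (*-congʳ (𝟙-off-diagonal i j i≢j)) (zeroˡ _)))
    products : ∀ (u v s t : Vector Carrier n) i j → (diagonal u ⊗ diagonal v ⊕ diagonal s ⊗ diagonal t) i j ≈
      (u i * v i + s i * t i) * 𝟙 i j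
    products u v s t i j = begin
      (diagonal u ⊗ diagonal v ⊕ diagonal s ⊗ diagonal t) i j
        ≈⟨ +-cong (⊗-diagonal (diagonal u) v i j) (⊗-diagonal (diagonal s) t i j) ⟩
      u i * 𝟙 i j * v j + s i * 𝟙 i j * t j
        ≈⟨ +-cong (trans (*-assoc _ _ _) (*-congˡ (𝟙-swap v i j))) (trans (*-assoc _ _ _) (*-congˡ (𝟙-swap t i j))) ⟩
      u i * (𝟙 i j * v i) + s i * (𝟙 i j * t i)
        ≈⟨ solve 5 (λ u v s t o → u :* (o :* v) :+ s :* (o :* t) := (u :* v :+ s :* t) :* o) refl (u i) (v i) (s i) (t i) (𝟙 i j) ⟩
      (u i * v i + s i * t i) * 𝟙 i j ∎
    upper : diagonal x ⊗ diagonal (λ k → - x′ k) ⊕ diagonal x′ ⊗ diagonal x ≋ 𝟘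
    upper i j = trans (products x (λ k → - x′ k) x′ x i j) (trans (*-congʳ
      (solve 2 (λ x x′ → x :* (:- x′) :+ x′ :* x := con (+ 0)) refl (x i) (x′ i))) (zeroˡ _))
    lower : diagonal y ⊗ diagonal (λ k → - x′ k) ⊕ diagonal y′ ⊗ diagonal x ≋ diagonal (λ k → x k * y′ k - x′ k * y k)
    lower i j = trans (products y (λ k → - x′ k) y′ x i j) (*-congʳ
      (solve 4 (λ x x′ y y′ → y :* (:- x′) :+ y′ :* x := x :* y′ :- x′ :* y) refl (x i) (x′ i) (y i) (y′ i)))
    left : diagonal x ⊗ 𝟙 ⊕ diagonal x′ ⊗ 𝟘 ≋ diagonal x
    left i j = trans (+-cong (sum-𝟙ʳ (diagonal x i) j) (sum-zero λ k → zeroʳ (diagonal x′ i k))) (+-identityʳ _)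

-- Quadratic extensions, and complex numbers over a commutative ring.

-- R[t] with t² = δ.  The product is written with μ = (δ *_), so that for δ = −1 it is the product of ℂ on the nose.
module QuadraticExtension (R : CommutativeRing 0ℓ 0ℓ) (δ : CommutativeRing.Carrier R)
  (μ : CommutativeRing.Carrier R → CommutativeRing.Carrier R)
  (μ≈ : ∀ x → CommutativeRing._≈_ R (μ x) (CommutativeRing._*_ R δ x)) where
  open CommutativeRing R hiding (zero)
  open RingSolver R

  infixr 4 _&_
  infix  4 _≈ₑ_

  -- A record, so that z and w can be inferred from a proof of z ≈ₑ w.
  record _≈ₑ_ (z w : Carrier × Carrier) : Set where
    constructor _&_
    field
      ≈-re : proj₁ z ≈ proj₁ w
      ≈-im : proj₂ z ≈ proj₂ w

  open _≈ₑ_ public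

  extension : CommutativeRing 0ℓ 0ℓ
  extension = record
    { Carrier = Carrier × Carrier
    ; _≈_ = _≈ₑ_
    ; _+_ = λ (a , b) (c , d) → a + c , b + d
    ; _*_ = λ (a , b) (c , d) → a * c + μ (b * d) , a * d + b * c
    ; -_  = λ (a , b) → - a , - b
    ; 0#  = 0# , 0#
    ; 1#  = 1# , 0#
    ; isCommutativeRing = record
      { isRing = record
        { +-isAbelianGroup = record
          { isGroup = record
            { isMonoid = record
              { isSemigroup = record
                { isMagma = record
                  { isEquivalence = record
                    { refl  = refl & refl
                    ; sym   = λ (p & q) → sym p & sym q
                    ; trans = λ (p & q) (p′ & q′) → trans p p′ & trans q q′
                    }
                  ; ∙-cong = λ (p & q) (p′ & q′) → +-cong p p′ & +-cong q q′
                  }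
                ; assoc = λ _ _ _ → +-assoc _ _ _ & +-assoc _ _ _
                }
              ; identity = (λ _ → +-identityˡ _ & +-identityˡ _) , (λ _ → +-identityʳ _ & +-identityʳ _)
              }
            ; inverse = (λ _ → -‿inverseˡ _ & -‿inverseˡ _) , (λ _ → -‿inverseʳ _ & -‿inverseʳ _)
            ; ⁻¹-cong = λ (p & q) → -‿cong p & -‿cong q
            }
          ; comm = λ _ _ → +-comm _ _ & +-comm _ _
          }
        ; *-cong = λ (p & q) (p′ & q′) →
            +-cong (*-cong p p′) (μ-cong (*-cong q q′)) & +-cong (*-cong p q′) (*-cong q p′)
        ; *-assoc = λ (a , b) (c , d) (e , f) →
            trans (+-cong (*-congʳ (+-congˡ (μ≈ (b * d)))) (μ≈ ((a * d + b * c) * f)))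
              (trans (solve 7 (λ a b c d e f δ → (a :* c :+ δ :* (b :* d)) :* e :+ δ :* ((a :* d :+ b :* c) :* f) :=
                a :* (c :* e :+ δ :* (d :* f)) :+ δ :* (b :* (c :* f :+ d :* e))) refl a b c d e f δ)
              (sym (+-cong (*-congˡ (+-congˡ (μ≈ (d * f)))) (μ≈ (b * (c * f + d * e)))))) &
            trans (+-congʳ (*-congʳ (+-congˡ (μ≈ (b * d)))))
              (trans (solve 7 (λ a b c d e f δ → (a :* c :+ δ :* (b :* d)) :* f :+ (a :* d :+ b :* c) :* e :=
                a :* (c :* f :+ d :* e) :+ b :* (c :* e :+ δ :* (d :* f))) refl a b c d e f δ)
              (+-congˡ (*-congˡ (+-congˡ (sym (μ≈ (d * f)))))))
        ; *-identity =
            (λ (a , b) → trans (+-cong (*-identityˡ a) (trans (μ≈ (0# * b)) (*-congˡ (zeroˡ b))))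
                (solve 2 (λ a δ → a :+ δ :* con (+ 0) := a) refl a δ) &
              trans (+-cong (*-identityˡ b) (zeroˡ a)) (+-identityʳ b)) ,
            (λ (a , b) → trans (+-cong (*-identityʳ a) (trans (μ≈ (b * 0#)) (*-congˡ (zeroʳ b))))
                (solve 2 (λ a δ → a :+ δ :* con (+ 0) := a) refl a δ) &
              trans (+-cong (zeroʳ a) (*-identityʳ b)) (+-identityˡ b))
        ; distrib =
            (λ (a , b) (c , d) (e , f) →
              trans (+-congˡ (μ≈ (b * (d + f))))
                (trans (solve 7 (λ a b c d e f δ → a :* (c :+ e) :+ δ :* (b :* (d :+ f)) :=
                  (a :* c :+ δ :* (b :* d)) :+ (a :* e :+ δ :* (b :* f))) refl a b c d e f δ)
                (sym (+-cong (+-congˡ (μ≈ (b * d))) (+-congˡ (μ≈ (b * f)))))) &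
              solve 6 (λ a b c d e f → a :* (d :+ f) :+ b :* (c :+ e) := (a :* d :+ b :* c) :+ (a :* f :+ b :* e)) refl a b c d e f) ,
            (λ (a , b) (c , d) (e , f) →
              trans (+-congˡ (μ≈ ((d + f) * b)))
                (trans (solve 7 (λ a b c d e f δ → (c :+ e) :* a :+ δ :* ((d :+ f) :* b) :=
                  (c :* a :+ δ :* (d :* b)) :+ (e :* a :+ δ :* (f :* b))) refl a b c d e f δ)
                (sym (+-cong (+-congˡ (μ≈ (d * b))) (+-congˡ (μ≈ (f * b)))))) &
              solve 6 (λ a b c d e f → (c :+ e) :* b :+ (d :+ f) :* a := (c :* b :+ d :* a) :+ (e :* b :+ f :* a)) refl a b c d e f)
        }
      ; *-comm = λ (a , b) (c , d) →
          +-cong (*-comm a c) (μ-cong (*-comm b d)) &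
          solve 4 (λ a b c d → a :* d :+ b :* c := c :* b :+ d :* a) refl a b c d
      }
    }
    where
    μ-cong : ∀ {x y} → x ≈ y → μ x ≈ μ y
    μ-cong {x} {y} x≈y = trans (μ≈ x) (trans (*-congˡ x≈y) (sym (μ≈ y)))

module Gaussian (R : CommutativeRing 0ℓ 0ℓ) where
  open CommutativeRing R hiding (zero)
  open RingSolver R
  open QuadraticExtension R (- 1#) -_ (λ x → sym (RingProperties.-1*x≈-x ring x)) public
    using (_&_; ≈-re; ≈-im) renaming (extension to gaussianRing)

  private
    module C = CommutativeRing gaussianRing

  conj : C.Carrier → C.Carrier
  conj (a , b) = a , - b

  real : Carrier → C.Carrier
  real a = a , 0#

  norm : C.Carrier → Carrier
  norm (a , b) = a * a + b * b

  norm-cong : ∀ {z w} → z C.≈ w → norm z ≈ norm w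
  norm-cong (p & q) = +-cong (*-cong p p) (*-cong q q)

  norm-* : ∀ z w → norm (z C.* w) ≈ norm z * norm w
  norm-* (a , b) (c , d) = solve 4 (λ a b c d →
    (a :* c :- b :* d) :* (a :* c :- b :* d) :+ (a :* d :+ b :* c) :* (a :* d :+ b :* c) :=
    (a :* a :+ b :* b) :* (c :* c :+ d :* d)) refl a b c d

  norm-real : ∀ a → norm (real a) ≈ a * a
  norm-real a = trans (+-congˡ (zeroˡ 0#)) (+-identityʳ _)

  norm-conj : ∀ z → norm (conj z) ≈ norm z
  norm-conj (a , b) = solve 2 (λ a b → a :* a :+ (:- b) :* (:- b) := a :* a :+ b :* b) refl a b

  conj-injective : ∀ {z w} → conj z C.≈ conj w → z C.≈ w
  conj-injective {_ , b} {_ , d} (p & q) = p & trans (sym (-‿involutive b)) (trans (-‿cong q) (-‿involutive d))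
    where open RingProperties ring using (-‿involutive)

  *-conj : ∀ z → z C.* conj z C.≈ real (norm z)
  *-conj (a , b) = solve 2 (λ a b → a :* a :- b :* (:- b) := a :* a :+ b :* b) refl a b &
    solve 2 (λ a b → a :* (:- b) :+ b :* a := con (+ 0)) refl a b

  conj-isRingHomomorphism : IsRingHomomorphism C.rawRing C.rawRing conj
  conj-isRingHomomorphism = mkRingHomomorphism conj (λ (p & q) → p & -‿cong q)
    (λ (a , b) (c , d) → refl & solve 2 (λ b d → :- (b :+ d) := :- b :+ :- d) refl b d)
    (λ (a , b) (c , d) →
      solve 4 (λ a b c d → a :* c :- b :* d := a :* c :- (:- b) :* (:- d)) refl a b c d &
      solve 4 (λ a b c d → :- (a :* d :+ b :* c) := a :* (:- d) :+ (:- b) :* c) refl a b c d)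
    (λ _ → refl & refl)
    (refl & solve 0 (:- con (+ 0) := con (+ 0)) refl)
    (refl & solve 0 (:- con (+ 0) := con (+ 0)) refl)

  real-isRingHomomorphism : IsRingHomomorphism rawRing C.rawRing real
  real-isRingHomomorphism = mkRingHomomorphism real (λ p → p & refl)
    (λ _ _ → refl & sym (+-identityˡ 0#))
    (λ a b →
      solve 2 (λ a b → a :* b := a :* b :- con (+ 0) :* con (+ 0)) refl a b &
      solve 2 (λ a b → con (+ 0) := a :* con (+ 0) :+ con (+ 0) :* b) refl a b)
    (λ _ → refl & solve 0 (con (+ 0) := :- con (+ 0)) refl)
    (refl & refl)
    (refl & refl)

-- Integers in ℚ, and homomorphisms from ℚ.

module IntegersInℚ where
  toℚᵘ-/1 : ∀ a → ℚ.toℚᵘ (a / 1) ℚᵘ.≃ ℚᵘ.mkℚᵘ a 0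
  toℚᵘ-/1 a = ℚₚ.toℚᵘ-fromℚᵘ (ℚᵘ.mkℚᵘ a 0)

  +-/1 : ∀ a b → (a ℤ.+ b) / 1 ≡ a / 1 ℚ.+ b / 1
  +-/1 a b = ℚₚ.toℚᵘ-injective (ℚᵘₚ.≃-trans (toℚᵘ-/1 (a ℤ.+ b)) (ℚᵘₚ.≃-sym
    (ℚᵘₚ.≃-trans (ℚₚ.toℚᵘ-homo-+ (a / 1) (b / 1)) (ℚᵘₚ.≃-trans (ℚᵘₚ.+-cong (toℚᵘ-/1 a) (toℚᵘ-/1 b))
      (ℚᵘ.*≡* (≡.cong (ℤ._* + 1) (≡.cong₂ ℤ._+_ (ℤₚ.*-identityʳ a) (ℤₚ.*-identityʳ b))))))))

  *-/1 : ∀ a b → (a ℤ.* b) / 1 ≡ a / 1 ℚ.* (b / 1)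
  *-/1 a b = ℚₚ.toℚᵘ-injective (ℚᵘₚ.≃-trans (toℚᵘ-/1 (a ℤ.* b)) (ℚᵘₚ.≃-sym
    (ℚᵘₚ.≃-trans (ℚₚ.toℚᵘ-homo-* (a / 1) (b / 1)) (ℚᵘₚ.*-cong (toℚᵘ-/1 a) (toℚᵘ-/1 b)))))

  -‿/1 : ∀ a → (ℤ.- a) / 1 ≡ ℚ.- (a / 1)
  -‿/1 a = ℚₚ.toℚᵘ-injective (ℚᵘₚ.≃-trans (toℚᵘ-/1 (ℤ.- a)) (ℚᵘₚ.≃-sym
    (ℚᵘₚ.≃-trans (ℚₚ.toℚᵘ-homo‿- (a / 1)) (ℚᵘₚ.-‿cong (toℚᵘ-/1 a)))))

  denominator reciprocal : ℚ → ℚ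
  denominator (mkℚ _ d _) = + suc d / 1
  reciprocal  (mkℚ _ d _) = + 1 / suc d

  q*denominator : ∀ q → q ℚ.* denominator q ≡ ℚ.numerator q / 1
  q*denominator q@(mkℚ p d _) = ℚₚ.toℚᵘ-injective (ℚᵘₚ.≃-trans (ℚₚ.toℚᵘ-homo-* q (+ suc d / 1))
    (ℚᵘₚ.≃-trans (ℚᵘₚ.*-congˡ {ℚ.toℚᵘ q} (toℚᵘ-/1 (+ suc d)))
    (ℚᵘₚ.≃-trans (ℚᵘ.*≡* (≡.trans (ℤₚ.*-identityʳ _) (≡.cong (λ e → p ℤ.* + e) (≡.sym (ℕₚ.*-identityʳ (suc d)))))) (ℚᵘₚ.≃-sym (toℚᵘ-/1 p)))))

  [1+d]*1/[1+d] : ∀ d → (+ suc d / 1) ℚ.* (+ 1 / suc d) ≡ 1ℚ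
  [1+d]*1/[1+d] d = ℚₚ.toℚᵘ-injective (ℚᵘₚ.≃-trans (ℚₚ.toℚᵘ-homo-* (+ suc d / 1) (+ 1 / suc d))
    (ℚᵘₚ.≃-trans (ℚᵘₚ.*-cong (toℚᵘ-/1 (+ suc d)) (ℚₚ.toℚᵘ-fromℚᵘ (ℚᵘ.mkℚᵘ (+ 1) d)))
      (ℚᵘ.*≡* (≡.cong +_ (≡.trans (ℕₚ.*-identityʳ _) (≡.trans (ℕₚ.*-identityʳ _) (≡.sym (≡.trans (ℕₚ.+-identityʳ _) (ℕₚ.+-identityʳ _)))))))))

  denominator*reciprocal : ∀ q → denominator q ℚ.* reciprocal q ≡ 1ℚ
  denominator*reciprocal (mkℚ _ d _) = [1+d]*1/[1+d] d

open IntegersInℚ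

/1-isRingHomomorphism : IsRingHomomorphism ℤ.+-*-rawRing ℚ.+-*-rawRing (_/ 1)
/1-isRingHomomorphism = mkRingHomomorphism (_/ 1) (≡.cong (_/ 1)) +-/1 *-/1 -‿/1 ≡.refl ≡.refl

_∘ʰ_ : ∀ {A B : RawRing 0ℓ 0ℓ} {C : CommutativeRing 0ℓ 0ℓ} {f g} →
  IsRingHomomorphism B (CommutativeRing.rawRing C) g → IsRingHomomorphism A B f →
  IsRingHomomorphism A (CommutativeRing.rawRing C) (g ∘ f)
_∘ʰ_ {C = C} g f = Composition.isRingHomomorphism (CommutativeRing.trans C) f g

module ℚ-Homomorphisms (R : CommutativeRing 0ℓ 0ℓ) where
  open CommutativeRing R hiding (zero)
  open SetoidReasoning setoid

  module _ {f g : ℚ → Carrier} (f-hom : IsRingHomomorphism ℚ.+-*-rawRing rawRing f)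
    (g-hom : IsRingHomomorphism ℚ.+-*-rawRing rawRing g) where
    private
      module f = IsRingHomomorphism f-hom
      module g = IsRingHomomorphism g-hom

    agree-ℕ : ∀ n → f (+ n / 1) ≈ g (+ n / 1)
    agree-ℕ zero    = trans f.0#-homo (sym g.0#-homo)
    agree-ℕ (suc n) = begin
      f (+ suc n / 1)            ≡⟨ ≡.cong f (+-/1 (+ 1) (+ n)) ⟩
      f (1ℚ ℚ.+ + n / 1)         ≈⟨ f.+-homo 1ℚ (+ n / 1) ⟩
      f 1ℚ + f (+ n / 1)         ≈⟨ +-cong (trans f.1#-homo (sym g.1#-homo)) (agree-ℕ n) ⟩
      g 1ℚ + g (+ n / 1)         ≈⟨ g.+-homo 1ℚ (+ n / 1) ⟨
      g (1ℚ ℚ.+ + n / 1)         ≡⟨ ≡.cong g (+-/1 (+ 1) (+ n)) ⟨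
      g (+ suc n / 1)            ∎

    agree-ℤ : ∀ a → f (a / 1) ≈ g (a / 1)
    agree-ℤ (+ n)    = agree-ℕ n
    agree-ℤ -[1+ n ] = begin
      f (-[1+ n ] / 1)          ≡⟨ ≡.cong f (-‿/1 (+ suc n)) ⟩
      f (ℚ.- (+ suc n / 1))     ≈⟨ f.-‿homo (+ suc n / 1) ⟩
      - f (+ suc n / 1)         ≈⟨ -‿cong (agree-ℕ (suc n)) ⟩
      - g (+ suc n / 1)         ≈⟨ g.-‿homo (+ suc n / 1) ⟨
      g (ℚ.- (+ suc n / 1))     ≡⟨ ≡.cong g (-‿/1 (+ suc n)) ⟨
      g (-[1+ n ] / 1)          ∎

    -- Both values become equal after multiplication by the common image of the denominator, which
    -- is cancelled by the image of its reciprocal.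
    agree : ∀ q → f q ≈ g q
    agree q = begin
      f q                     ≈⟨ *-identityʳ _ ⟨
      f q * 1#                ≈⟨ *-congˡ gd*gr ⟨
      f q * (g d * g r)       ≈⟨ *-assoc _ _ _ ⟨
      f q * g d * g r         ≈⟨ *-congʳ (*-congˡ (sym (agree-d q))) ⟩
      f q * f d * g r         ≈⟨ *-congʳ (trans (sym (f.*-homo q d)) (reflexive (≡.cong f (q*denominator q)))) ⟩
      f (ℚ.numerator q / 1) * g r     ≈⟨ *-congʳ (agree-ℤ (ℚ.numerator q)) ⟩
      g (ℚ.numerator q / 1) * g r     ≈⟨ *-congʳ (trans (reflexive (≡.cong g (≡.sym (q*denominator q)))) (g.*-homo q d)) ⟩
      g q * g d * g r         ≈⟨ *-assoc _ _ _ ⟩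
      g q * (g d * g r)       ≈⟨ *-congˡ gd*gr ⟩
      g q * 1#                ≈⟨ *-identityʳ _ ⟩
      g q                     ∎
      where
      d = denominator q
      r = reciprocal q
      gd*gr : g d * g r ≈ 1#
      gd*gr = trans (sym (g.*-homo d r)) (trans (reflexive (≡.cong g (denominator*reciprocal q))) g.1#-homo)
      agree-d : ∀ q → f (denominator q) ≈ g (denominator q)
      agree-d (mkℚ _ d _) = agree-ℕ (suc d)

-- Coordinates and endomorphisms of a number field.

module NumberFieldProperties {n} (K : NumberField n) where
  open NumberField K hiding (zero)
  open SetoidReasoning setoid
  module fromℚ = IsRingHomomorphism fromℚ-isRingHomomorphism
  open Sum semiring using (sum-cong-≋)
  open RingProperties ring using (-‿distribʳ-*)

  fromℤ-isRingHomomorphism : IsRingHomomorphism ℤ.+-*-rawRing rawRing fromℤ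
  fromℤ-isRingHomomorphism = _∘ʰ_ {C = commutativeRing} fromℚ-isRingHomomorphism /1-isRingHomomorphism

  combination : Vector ℚ n → Carrier
  combination c = sum λ i → fromℚ (c i) * basis i

  coordinates-combination : ∀ x → x ≈ combination (coordinates x)
  coordinates-combination x = proj₁ (proj₂ (proj₂ isBasis x tt))

  coordinates-unique : ∀ x c → x ≈ combination c → ∀ i → coordinates x i ≡ c i
  coordinates-unique x = proj₂ (proj₂ (proj₂ isBasis x tt))

  coordinates-cong : ∀ {x y} → x ≈ y → ∀ i → coordinates x i ≡ coordinates y i
  coordinates-cong {x} {y} x≈y = coordinates-unique x (coordinates y) (trans x≈y (coordinates-combination y))

  infix 4 _≟_
  -- Coordinates are unique rationals, which can be compared. The case distinctions in `injective`
  -- and `separator` rest on this.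
  _≟_ : ∀ x y → Dec (x ≈ y)
  x ≟ y = map′ (λ h → trans (coordinates-combination x) (trans (sum-cong-≋ (λ i → *-congʳ (fromℚ.⟦⟧-cong (h i)))) (sym (coordinates-combination y))))
               coordinates-cong
               (Finₚ.all? λ i → coordinates x i ℚₚ.≟ coordinates y i)

  *-cancelˡ-0 : ∀ {x y} → ¬ (x ≈ 0#) → x * y ≈ 0# → y ≈ 0#
  *-cancelˡ-0 {x} {y} x≉0 xy≈0 = let (z , xz≈1) = inverse x x≉0 in begin
    y              ≈⟨ *-identityˡ y ⟨
    1# * y         ≈⟨ *-congʳ (trans (sym xz≈1) (*-comm x z)) ⟩
    z * x * y      ≈⟨ *-assoc z x y ⟩
    z * (x * y)    ≈⟨ *-congˡ xy≈0 ⟩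
    z * 0#         ≈⟨ zeroʳ z ⟩
    0#             ∎

  x-y≈0⇒x≈y : ∀ {x y} → x - y ≈ 0# → x ≈ y
  x-y≈0⇒x≈y {x} {y} h = begin
    x              ≈⟨ +-identityʳ x ⟨
    x + 0#         ≈⟨ +-congˡ (-‿inverseˡ y) ⟨
    x + (- y + y)  ≈⟨ +-assoc x (- y) y ⟨
    x - y + y      ≈⟨ +-congʳ h ⟩
    0# + y         ≈⟨ +-identityˡ y ⟩
    y              ∎

  *-cancelˡ : ∀ {x y z} → ¬ (x ≈ 0#) → x * y ≈ x * z → y ≈ z
  *-cancelˡ {x} {y} {z} x≉0 xy≈xz = x-y≈0⇒x≈y (*-cancelˡ-0 x≉0 (begin
    x * (y - z)          ≈⟨ distribˡ x y (- z) ⟩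
    x * y + x * - z      ≈⟨ +-cong xy≈xz (sym (-‿distribʳ-* x z)) ⟩
    x * z - x * z        ≈⟨ -‿inverseʳ _ ⟩
    0#                   ∎))

  module Into (R : CommutativeRing 0ℓ 0ℓ) {f : Carrier → CommutativeRing.Carrier R}
    (hom : IsRingHomomorphism rawRing (CommutativeRing.rawRing R) f) where
    private
      module R = CommutativeRing R
    open IsRingHomomorphism hom

    -- If x and y differed, x - y would be a unit with image 0, and 1 would equal 0 in the target.
    injective : ¬ (R.1# R.≈ R.0#) → ∀ {x y} → f x R.≈ f y → x ≈ y
    injective 1≉0 {x} {y} fx≈fy with (x - y) ≟ 0#
    ... | yes x-y≈0 = x-y≈0⇒x≈y x-y≈0
    ... | no  x-y≉0 = let (z , h) = inverse (x - y) x-y≉0 in contradiction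
      (R.trans (R.sym 1#-homo) (R.trans (⟦⟧-cong (sym h)) (R.trans (*-homo (x - y) z) (R.trans (R.*-congʳ
        (R.trans (+-homo x (- y)) (R.trans (R.+-cong fx≈fy (-‿homo y)) (R.-‿inverseʳ _)))) (R.zeroˡ _))))) 1≉0

  Endomorphism : (Carrier → Carrier) → Set
  Endomorphism = IsRingHomomorphism rawRing rawRing

  endomorphism-fixes-ℚ : ∀ {α} → Endomorphism α → ∀ q → α (fromℚ q) ≈ fromℚ q
  endomorphism-fixes-ℚ α-hom = ℚ-Homomorphisms.agree commutativeRing
      (_∘ʰ_ {C = commutativeRing} α-hom fromℚ-isRingHomomorphism) fromℚ-isRingHomomorphism

  endomorphism-combination : ∀ {α} → Endomorphism α → ∀ x → α x ≈ sum (λ i → fromℚ (coordinates x i) * α (basis i))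
  endomorphism-combination {α} α-hom x = begin
    α x                                                  ≈⟨ ⟦⟧-cong (coordinates-combination x) ⟩
    α (combination (coordinates x))                      ≈⟨ Homomorphism.sum-homo rawRing commutativeRing α-hom
        (λ i → fromℚ (coordinates x i) * basis i) ⟩
    sum (λ i → α (fromℚ (coordinates x i) * basis i))    ≈⟨ sum-cong-≋ {n} (λ i → trans
        (*-homo (fromℚ (coordinates x i)) (basis i)) (*-congʳ (endomorphism-fixes-ℚ α-hom (coordinates x i)))) ⟩
    sum (λ i → fromℚ (coordinates x i) * α (basis i))    ∎
    where open IsRingHomomorphism α-hom

-- Independence of automorphisms, and the trace as a sum of conjugates.

module TraceFormula {m} (K : NumberField (suc m)) where
  open NumberField K hiding (zero)
  open NumberFieldProperties K
  open SetoidReasoning setoid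
  open Determinant commutativeRing
  open LinearAlgebra rawRing using (_⊗_)
  open Sum semiring using (*-distribˡ-sum; ∑-distrib-+; ∑-comm)
  open RingSolver commutativeRing

  module _ (α : Fin (suc m) → Carrier → Carrier) (α-hom : ∀ k → Endomorphism (α k))
    (distinct : ∀ k l → k ≢ l → ¬ (∀ x → α k x ≈ α l x)) where
    private
      N = suc m
      module α k = IsRingHomomorphism (α-hom k)

    -- An endomorphism is determined by its values on the basis, so a finite search through the
    -- basis finds a witness.
    separator : ∀ k l → k ≢ l → ∃[ d ] ¬ (α k d ≈ α l d)
    separator k l k≢l with Finₚ.all? (λ i → α k (basis i) ≟ α l (basis i))
    ... | yes same = contradiction (λ x → trans (endomorphism-combination (α-hom k) x)
      (trans (sum-cong (λ i → fromℚ (coordinates x i) * α k (basis i)) (λ i → fromℚ (coordinates x i) * α l (basis i)) (λ i → *-congˡ (same i)))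
        (sym (endomorphism-combination (α-hom l) x)))) (distinct k l k≢l)
    ... | no ¬same = let (i , h) = Finₚ.¬∀⟶∃¬ N _ (λ i → α k (basis i) ≟ α l (basis i)) ¬same in basis i , h

    evaluate : Vector Carrier N → Fin N → Carrier
    evaluate u l = sum λ j → u j * α l (basis j)

    -- Multiplies the operator Σⱼ uⱼ α(bⱼ) of α by a (α(d) − c).
    multiply : ∀ (u : Vector Carrier N) a c d → ∃[ v ] (∀ l → evaluate v l ≈ a * ((α l d - c) * evaluate u l))
    multiply u a c d = v , value
      where
      -- The matrix of multiplication by `d`. Since endomorphisms fix ℚ, it turns the factor `α l d`
      -- into a change of the coefficients `u` that is the same for every `l`.
      q : Fin N → Fin N → Carrier
      q j i = fromℚ (coordinates (d * basis j) i)
      v : Vector Carrier N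
      v i = sum (λ j → a * u j * q j i) + - (a * c) * u i
      value : ∀ l → evaluate v l ≈ a * ((α l d - c) * evaluate u l)
      value l = begin
        sum (λ i → (sum (λ j → a * u j * q j i) + - (a * c) * u i) * b i)
          ≈⟨ sum-cong (λ i → v i * b i) (λ i → sum (λ j → a * u j * q j i) * b i + - (a * c) * (u i * b i))
               (λ i → trans (distribʳ _ _ _) (+-congˡ (*-assoc _ _ _))) ⟩
        sum (λ i → sum (λ j → a * u j * q j i) * b i + - (a * c) * (u i * b i))
          ≈⟨ ∑-distrib-+ (λ i → sum (λ j → a * u j * q j i) * b i) (λ i → - (a * c) * (u i * b i)) ⟩
        sum (λ i → sum (λ j → a * u j * q j i) * b i) + sum (λ i → - (a * c) * (u i * b i))
          ≈⟨ +-cong first (sym (*-distribˡ-sum (- (a * c)) (λ i → u i * b i))) ⟩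
        a * α l d * e + - (a * c) * e
          ≈⟨ solve 4 (λ a d c e → a :* d :* e :+ :- (a :* c) :* e := a :* ((d :- c) :* e)) refl a (α l d) c e ⟩
        a * ((α l d - c) * e) ∎
        where
        b = λ i → α l (basis i)
        e = evaluate u l
        first : sum (λ i → sum (λ j → a * u j * q j i) * b i) ≈ a * α l d * e
        first = begin
          ((λ _ j → a * u j) ⊗ q ⊗ (λ i (_ : Fin 1) → b i)) (zero {0}) zero
            ≈⟨ ⊗-assoc (λ (_ : Fin 1) j → a * u j) q (λ i (_ : Fin 1) → b i) zero zero ⟩
          sum (λ j → a * u j * sum (λ i → q j i * b i))
            ≈⟨ sum-cong (λ j → a * u j * sum (λ i → q j i * b i)) (λ j → a * α l d * (u j * b j)) (λ j → trans (*-congˡ (trans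
                 (sym (endomorphism-combination (α-hom l) (d * basis j))) (α.*-homo l d (basis j))))
                 (solve 4 (λ a u d b → a :* u :* (d :* b) := a :* d :* (u :* b)) refl a (u j) (α l d) (b j))) ⟩
          sum (λ j → a * α l d * (u j * b j))
            ≈⟨ *-distribˡ-sum (a * α l d) (λ j → u j * b j) ⟨
          a * α l d * e ∎

    -- Artin: a product of factors (α(d) − αₗ(d)) / (αₖ(d) − αₗ(d)) isolates αₖ.
    isolate : ∀ {p} k (L : Fin p → Fin N) → (∀ i → k ≢ L i) →
      ∃[ u ] (evaluate u k ≈ 1# × (∀ i → evaluate u (L i) ≈ 0#))
    isolate {zero}  k L _ = (λ j → fromℚ (coordinates 1# j)) ,
      trans (sym (endomorphism-combination (α-hom k) 1#)) (α.1#-homo k) , λ ()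
    isolate {suc p} k L k≢L = v , at-k , λ { zero → at-0 ; (suc i) → trans (value (L (suc i)))
        (trans (*-congˡ (trans (*-congˡ (u-rest i)) (zeroʳ _))) (zeroʳ _)) }
      where
      others = isolate k (L ∘ suc) (k≢L ∘ suc)
      u = proj₁ others
      u-k = proj₁ (proj₂ others)
      u-rest = proj₂ (proj₂ others)
      d = proj₁ (separator k (L zero) (k≢L zero))
      δ = α k d - α (L zero) d
      δ⁻¹ : ∃[ a ] δ * a ≈ 1#
      δ⁻¹ = inverse δ (proj₂ (separator k (L zero) (k≢L zero)) ∘ x-y≈0⇒x≈y)
      a = proj₁ δ⁻¹
      v = proj₁ (multiply u a (α (L zero) d) d)
      value = proj₂ (multiply u a (α (L zero) d) d)
      at-k : evaluate v k ≈ 1#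
      at-k = begin
        evaluate v k             ≈⟨ value k ⟩
        a * (δ * evaluate u k)   ≈⟨ *-congˡ (*-congˡ u-k) ⟩
        a * (δ * 1#)             ≈⟨ *-congˡ (*-identityʳ δ) ⟩
        a * δ                    ≈⟨ *-comm a δ ⟩
        δ * a                    ≈⟨ proj₂ δ⁻¹ ⟩
        1#                       ∎
      at-0 : evaluate v (L zero) ≈ 0#
      at-0 = trans (value (L zero)) (trans (*-congˡ (trans (*-congʳ (-‿inverseʳ _)) (zeroˡ _))) (zeroʳ a))

    private
      isolated = λ k → isolate k (punchIn k) (λ i k≡ → Finₚ.punchInᵢ≢i k i (≡.sym k≡))

      U V : Matrix Carrier N N
      U k = proj₁ (isolated k)
      V j l = α l (basis j)

      UV≋𝟙 : U ⊗ V ≋ 𝟙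
      UV≋𝟙 k l with punchView k l
      ... | here    = trans (proj₁ (proj₂ (isolated k))) (sym (𝟙-diagonal k))
      ... | there i = trans (proj₂ (proj₂ (isolated k)) i) (sym (𝟙-off-diagonal k _ (λ k≡ → Finₚ.punchInᵢ≢i k i (≡.sym k≡))))

      VU≋𝟙 : V ⊗ U ≋ 𝟙
      VU≋𝟙 = left-inverse⇒right-inverse U V UV≋𝟙

    -- Let C be the matrix of multiplication by x. The columns of V are eigenvectors, C V = V
    -- diag(αₖ x), and U is the two-sided inverse of V, so the trace of C = C V U is the sum of the
    -- αₖ x.
    trace-formula : ∀ x → fromℚ (Tr x) ≈ sum (λ k → α k x)
    trace-formula x = begin
      fromℚ (Tr x)
        ≈⟨ Homomorphism.sum-homo ℚ.+-*-rawRing commutativeRing fromℚ-isRingHomomorphism (λ i → coordinates (x * basis i) i) ⟩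
      sum (λ i → C i i)
        ≈⟨ sum-cong (λ i → C i i) (λ i → (C ⊗ V ⊗ U) i i) (λ i → sym (trans (⊗-assoc C V U i i) (trans (⊗-congˡ C VU≋𝟙 i i) (sum-𝟙ʳ (C i) i)))) ⟩
      sum (λ i → sum (λ k → (C ⊗ V) i k * U k i))
        ≈⟨ ∑-comm (λ i k → (C ⊗ V) i k * U k i) ⟩
      sum (λ k → sum (λ i → (C ⊗ V) i k * U k i))
        ≈⟨ sum-cong (λ k → sum (λ i → (C ⊗ V) i k * U k i)) (λ k → α k x) (λ k → trans
             (sum-cong (λ i → (C ⊗ V) i k * U k i) (λ i → α k x * (U k i * V i k)) (λ i → trans (*-congʳ (CV i k))
               (solve 3 (λ x v u → x :* v :* u := x :* (u :* v)) refl (α k x) (V i k) (U k i))))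
             (trans (sym (*-distribˡ-sum (α k x) (λ i → U k i * V i k)))
               (trans (*-congˡ (trans (UV≋𝟙 k k) (𝟙-diagonal k))) (*-identityʳ _)))) ⟩
      sum (λ k → α k x) ∎
      where
      C : Matrix Carrier N N
      C i j = fromℚ (coordinates (x * basis i) j)
      CV : ∀ i k → (C ⊗ V) i k ≈ α k x * V i k
      CV i k = trans (sym (endomorphism-combination (α-hom k) (x * basis i))) (α.*-homo k x (basis i))

-- Determinants of conjugates and the index of a lattice.

module LatticeIndex {m} (K : NumberField (suc m)) where
  open NumberField K hiding (zero)
  open NumberFieldProperties K
  open SetoidReasoning setoid
  open Determinant commutativeRing
  open BlockMatrix commutativeRing
  open LinearAlgebra rawRing using (_⊗_; _ᵀ; det)
  open RawPower (RawRing.rawSemiring rawRing) using (product)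
  open Sum semiring using (sum-cong-≋)
  private
    module ℤM = BlockMatrix ℤₚ.+-*-commutativeRing
    module ℤL = LinearAlgebra ℤ.+-*-rawRing
    N = suc m
    M = Matrix Carrier N N

  product-nonzero : ∀ {k} {v : Vector Carrier k} → (∀ i → ¬ (v i ≈ 0#)) → ¬ (product v ≈ 0#)
  product-nonzero {zero}  h = 1≉0
  product-nonzero {suc k} h p = product-nonzero (h ∘ suc) (*-cancelˡ-0 (h zero) p)

  endomorphism-nonzero : ∀ {α} → Endomorphism α → ∀ {x} → ¬ (x ≈ 0#) → ¬ (α x ≈ 0#)
  endomorphism-nonzero α-hom x≉0 αx≈0 = x≉0 (Into.injective commutativeRing α-hom 1≉0
    (trans αx≈0 (sym (IsRingHomomorphism.0#-homo α-hom))))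

  fromℤ-block : ∀ (A B C D : Matrix ℤ N N) → (λ i j → fromℤ (ℤM.block A B C D i j)) ≋
    block (λ i j → fromℤ (A i j)) (λ i j → fromℤ (B i j)) (λ i j → fromℤ (C i j)) (λ i j → fromℤ (D i j))
  fromℤ-block A B C D = split-cases _
    (λ i → split-cases _
      (λ j → trans (fromℤ.⟦⟧-cong (ℤM.block-ˡˡ A B C D i j)) (sym (block-ˡˡ _ _ _ _ i j)))
      (λ j → trans (fromℤ.⟦⟧-cong (ℤM.block-ˡʳ A B C D i j)) (sym (block-ˡʳ _ _ _ _ i j))))
    (λ i → split-cases _
      (λ j → trans (fromℤ.⟦⟧-cong (ℤM.block-ʳˡ A B C D i j)) (sym (block-ʳˡ _ _ _ _ i j)))
      (λ j → trans (fromℤ.⟦⟧-cong (ℤM.block-ʳʳ A B C D i j)) (sym (block-ʳʳ _ _ _ _ i j))))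
    where module fromℤ = IsRingHomomorphism fromℤ-isRingHomomorphism

  module _ (α : Fin N → Carrier → Carrier) (α-hom : ∀ k → Endomorphism (α k)) where
    private
      module α k = IsRingHomomorphism (α-hom k)

    conjugates : Vector Carrier N → M
    conjugates v i k = α k (v i)

    norm : Carrier → Carrier
    norm x = product λ k → α k x

    -- The trace formula identifies W Wᵀ with the trace matrix of `ω`.
    det-conjugates² : (∀ k l → k ≢ l → ¬ (∀ x → α k x ≈ α l x)) → ∀ ω Δ →
      LinearAlgebra.det ℚ.+-*-rawRing (λ i j → Tr (ω i * ω j)) ≡ Δ / 1 →
      det (conjugates ω) * det (conjugates ω) ≈ fromℤ Δ
    det-conjugates² distinct ω Δ disc = begin
      det W * det W                            ≈⟨ *-congˡ (det-ᵀ W) ⟨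
      det W * det (W ᵀ)                        ≈⟨ det-⊗ W (W ᵀ) ⟨
      det (W ⊗ W ᵀ)                            ≈⟨ det-cong (λ i j → trans (sum-cong-≋ {N} (λ k → sym (α.*-homo k (ω i) (ω j))))
                                                    (sym (TraceFormula.trace-formula K α α-hom distinct (ω i * ω j)))) ⟩
      det (λ i j → fromℚ (Tr (ω i * ω j)))     ≈⟨ Homomorphism.det-homo ℚ.+-*-rawRing commutativeRing fromℚ-isRingHomomorphism
                                                    (λ i j → Tr (ω i * ω j)) ⟨
      fromℚ _                                  ≈⟨ fromℚ.⟦⟧-cong disc ⟩
      fromℤ Δ                                  ∎
      where
      W : M
      W = conjugates ω

    -- The sums over k are the entries of E diag(αₖ ξ) E′ᵀ.
    gram : ∀ e e′ ξ (G : Matrix ℤ N N) → (∀ i j → sum (λ k → α k (ξ * (e i * e′ j))) ≈ fromℤ (G i j)) →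
      det (conjugates e) * norm ξ * det (conjugates e′) ≈ fromℤ (ℤL.det G)
    gram e e′ ξ G h = begin
      det E * norm ξ * det E′                    ≈⟨ *-cong (*-congˡ (det-diagonal (λ k → α k ξ))) (det-ᵀ E′) ⟨
      det E * det (diagonal X) * det (E′ ᵀ)      ≈⟨ *-congʳ (det-⊗ E (diagonal X)) ⟨
      det (E ⊗ diagonal X) * det (E′ ᵀ)          ≈⟨ det-⊗ (E ⊗ diagonal X) (E′ ᵀ) ⟨
      det (E ⊗ diagonal X ⊗ E′ ᵀ)                ≈⟨ det-cong entry ⟩
      det (λ i j → fromℤ (G i j))                ≈⟨ Homomorphism.det-homo ℤ.+-*-rawRing commutativeRing fromℤ-isRingHomomorphism G ⟨
      fromℤ (ℤL.det G)                           ∎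
      where
      open RingSolver commutativeRing
      E E′ : M
      E  = conjugates e
      E′ = conjugates e′
      X : Vector Carrier N
      X k = α k ξ
      entry : ∀ i j → (E ⊗ diagonal X ⊗ E′ ᵀ) i j ≈ fromℤ (G i j)
      entry i j = trans (sum-cong-≋ {N} (λ k → trans (*-congʳ (⊗-diagonal E X i k))
        (trans (solve 3 (λ a x b → a :* x :* b := x :* (a :* b)) refl (α k (e i)) (α k ξ) (α k (e′ j)))
          (sym (trans (α.*-homo k ξ (e i * e′ j)) (*-congˡ (α.*-homo k (e i) (e′ j)))))))) (h i j)

    -- The rows of P express O (x , σx) + O (y , σy), with O spanned by ω, in the basis (eⱼ , 0), (0 , σeⱼ).
    index : ∀ {σ} → Endomorphism σ → ∀ {ω e : Vector Carrier N} {x y} {A A′ B B′ : Matrix ℤ N N} → ¬ (x ≈ 0#) →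
      (∀ i → ω i * x ≈ sum (λ j → fromℤ (A i j) * e j)) → (∀ i → ω i * σ x ≈ sum (λ j → fromℤ (A′ i j) * σ (e j))) →
      (∀ i → ω i * y ≈ sum (λ j → fromℤ (B i j) * e j)) → (∀ i → ω i * σ y ≈ sum (λ j → fromℤ (B′ i j) * σ (e j))) →
      ∃[ p ] fromℤ p * (det (conjugates e) * det (conjugates (σ ∘ e))) ≈
             det (conjugates ω) * det (conjugates ω) * norm (x * σ y - σ x * y)
    index {σ} σ-hom {ω} {e} {x} {y} {A} {A′} {B} {B′} x≉0 hA hA′ hB hB′ = ℤL.det Pℤ ,
      -- `det-block-diagonals` yields det Q only together with the factor `norm x`; it is carried on
      -- both sides and cancelled, being nonzero.
      *-cancelˡ (product-nonzero (λ k → endomorphism-nonzero (α-hom k) x≉0)) (begin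
      norm x * (fromℤ (ℤL.det Pℤ) * (det E * det E′))
        ≈⟨ *-congˡ (*-cong (trans (Homomorphism.det-homo ℤ.+-*-rawRing commutativeRing fromℤ-isRingHomomorphism Pℤ)
             (det-cong (fromℤ-block A A′ B B′))) (sym (det-block-lower′ E 𝟘 E′))) ⟩
      norm x * (det P * det S)
        ≈⟨ *-congˡ (trans (sym (det-⊗ P S)) (trans (det-cong PS≋TQ) (det-⊗ T Q))) ⟩
      norm x * (det T * det Q)
        ≈⟨ *-congˡ (*-congʳ (det-block-lower′ W 𝟘 W)) ⟩
      norm x * (det W * det W * det Q)
        ≈⟨ solve 3 (λ x w q → x :* (w :* q) := w :* (q :* x)) refl (norm x) (det W * det W) (det Q) ⟩
      det W * det W * (det Q * norm x)
        ≈⟨ *-congˡ (det-block-diagonals (α⟨ x ⟩) (α⟨ σ x ⟩) (α⟨ y ⟩) (α⟨ σ y ⟩)) ⟩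
      det W * det W * (norm x * product (λ k → α k x * α k (σ y) - α k (σ x) * α k y))
        ≈⟨ solve 3 (λ x w d → w :* (x :* d) := x :* (w :* d)) refl (norm x) (det W * det W) _ ⟩
      norm x * (det W * det W * product (λ k → α k x * α k (σ y) - α k (σ x) * α k y))
        ≈⟨ *-congˡ (*-congˡ (product-cong (λ k → α-difference k))) ⟩
      norm x * (det W * det W * norm (x * σ y - σ x * y)) ∎)
      where
      open RingSolver commutativeRing
      α⟨_⟩ : Carrier → Vector Carrier N
      α⟨ z ⟩ k = α k z
      Pℤ = ℤM.block A A′ B B′
      E E′ W : M
      E  = conjugates e
      E′ = conjugates (σ ∘ e)
      W  = conjugates ω
      P = block (λ i j → fromℤ (A i j)) (λ i j → fromℤ (A′ i j)) (λ i j → fromℤ (B i j)) (λ i j → fromℤ (B′ i j))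
      S = block E 𝟘 𝟘 E′
      T = block W 𝟘 𝟘 W
      Q = block (diagonal α⟨ x ⟩) (diagonal α⟨ σ x ⟩) (diagonal α⟨ y ⟩) (diagonal α⟨ σ y ⟩)
      product-cong : ∀ {k} {u v : Vector Carrier k} → (∀ i → u i ≈ v i) → product u ≈ product v
      product-cong {zero}  h = refl
      product-cong {suc k} h = *-cong (h zero) (product-cong (h ∘ suc))
      α-difference : ∀ k → α k x * α k (σ y) - α k (σ x) * α k y ≈ α k (x * σ y - σ x * y)
      α-difference k = sym (trans (α.+-homo k _ _) (+-cong (α.*-homo k x (σ y)) (trans (α.-‿homo k _) (-‿cong (α.*-homo k (σ x) y)))))
      α-fromℤ : ∀ k a → α k (fromℤ a) ≈ fromℤ a
      α-fromℤ k a = endomorphism-fixes-ℚ (α-hom k) (a / 1)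
      apply : ∀ (C : Matrix ℤ N N) (f : Vector Carrier N) z → (∀ i → ω i * z ≈ sum (λ j → fromℤ (C i j) * f j)) →
        ∀ i k → ((λ i j → fromℤ (C i j)) ⊗ conjugates f) i k ≈ W i k * α k z
      apply C f z h i k = begin
        sum (λ j → fromℤ (C i j) * α k (f j))      ≈⟨ sum-cong-≋ {N} (λ j → sym
                                                        (trans (α.*-homo k (fromℤ (C i j)) (f j)) (*-congʳ (α-fromℤ k (C i j))))) ⟩
        sum (λ j → α k (fromℤ (C i j) * f j))      ≈⟨ Homomorphism.sum-homo rawRing commutativeRing (α-hom k) (λ j → fromℤ (C i j) * f j) ⟨
        α k (sum (λ j → fromℤ (C i j) * f j))      ≈⟨ α.⟦⟧-cong k (h i) ⟨
        α k (ω i * z)                              ≈⟨ α.*-homo k (ω i) z ⟩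
        α k (ω i) * α k z                          ∎
      P₁₁ P₁₂ P₂₁ P₂₂ X X′ Y Y′ : M
      P₁₁ i j = fromℤ (A i j)
      P₁₂ i j = fromℤ (A′ i j)
      P₂₁ i j = fromℤ (B i j)
      P₂₂ i j = fromℤ (B′ i j)
      X  = diagonal α⟨ x ⟩
      X′ = diagonal α⟨ σ x ⟩
      Y  = diagonal α⟨ y ⟩
      Y′ = diagonal α⟨ σ y ⟩
      zeros : ∀ (C V : M) i j → (C ⊗ 𝟘) i j ≈ (𝟘 ⊗ V) i j
      zeros C V i j = trans (sum-zero λ k → zeroʳ (C i k)) (sym (sum-zero λ k → zeroˡ (V k j)))
      -- Both sides list the conjugates of ωᵢ (x , σ x) and ωᵢ (y , σ y): on the left through the
      -- bases e and σ e, on the right as products with the conjugates of ωᵢ.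
      PS≋TQ : P ⊗ S ≋ T ⊗ Q
      PS≋TQ i j = trans (block-⊗ P₁₁ P₁₂ P₂₁ P₂₂ E 𝟘 𝟘 E′ i j) (trans (block-cong
        (λ i j → +-cong (trans (apply A e x hA i j) (sym (⊗-diagonal W α⟨ x ⟩ i j))) (zeros P₁₂ Y i j))
        (λ i j → trans (+-cong (zeros P₁₁ Y′ i j) (trans (apply A′ (σ ∘ e) (σ x) hA′ i j) (sym (⊗-diagonal W α⟨ σ x ⟩ i j)))) (+-comm _ _))
        (λ i j → trans (+-cong (trans (apply B e y hB i j) (sym (⊗-diagonal W α⟨ y ⟩ i j))) (zeros P₂₂ X i j)) (+-comm _ _))
        (λ i j → +-cong (zeros P₂₁ X′ i j) (trans (apply B′ (σ ∘ e) (σ y) hB′ i j) (sym (⊗-diagonal W α⟨ σ y ⟩ i j))))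
        i j) (sym (block-⊗ W 𝟘 𝟘 W X X′ Y Y′ i j)))

-- The field ℚ(√-r), the possible obstruction to primitivity.

module ImaginaryQuadraticField (r : ℚ) (0<r : 0ℚ ℚ.< r) where
  private
    module Q = QuadraticExtension ℚₚ.+-*-commutativeRing (ℚ.- r) ((ℚ.- r) ℚ.*_) (λ _ → ≡.refl)
    module E = CommutativeRing Q.extension

  open Q using (_&_; ≈-re; ≈-im)
  open import Data.Rational.Base using (_+_; _*_; -_; _-_; _<_)
  open +-*-Solver

  p≢0⇒0<p² : ∀ {p} → p ≢ 0ℚ → 0ℚ < p * p
  p≢0⇒0<p² {p} p≢0 with ℚₚ.<-cmp p 0ℚ
  ... | tri≈ _ p≡0 _ = contradiction p≡0 p≢0
  ... | tri> _ _ 0<p = *-pos 0<p 0<p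
  ... | tri< p<0 _ _ = ≡.subst (0ℚ <_) (solve 1 (λ p → (con 0ℚ :- p) :* (con 0ℚ :- p) := p :* p) ≡.refl p)
    (*-pos (p<q⇒0<q-p p<0) (p<q⇒0<q-p p<0))

  norm-positive : ∀ a b → ¬ (a ≡ 0ℚ × b ≡ 0ℚ) → 0ℚ < a * a + r * (b * b)
  norm-positive a b ≢0 with a ℚₚ.≟ 0ℚ | b ℚₚ.≟ 0ℚ
  ... | yes a≡0 | yes b≡0 = contradiction (a≡0 , b≡0) ≢0
  ... | no  a≢0 | _       = ℚₚ.+-mono-<-≤ (p≢0⇒0<p² a≢0) (0≤* (ℚₚ.<⇒≤ 0<r) (0≤p² b))
  ... | yes _   | no b≢0  = ℚₚ.+-mono-≤-< (0≤p² a) (*-pos 0<r (p≢0⇒0<p² b≢0))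

  basis : Vector E.Carrier 2
  basis 0F = 1ℚ , 0ℚ
  basis 1F = 0ℚ , 1ℚ

  embed : ℚ → E.Carrier
  embed q = q , 0ℚ

  embed-isRingHomomorphism : IsRingHomomorphism ℚ.+-*-rawRing E.rawRing embed
  embed-isRingHomomorphism = mkRingHomomorphism embed
    (λ p≡q → p≡q & ≡.refl)
    (λ p q → ≡.refl & ≡.refl)
    (λ p q → solve 3 (λ p q r → p :* q := p :* q :+ (:- r) :* (con 0ℚ :* con 0ℚ)) ≡.refl p q r &
             solve 2 (λ p q → con 0ℚ := p :* con 0ℚ :+ con 0ℚ :* q) ≡.refl p q)
    (λ p → ≡.refl & ≡.refl) (≡.refl & ≡.refl) (≡.refl & ≡.refl)

  combination-basis : ∀ (c : Vector ℚ 2) →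
    LinearAlgebra.sum E.rawRing (λ i → embed (c i) E.* basis i) E.≈ (c 0F , c 1F)
  combination-basis c = first (c 0F) (c 1F) r & second (c 0F) (c 1F)
    where
    first : ∀ x y r → (x * 1ℚ + (- r) * (0ℚ * 0ℚ)) + ((y * 0ℚ + (- r) * (0ℚ * 1ℚ)) + 0ℚ) ≡ x
    first = solve 3 (λ x y r → (x :* con 1ℚ :+ (:- r) :* (con 0ℚ :* con 0ℚ)) :+ ((y :* con 0ℚ :+ (:- r) :* (con 0ℚ :* con 1ℚ)) :+ con 0ℚ) := x) ≡.refl
    second : ∀ x y → (x * 0ℚ + 0ℚ * 1ℚ) + ((y * 1ℚ + 0ℚ * 0ℚ) + 0ℚ) ≡ y
    second = solve 2 (λ x y → (x :* con 0ℚ :+ con 0ℚ :* con 1ℚ) :+ ((y :* con 1ℚ :+ con 0ℚ :* con 0ℚ) :+ con 0ℚ) := y) ≡.refl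

  field′ : NumberField 2
  field′ = record
    { commutativeRing = Q.extension
    ; 1≉0 = λ { (() & _) }
    ; inverse = λ { (a , b) ≢0 → inverse a b (quotient (ℚₚ.positive⁻¹ 1ℚ) (norm-positive a b λ (p , q) → ≢0 (p & q))) }
    ; fromℚ = embed
    ; fromℚ-isRingHomomorphism = embed-isRingHomomorphism
    ; basis = basis
    ; isBasis = (λ _ → tt) , λ { (a , b) _ → pair a b ,
        E.sym (combination-basis (pair a b)) ,
        λ c′ h → λ { 0F → ≈-re (E.trans h (combination-basis c′)) ; 1F → ≈-im (E.trans h (combination-basis c′)) } }
    }
    where
    pair : ℚ → ℚ → Vector ℚ 2
    pair a b 0F = a
    pair a b 1F = b
    inverse : ∀ a b → ∃[ i ] (0ℚ < i × i * (a * a + r * (b * b)) ≡ 1ℚ) → ∃[ y ] (a , b) E.* y E.≈ E.1#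
    inverse a b (i , _ , iN≡1) = (i * a , i * (- b)) ,
      ≡.trans (solve 4 (λ a b i r → a :* (i :* a) :+ (:- r) :* (b :* (i :* (:- b))) := i :* (a :* a :+ r :* (b :* b))) ≡.refl a b i r) iN≡1 &
      solve 3 (λ a b i → a :* (i :* (:- b)) :+ b :* (i :* a) := con 0ℚ) ≡.refl a b i

  √-r : E.Carrier
  √-r = 0ℚ , 1ℚ

  √-r² : √-r E.* √-r E.≈ embed (- r)
  √-r² = solve 1 (λ r → con 0ℚ :* con 0ℚ :+ (:- r) :* (con 1ℚ :* con 1ℚ) := :- r) ≡.refl r & ≡.refl

  module _ {n} (K : NumberField n) where
    private
      module K = NumberField K
      module fromℚ = NumberFieldProperties.fromℚ K
    open RingSolver K.commutativeRing using () renaming (solve to solveK; _:=_ to _:≈_; _:+_ to _⊞_; _:*_ to _⊠_; con to conK)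

    adjoin : ∀ {s} → s K.* s K.≈ K.fromℚ (- r) → FieldHom field′ K
    adjoin {s} s²≈-r = record
      { map = f
      ; isRingHomomorphism = mkRingHomomorphism f
          (λ (p & q) → K.+-cong (fromℚ.⟦⟧-cong p) (K.*-congʳ (fromℚ.⟦⟧-cong q)))
          (λ (a , b) (c , d) → K.trans (K.+-cong (fromℚ.+-homo a c) (K.*-congʳ (fromℚ.+-homo b d)))
            (solveK 5 (λ a b c d s → (a ⊞ c) ⊞ (b ⊞ d) ⊠ s :≈ (a ⊞ b ⊠ s) ⊞ (c ⊞ d ⊠ s)) K.refl _ _ _ _ s))
          (λ (a , b) (c , d) → K.trans (K.+-cong
              (K.trans (fromℚ.+-homo _ _) (K.+-cong (fromℚ.*-homo a c)
                  (K.trans (fromℚ.*-homo (- r) (b * d)) (K.*-cong (K.sym s²≈-r) (fromℚ.*-homo b d)))))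
              (K.*-congʳ (K.trans (fromℚ.+-homo _ _) (K.+-cong (fromℚ.*-homo a d) (fromℚ.*-homo b c)))))
            (solveK 5 (λ a b c d s → (a ⊠ c ⊞ (s ⊠ s) ⊠ (b ⊠ d)) ⊞ (a ⊠ d ⊞ b ⊠ c) ⊠ s :≈ (a ⊞ b ⊠ s) ⊠ (c ⊞ d ⊠ s)) K.refl _ _ _ _ s))
          (λ (a , b) → K.trans (K.+-cong (fromℚ.-‿homo a) (K.*-congʳ (fromℚ.-‿homo b)))
            (K.trans (K.+-congˡ (K.sym (-‿distribˡ-* _ s))) (-‿+-comm _ _)))
          (K.trans (K.+-cong fromℚ.0#-homo (K.*-congʳ fromℚ.0#-homo)) (K.trans (K.+-identityˡ _) (K.zeroˡ s)))
          (K.trans (K.+-cong fromℚ.1#-homo (K.trans (K.*-congʳ fromℚ.0#-homo) (K.zeroˡ s))) (K.+-identityʳ _))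
      }
      where
      open RingProperties K.ring using (-‿distribˡ-*; -‿+-comm)
      f : E.Carrier → K.Carrier
      f (a , b) = K.fromℚ a K.+ K.fromℚ b K.* s

  -- A real value of √−r would have the negative square −r.
  module _ (R : OrderedRing) where
    private
      module R = OrderedRing R
      module G = Gaussian R.commutativeRing
      module C = CommutativeRing G.gaussianRing
    open OrderedRingProperties R using (-positive-impossible; module fromℚ)

    imaginary : ∀ {ψ} → IsRingHomomorphism E.rawRing C.rawRing ψ → ¬ (proj₂ (ψ √-r) R.≈ R.0#)
    imaginary {ψ} ψ-hom im≈0 = -positive-impossible 0<r (R.nonNeg-resp-≈ x²≈-r (R.nonNeg-square x))
      where
      module ψ = IsRingHomomorphism ψ-hom
      open RingSolver R.commutativeRing using () renaming (solve to solveR; _:=_ to _:≈_; _:+_ to _⊞_; _:*_ to _⊠_; :-_ to ⊟_; con to conR)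
      x y : R.Carrier
      x = proj₁ (ψ √-r)
      y = proj₂ (ψ √-r)
      x²-y² : x R.* x R.+ (R.- (y R.* y)) R.≈ R.fromℚ (- r)
      x²-y² = R.trans (G.≈-re (C.trans (C.sym (ψ.*-homo √-r √-r)) (C.trans (ψ.⟦⟧-cong √-r²)
        (ℚ-Homomorphisms.agree G.gaussianRing (_∘ʰ_ {C = G.gaussianRing} ψ-hom embed-isRingHomomorphism)
          (_∘ʰ_ {C = G.gaussianRing} G.real-isRingHomomorphism R.fromℚ-isRingHomomorphism) (- r))))) R.refl
      x²≈-r : x R.* x R.≈ R.- R.fromℚ r
      x²≈-r = R.trans (solveR 1 (λ x → x ⊠ x :≈ x ⊠ x ⊞ ⊟ (conR (+ 0) ⊠ conR (+ 0))) R.refl x)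
        (R.trans (R.+-congˡ (R.-‿cong (R.sym (R.*-cong im≈0 im≈0)))) (R.trans x²-y² (fromℚ.-‿homo r)))

-- Identities for the Hermitian form of a CM type.

module HermitianIdentities (R : CommutativeRing 0ℓ 0ℓ) where
  open CommutativeRing R hiding (zero)
  open RingSolver R
  open IntegerCoefficients R using (fromInt)
  open Gaussian R
  module C = CommutativeRing gaussianRing

  -- The real and the imaginary part of z̄ w.
  dot cross : C.Carrier → C.Carrier → Carrier
  dot   (a , b) (c , d) = a * c + b * d
  cross (a , b) (c , d) = a * d - b * c

  -- z w̄ - z̄ w is -2 i `cross z w`, so the real part of the product involves `ξ` only through its
  -- imaginary part.
  form-cross : ∀ ξ z w → proj₁ (ξ C.* (z C.* conj w C.- conj z C.* w)) ≈ fromInt (+ 2) * (proj₂ ξ * cross z w)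
  form-cross (ρ , η) (a , b) (c , d) = solve 6 (λ ρ η a b c d →
    ρ :* ((a :* c :+ :- (b :* (:- d))) :+ :- (a :* c :+ :- ((:- b) :* d))) :+ :- (η :* ((a :* (:- d) :+ b :* c) :+ :- (a :* d :+ (:- b) :* c))) :=
    con (+ 2) :* (η :* (a :* d :- b :* c))) refl ρ η a b c d

  cross-combinationˡ : ∀ z w u v → cross u (z C.* u C.+ w C.* v) ≈ proj₂ z * norm u + proj₂ w * dot u v + proj₁ w * cross u v
  cross-combinationˡ (x , y) (x′ , y′) (a , b) (c , d) = solve 8 (λ x y x′ y′ a b c d →
    a :* ((x :* b :+ y :* a) :+ (x′ :* d :+ y′ :* c)) :- b :* ((x :* a :+ :- (y :* b)) :+ (x′ :* c :+ :- (y′ :* d))) :=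
    y :* (a :* a :+ b :* b) :+ y′ :* (a :* c :+ b :* d) :+ x′ :* (a :* d :- b :* c)) refl x y x′ y′ a b c d

  cross-combinationʳ : ∀ z w u v → cross v (z C.* u C.+ w C.* v) ≈ proj₂ z * dot u v + proj₂ w * norm v + (- proj₁ z) * cross u v
  cross-combinationʳ (x , y) (x′ , y′) (a , b) (c , d) = solve 8 (λ x y x′ y′ a b c d →
    c :* ((x :* b :+ y :* a) :+ (x′ :* d :+ y′ :* c)) :- d :* ((x :* a :+ :- (y :* b)) :+ (x′ :* c :+ :- (y′ :* d))) :=
    y :* (a :* c :+ b :* d) :+ y′ :* (c :* c :+ d :* d) :+ (:- x) :* (a :* d :- b :* c)) refl x y x′ y′ a b c d

  norm-combination : ∀ z w u v → norm (z C.* u C.+ w C.* v) ≈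
    norm z * norm u + norm w * norm v + fromInt (+ 2) * (dot z w * dot u v) - fromInt (+ 2) * (cross z w * cross u v)
  norm-combination (x , y) (x′ , y′) (a , b) (c , d) = solve 8 (λ x y x′ y′ a b c d →
    ((x :* a :+ :- (y :* b)) :+ (x′ :* c :+ :- (y′ :* d))) :* ((x :* a :+ :- (y :* b)) :+ (x′ :* c :+ :- (y′ :* d))) :+
    ((x :* b :+ y :* a) :+ (x′ :* d :+ y′ :* c)) :* ((x :* b :+ y :* a) :+ (x′ :* d :+ y′ :* c)) :=
    (x :* x :+ y :* y) :* (a :* a :+ b :* b) :+ (x′ :* x′ :+ y′ :* y′) :* (c :* c :+ d :* d) :+
    con (+ 2) :* ((x :* x′ :+ y :* y′) :* (a :* c :+ b :* d)) :- con (+ 2) :* ((x :* y′ :- y :* x′) :* (a :* d :- b :* c)))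
    refl x y x′ y′ a b c d

  -- For H(z , w) = 2 (η₁ z̄₁ w₁ + η₂ z̄₂ w₂), inserting `norm`, `dot` or `cross` of the components
  -- gives the norm, the real part or the imaginary part of H. The imaginary part is the Riemann
  -- form.
  weighted : Carrier → Carrier → Carrier → Carrier → Carrier
  weighted η₁ η₂ s t = fromInt (+ 2) * (η₁ * s + η₂ * t)

  -- Lagrange's identity: H(u , u) H(v , v) = |H(u , v)|² + 4 η₁ η₂ |det(u , v)|². It evaluates the
  -- Gram determinant of e₁ and e₂, and it bounds |φ(σ D)| when the squares in |H(u , v)|² are
  -- dropped.
  lagrange : ∀ η₁ η₂ u₁ u₂ v₁ v₂ →
    weighted η₁ η₂ (norm u₁) (norm u₂) * weighted η₁ η₂ (norm v₁) (norm v₂) ≈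
    weighted η₁ η₂ (dot u₁ v₁) (dot u₂ v₂) * weighted η₁ η₂ (dot u₁ v₁) (dot u₂ v₂) +
    weighted η₁ η₂ (cross u₁ v₁) (cross u₂ v₂) * weighted η₁ η₂ (cross u₁ v₁) (cross u₂ v₂) +
    fromInt (+ 4) * (η₁ * η₂) * norm (u₁ C.* v₂ C.- u₂ C.* v₁)
  lagrange η₁ η₂ (a , b) (c , d) (e , f) (g , h) = solve 10 (λ η₁ η₂ a b c d e f g h →
    (con (+ 2) :* (η₁ :* (a :* a :+ b :* b) :+ η₂ :* (c :* c :+ d :* d))) :* (con (+ 2) :* (η₁ :* (e :* e :+ f :* f) :+ η₂ :* (g :* g :+ h :* h))) :=
    (con (+ 2) :* (η₁ :* (a :* e :+ b :* f) :+ η₂ :* (c :* g :+ d :* h))) :* (con (+ 2) :* (η₁ :* (a :* e :+ b :* f) :+ η₂ :* (c :* g :+ d :* h))) :+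
    (con (+ 2) :* (η₁ :* (a :* f :- b :* e) :+ η₂ :* (c :* h :- d :* g))) :* (con (+ 2) :* (η₁ :* (a :* f :- b :* e) :+ η₂ :* (c :* h :- d :* g))) :+
    con (+ 4) :* (η₁ :* η₂) :*
    (((a :* g :+ :- (b :* h)) :+ :- (c :* e :+ :- (d :* f))) :* ((a :* g :+ :- (b :* h)) :+ :- (c :* e :+ :- (d :* f))) :+
     ((a :* h :+ b :* g) :+ :- (c :* f :+ d :* e)) :* ((a :* h :+ b :* g) :+ :- (c :* f :+ d :* e))))
    refl η₁ η₂ a b c d e f g h

  weighted-linear₃ : ∀ η₁ η₂ p q r s₁ t₁ w₁ s₂ t₂ w₂ →
    weighted η₁ η₂ (p * s₁ + q * t₁ + r * w₁) (p * s₂ + q * t₂ + r * w₂) ≈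
    p * weighted η₁ η₂ s₁ s₂ + q * weighted η₁ η₂ t₁ t₂ + r * weighted η₁ η₂ w₁ w₂
  weighted-linear₃ = solve 11 (λ η₁ η₂ p q r s₁ t₁ w₁ s₂ t₂ w₂ →
    con (+ 2) :* (η₁ :* (p :* s₁ :+ q :* t₁ :+ r :* w₁) :+ η₂ :* (p :* s₂ :+ q :* t₂ :+ r :* w₂)) :=
    p :* (con (+ 2) :* (η₁ :* s₁ :+ η₂ :* s₂)) :+ q :* (con (+ 2) :* (η₁ :* t₁ :+ η₂ :* t₂)) :+ r :* (con (+ 2) :* (η₁ :* w₁ :+ η₂ :* w₂))) refl

  weighted-cong : ∀ {η₁ η₂ s s′ t t′} → s ≈ s′ → t ≈ t′ → weighted η₁ η₂ s t ≈ weighted η₁ η₂ s′ t′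
  weighted-cong p q = *-congˡ (+-cong (*-congˡ p) (*-congˡ q))

  cross-cong : ∀ {z z′ w w′} → z C.≈ z′ → w C.≈ w′ → cross z w ≈ cross z′ w′
  cross-cong (p & q) (p′ & q′) = +-cong (*-cong p q′) (-‿cong (*-cong q p′))

  norm-swap : ∀ z w → norm (z C.- w) ≈ norm (w C.- z)
  norm-swap (a , b) (c , d) = solve 4 (λ a b c d → (a :- c) :* (a :- c) :+ (b :- d) :* (b :- d) :=
    (c :- a) :* (c :- a) :+ (d :- b) :* (d :- b)) refl a b c d

  weighted-norm-combination : ∀ η₁ η₂ z w u₁ u₂ v₁ v₂ →
    weighted η₁ η₂ (norm (z C.* u₁ C.+ w C.* v₁)) (norm (z C.* u₂ C.+ w C.* v₂)) ≈
    norm z * weighted η₁ η₂ (norm u₁) (norm u₂) + norm w * weighted η₁ η₂ (norm v₁) (norm v₂) +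
    fromInt (+ 2) * (dot z w * weighted η₁ η₂ (dot u₁ v₁) (dot u₂ v₂)) -
    fromInt (+ 2) * (cross z w * weighted η₁ η₂ (cross u₁ v₁) (cross u₂ v₂))
  weighted-norm-combination η₁ η₂ z w u₁ u₂ v₁ v₂ = trans (weighted-cong (norm-combination z w u₁ v₁) (norm-combination z w u₂ v₂))
    (solve 14 (λ η₁ η₂ A B D X s₁ t₁ d₁ c₁ s₂ t₂ d₂ c₂ →
      con (+ 2) :* (η₁ :* (A :* s₁ :+ B :* t₁ :+ con (+ 2) :* (D :* d₁) :- con (+ 2) :* (X :* c₁)) :+
                    η₂ :* (A :* s₂ :+ B :* t₂ :+ con (+ 2) :* (D :* d₂) :- con (+ 2) :* (X :* c₂))) :=
      A :* (con (+ 2) :* (η₁ :* s₁ :+ η₂ :* s₂)) :+ B :* (con (+ 2) :* (η₁ :* t₁ :+ η₂ :* t₂)) :+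
      con (+ 2) :* (D :* (con (+ 2) :* (η₁ :* d₁ :+ η₂ :* d₂))) :- con (+ 2) :* (X :* (con (+ 2) :* (η₁ :* c₁ :+ η₂ :* c₂))))
      refl η₁ η₂ (norm z) (norm w) (dot z w) (cross z w)
      (norm u₁) (norm v₁) (dot u₁ v₁) (cross u₁ v₁) (norm u₂) (norm v₂) (dot u₂ v₂) (cross u₂ v₂))

module Elimination (R : CommutativeRing 0ℓ 0ℓ) where
  open CommutativeRing R hiding (zero)
  open RingSolver R

  eliminate : ∀ z w u₁ u₂ v₁ v₂ → u₁ * (z * u₂ + w * v₂) - u₂ * (z * u₁ + w * v₁) ≈ w * (u₁ * v₂ - u₂ * v₁)
  eliminate = solve 6 (λ z w u₁ u₂ v₁ v₂ → u₁ :* (z :* u₂ :+ w :* v₂) :- u₂ :* (z :* u₁ :+ w :* v₁) := w :* (u₁ :* v₂ :- u₂ :* v₁)) refl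

-- Conjugates, lattices and reduced bases in a Galois CM field.

module GaloisCM (R : OrderedRing) (K : NumberField 4) where
  private
    module R = OrderedRing R
    module K = NumberField K
    module KP = NumberFieldProperties K
  open HermitianIdentities R.commutativeRing
  open Gaussian R.commutativeRing
  open OrderedRingProperties R using (nonNeg-ℕ; -positive-impossible; squares-cancel; nonNeg-1; cancelˡ-ℕ)
  open IntegerCoefficients R.commutativeRing using (fromInt; 1-homo)
  open CommutativeSemigroupProperties C.*-commutativeSemigroup using (interchange; xy∙z≈xz∙y)
  private
    module ℚ→R = IsRingHomomorphism R.fromℚ-isRingHomomorphism

  1≉0 : ¬ (C.1# C.≈ C.0#)
  1≉0 (1≈0 & _) = -positive-impossible (ℚₚ.positive⁻¹ 1ℚ) (R.nonNeg-resp-≈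
    (R.trans (R.*-cong 1≈0 1≈0) (R.trans (R.zeroˡ R.0#) (R.trans (R.sym (R.-‿inverseʳ R.1#)) (R.trans (R.+-congʳ 1≈0)
      (R.trans (R.+-identityˡ _) (R.-‿cong (R.sym ℚ→R.1#-homo))))))) (R.nonNeg-square R.1#))

  conj-cong : ∀ {z w} → z C.≈ w → conj z C.≈ conj w
  conj-cong = IsRingHomomorphism.⟦⟧-cong conj-isRingHomomorphism

  conj-conj : ∀ z → conj (conj z) C.≈ z
  conj-conj (a , b) = R.refl & RingProperties.-‿involutive R.ring b

  automorphisms : (σ bar : K.Carrier → K.Carrier) → Fin 4 → K.Carrier → K.Carrier
  automorphisms σ bar 0F x = x
  automorphisms σ bar 1F x = σ x
  automorphisms σ bar 2F x = bar x
  automorphisms σ bar 3F x = bar (σ x)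

  -- The group {1 , σ , bar , bar σ} seen through one embedding. By `σσ` it is a Klein group or
  -- cyclic with generator σ, and in either case σ² preserves |φ(x)|.
  record Symmetry : Set where
    field
      {φ}      : K.Carrier → C.Carrier
      {σ bar}  : K.Carrier → K.Carrier
      φ-hom    : IsRingHomomorphism K.rawRing C.rawRing φ
      σ-hom    : KP.Endomorphism σ
      bar-hom  : KP.Endomorphism bar
      φ-bar    : ∀ x → φ (bar x) C.≈ conj (φ x)
      φσ-bar   : ∀ x → φ (σ (bar x)) C.≈ conj (φ (σ x))
      distinct : ∀ k l → k ≢ l → ¬ (∀ x → automorphisms σ bar k x K.≈ automorphisms σ bar l x)
      σσ       : (∀ x → σ (σ x) K.≈ x) ⊎ (∀ x → σ (σ x) K.≈ bar x)

  module Conjugates (S : Symmetry) where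
    open Symmetry S
    module φ = IsRingHomomorphism φ-hom
    module σ = IsRingHomomorphism σ-hom
    module bar = IsRingHomomorphism bar-hom

    φ-injective : ∀ {x y} → φ x C.≈ φ y → x K.≈ y
    φ-injective = KP.Into.injective gaussianRing φ-hom 1≉0

    φ-fromℚ : ∀ q → φ (K.fromℚ q) C.≈ real (R.fromℚ q)
    φ-fromℚ = ℚ-Homomorphisms.agree gaussianRing (_∘ʰ_ {C = gaussianRing} φ-hom K.fromℚ-isRingHomomorphism)
      (_∘ʰ_ {C = gaussianRing} real-isRingHomomorphism R.fromℚ-isRingHomomorphism)

    bar-bar : ∀ x → bar (bar x) K.≈ x
    bar-bar x = φ-injective (C.trans (φ-bar (bar x)) (C.trans (conj-cong (φ-bar x)) (conj-conj (φ x))))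

    σ-bar : ∀ x → σ (bar x) K.≈ bar (σ x)
    σ-bar x = φ-injective (C.trans (φσ-bar x) (C.sym (φ-bar (σ x))))

    α : Fin 4 → K.Carrier → K.Carrier
    α = automorphisms σ bar

    α-hom : ∀ k → KP.Endomorphism (α k)
    α-hom 0F = mkRingHomomorphism id id (λ _ _ → K.refl) (λ _ _ → K.refl) (λ _ → K.refl) K.refl K.refl
    α-hom 1F = σ-hom
    α-hom 2F = bar-hom
    α-hom 3F = _∘ʰ_ {C = K.commutativeRing} bar-hom σ-hom

    bar-α : ∀ k x → bar (α k x) K.≈ α k (bar x)
    bar-α 0F x = K.refl
    bar-α 1F x = K.sym (σ-bar x)
    bar-α 2F x = K.refl
    bar-α 3F x = bar.⟦⟧-cong (K.sym (σ-bar x))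

    reφ : K.Carrier → R.Carrier
    reφ x = proj₁ (φ x)

    φ-trace : ∀ x → φ (K.sum λ k → α k x) C.≈ real (fromInt (+ 2) R.* (reφ x R.+ reφ (σ x)))
    φ-trace x = C.trans (Homomorphism.sum-homo K.rawRing gaussianRing φ-hom (λ k → α k x))
      (C.trans (C.+-congˡ {φ x} (C.+-congˡ {φ (σ x)} (C.+-cong (φ-bar x) (C.+-cong (φ-bar (σ x)) (C.refl {C.0#})))))
        (add (φ x) (φ (σ x))))
      where
      open RingSolver R.commutativeRing
      add : ∀ z w → z C.+ (w C.+ (conj z C.+ (conj w C.+ C.0#))) C.≈ real (fromInt (+ 2) R.* (proj₁ z R.+ proj₁ w))
      add (a , b) (c , d) = solve 2 (λ a c → a :+ (c :+ (a :+ (c :+ con (+ 0)))) := con (+ 2) :* (a :+ c)) R.refl a c &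
        solve 2 (λ b d → b :+ (d :+ (:- b :+ (:- d :+ con (+ 0)))) := con (+ 0)) R.refl b d

    trace : ∀ x → R.fromℚ (K.Tr x) R.≈ fromInt (+ 2) R.* (reφ x R.+ reφ (σ x))
    trace x = ≈-re (C.trans (C.sym (φ-fromℚ (K.Tr x)))
      (C.trans (φ.⟦⟧-cong (TraceFormula.trace-formula K α α-hom distinct x)) (φ-trace x)))

    -- t generates an imaginary quadratic field: s = t − Tr t / 4 has φ s = φ (σ s) = i y.
    imaginary-square-root : ∀ t → φ t C.≈ φ (σ t) →
      let y = proj₂ (φ t) in R.NonNeg (fromInt (+ 4) R.* (y R.* y) R.- fromInt (+ 3)) →
      ∃[ r ] (0ℚ ℚ.< r × ∃[ s ] (s K.* s K.≈ K.fromℚ (ℚ.- r) × φ s C.≈ φ (σ s)))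
    imaginary-square-root t φt≈φσt 4y²≥3 = r , 0<r , s , s²≈-r , C.trans φs (C.sym φσs)
      where
      open RingSolver R.commutativeRing
      open SetoidReasoning R.setoid
      y = proj₂ (φ t)
      ¼ = + 1 / 4
      quarter : ∀ {p x} → R.fromℚ p R.≈ fromInt (+ 4) R.* x → R.fromℚ (p ℚ.* ¼) R.≈ x
      quarter {p} {x} h = begin
        R.fromℚ (p ℚ.* ¼)                            ≈⟨ ℚ→R.*-homo p ¼ ⟩
        R.fromℚ p R.* R.fromℚ ¼                      ≈⟨ R.*-congʳ h ⟩
        fromInt (+ 4) R.* x R.* R.fromℚ ¼            ≈⟨ solve 2 (λ x q → con (+ 4) :* x :* q := (q :+ (q :+ (q :+ q))) :* x) R.refl x (R.fromℚ ¼) ⟩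
        (q R.+ (q R.+ (q R.+ q))) R.* x              ≈⟨ R.*-congʳ (R.trans (R.+-congˡ (R.trans (R.+-congˡ (R.sym (ℚ→R.+-homo ¼ ¼)))
                                                          (R.sym (ℚ→R.+-homo ¼ (¼ ℚ.+ ¼))))) (R.sym (ℚ→R.+-homo ¼ (¼ ℚ.+ (¼ ℚ.+ ¼))))) ⟩
        R.fromℚ 1ℚ R.* x                             ≈⟨ R.trans (R.*-congʳ ℚ→R.1#-homo) (R.*-identityˡ x) ⟩
        x                                            ∎
        where q = R.fromℚ ¼
      trace-quarter : ∀ u → reφ u R.≈ reφ (σ u) → R.fromℚ (K.Tr u ℚ.* ¼) R.≈ reφ u
      trace-quarter u h = quarter (R.trans (trace u) (R.trans (R.*-congˡ (R.+-congˡ (R.sym h)))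
        (solve 1 (λ x → con (+ 2) :* (x :+ x) := con (+ 4) :* x) R.refl (reφ u))))
      -- As φ and φ ∘ σ agree on t, the trace is four times Re φ(t), so c maps to this real part and
      -- subtracting it leaves i y.
      c = K.Tr t ℚ.* ¼
      s = t K.- K.fromℚ c
      shift : ∀ {z w : C.Carrier} → z C.≈ φ t → w C.≈ real (R.fromℚ c) → z C.- w C.≈ (R.0# , y)
      shift (p & q) (p′ & q′) =
        R.trans (R.+-cong p (R.-‿cong (R.trans p′ (trace-quarter t (≈-re φt≈φσt))))) (R.-‿inverseʳ _) &
        R.trans (R.+-cong q (R.-‿cong q′)) (solve 1 (λ y → y :- con (+ 0) := y) R.refl y)
      φs : φ s C.≈ (R.0# , y)
      φs = C.trans (φ.+-homo t (K.- K.fromℚ c)) (C.trans (C.+-congˡ {φ t} (φ.-‿homo (K.fromℚ c))) (shift (C.refl {φ t}) (φ-fromℚ c)))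
      φσs : φ (σ s) C.≈ (R.0# , y)
      φσs = C.trans (φ.⟦⟧-cong (K.trans (σ.+-homo t (K.- K.fromℚ c))
          (K.+-congˡ (K.trans (σ.-‿homo (K.fromℚ c)) (K.-‿cong (KP.endomorphism-fixes-ℚ σ-hom c))))))
        (C.trans (φ.+-homo (σ t) (K.- K.fromℚ c)) (C.trans (C.+-congˡ {φ (σ t)} (φ.-‿homo (K.fromℚ c))) (shift (C.sym φt≈φσt) (φ-fromℚ c))))
      square : ∀ {z} → z C.≈ (R.0# , y) → z C.* z C.≈ real (R.- (y R.* y))
      square h = C.trans (C.*-cong h h) (solve 1 (λ y → con (+ 0) :* con (+ 0) :+ :- (y :* y) := :- (y :* y)) R.refl y &
        solve 1 (λ y → con (+ 0) :* y :+ y :* con (+ 0) := con (+ 0)) R.refl y)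
      φs² : φ (s K.* s) C.≈ real (R.- (y R.* y))
      φs² = C.trans (φ.*-homo s s) (square φs)
      φσs² : φ (σ (s K.* s)) C.≈ real (R.- (y R.* y))
      φσs² = C.trans (φ.⟦⟧-cong (σ.*-homo s s)) (C.trans (φ.*-homo (σ s) (σ s)) (square φσs))
      -- s² takes the same real value -y² under φ and φ ∘ σ. A quarter of its trace therefore maps
      -- to -y², which makes s² rational.
      m = K.Tr (s K.* s) ℚ.* ¼
      m≈-y² : R.fromℚ m R.≈ R.- (y R.* y)
      m≈-y² = R.trans (trace-quarter (s K.* s) (R.trans (≈-re φs²) (R.sym (≈-re φσs²)))) (≈-re φs²)
      r = ℚ.- m
      r≈y² : R.fromℚ r R.≈ y R.* y
      r≈y² = R.trans (ℚ→R.-‿homo m) (R.trans (R.-‿cong m≈-y²) (RingProperties.-‿involutive R.ring _))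
      -- 4 r ≥ 3 excludes r ≤ 0
      0<r : 0ℚ ℚ.< r
      0<r = ℚₚ.≰⇒> λ r≤0 → -positive-impossible (ℚₚ.positive⁻¹ 1ℚ) (cancelˡ-ℕ 2 (R.nonNeg-resp-≈
        (R.trans (R.+-cong (R.+-congʳ (R.*-congˡ (R.sym r≈y²))) (R.*-congˡ (ℚ→R.-‿homo r)))
          (R.trans (solve 1 (λ x → con (+ 4) :* x :- con (+ 3) :+ con (+ 4) :* (:- x) := con (+ 3) :* (:- con (+ 1))) R.refl (R.fromℚ r))
            (R.*-congˡ (R.-‿cong (R.trans 1-homo (R.sym ℚ→R.1#-homo))))))
        (R.nonNeg-+ 4y²≥3 (R.nonNeg-* (nonNeg-ℕ 4) (R.nonNeg-fromℚ (ℚₚ.neg-antimono-≤ r≤0))))))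
      s²≈-r : s K.* s K.≈ K.fromℚ (ℚ.- r)
      s²≈-r = φ-injective (C.trans φs² (C.trans (R.sym m≈-y² & R.refl) (C.sym (C.trans (φ-fromℚ (ℚ.- r))
        (ℚ→R.⟦⟧-cong (neg-neg m) & R.refl)))))
        where
        neg-neg : ∀ m → ℚ.- (ℚ.- m) ≡ m
        neg-neg = RingProperties.-‿involutive (CommutativeRing.ring ℚₚ.+-*-commutativeRing)

  record SymplecticBasis (S : Symmetry) : Set where
    open Symmetry S
    field
      ξ            : K.Carrier
      ξ-imaginary  : proj₁ (φ ξ) R.≈ R.0#
      σξ-imaginary : proj₁ (φ (σ ξ)) R.≈ R.0#
      e            : Vector K.Carrier 4
      symplectic   : ∀ i j → weighted (proj₂ (φ ξ)) (proj₂ (φ (σ ξ))) (cross (φ (e i)) (φ (e j))) (cross (φ (σ (e i))) (φ (σ (e j))))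
                     R.≈ R.fromℚ (J i j / 1)

  module Lattice {S : Symmetry} (B : SymplecticBasis S) where
    open Symmetry S
    open Conjugates S
    open SymplecticBasis B
    module Index = LatticeIndex K
    open LinearAlgebra K.rawRing using (det)
    open RingSolver R.commutativeRing

    η₁ η₂ : R.Carrier
    η₁ = proj₂ (φ ξ)
    η₂ = proj₂ (φ (σ ξ))

    norm-σσ : ∀ x → norm (φ (σ (σ x))) R.≈ norm (φ x)
    norm-σσ x = [ (λ σσ≈id → norm-cong (φ.⟦⟧-cong (σσ≈id x)))
                , (λ σσ≈bar → R.trans (norm-cong (C.trans (φ.⟦⟧-cong (σσ≈bar x)) (φ-bar x))) (norm-conj (φ x))) ]′ σσ

    -- Composition with σ permutes the four automorphisms, in one of two ways according to `σσ`.
    sum-σ : ∀ x → K.sum (λ k → α k (σ x)) K.≈ K.sum (λ k → α k x)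
    sum-σ x = rearrange σσ
      where
      open RingSolver K.commutativeRing using () renaming (solve to solveK; _:=_ to _:≈_; _:+_ to _⊞_; con to conK)
      rearrange : (∀ x → σ (σ x) K.≈ x) ⊎ (∀ x → σ (σ x) K.≈ bar x) → K.sum (λ k → α k (σ x)) K.≈ K.sum (λ k → α k x)
      rearrange (inj₁ h) = K.trans (K.+-congˡ (K.+-cong (h x) (K.+-congˡ (K.+-congʳ (bar.⟦⟧-cong (h x))))))
        (solveK 5 (λ a b c d o → b ⊞ (a ⊞ (d ⊞ (c ⊞ o))) :≈ a ⊞ (b ⊞ (c ⊞ (d ⊞ o)))) K.refl x (σ x) (bar x) (bar (σ x)) K.0#)
      rearrange (inj₂ h) = K.trans (K.+-congˡ (K.+-cong (h x) (K.+-congˡ (K.+-congʳ (K.trans (bar.⟦⟧-cong (h x)) (bar-bar x))))))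
        (solveK 5 (λ a b c d o → b ⊞ (c ⊞ (d ⊞ (a ⊞ o))) :≈ a ⊞ (b ⊞ (c ⊞ (d ⊞ o)))) K.refl x (σ x) (bar x) (bar (σ x)) K.0#)

    imaginary-product : ∀ {ζ z w} → proj₁ ζ R.≈ R.0# → proj₁ (ζ C.* (z C.* conj w)) R.≈ proj₂ ζ R.* cross z w
    imaginary-product {ρ , η} {a , b} {c , d} ρ≈0 = R.trans (R.+-congʳ (R.trans (R.*-congʳ ρ≈0) (R.zeroˡ _)))
      (R.trans (R.+-identityˡ _) (solve 5 (λ η a b c d → :- (η :* (a :* (:- d) :+ b :* c)) := η :* (a :* d :- b :* c)) R.refl η a b c d))

    φ-product : ∀ x y z → φ (x K.* (y K.* bar z)) C.≈ φ x C.* (φ y C.* conj (φ z))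
    φ-product x y z = C.trans (φ.*-homo x _) (C.*-congˡ {φ x} (C.trans (φ.*-homo y _) (C.*-congˡ {φ y} (φ-bar z))))

    φσ-product : ∀ x y z → φ (σ (x K.* (y K.* bar z))) C.≈ φ (σ x) C.* (φ (σ y) C.* conj (φ (σ z)))
    φσ-product x y z = C.trans (φ.⟦⟧-cong (K.trans (σ.*-homo x _) (K.*-congˡ (K.trans (σ.*-homo y _) (K.*-congˡ (σ-bar z))))))
      (φ-product (σ x) (σ y) (σ z))

    -- The values of the Riemann form on the basis, pulled back along the injective φ to the trace
    -- form of `K`.
    traces : ∀ i j → K.sum (λ k → α k (ξ K.* (e i K.* bar (e j)))) K.≈ K.fromℤ (J i j)
    traces i j = φ-injective (C.trans (φ-trace _) (C.trans
      (R.trans (R.*-congˡ (R.+-cong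
        (R.trans (≈-re (φ-product ξ (e i) (e j))) (imaginary-product {φ ξ} {φ (e i)} {φ (e j)} ξ-imaginary))
        (R.trans (≈-re (φσ-product ξ (e i) (e j))) (imaginary-product {φ (σ ξ)} {φ (σ (e i))} {φ (σ (e j))} σξ-imaginary))))
        (symplectic i j) & R.refl)
      (C.sym (φ-fromℚ (J i j / 1)))))

    -- Trace sums are invariant under σ, so σ e satisfies for σ ξ the relations that e satisfies for
    -- ξ.
    traces-σ : ∀ i j → K.sum (λ k → α k (σ ξ K.* (σ (e i) K.* bar (σ (e j))))) K.≈ K.fromℤ (J i j)
    traces-σ i j = K.trans (Determinant.sum-cong K.commutativeRing
        (λ k → α k (σ ξ K.* (σ (e i) K.* bar (σ (e j))))) (λ k → α k (σ (ξ K.* (e i K.* bar (e j)))))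
        (λ k → IsRingHomomorphism.⟦⟧-cong (α-hom k) (K.sym (K.trans (σ.*-homo ξ _)
            (K.*-congˡ (K.trans (σ.*-homo (e i) _) (K.*-congˡ (σ-bar (e j)))))))))
      (K.trans (sum-σ _) (traces i j))

    conjugates : Vector K.Carrier 4 → Matrix K.Carrier 4 4
    conjugates = Index.conjugates α α-hom

    ν : K.Carrier → R.Carrier
    ν x = norm (φ x) R.* norm (φ (σ x))

    φ-norm : ∀ x → φ (Index.norm α α-hom x) C.≈ real (ν x)
    φ-norm x = C.trans (step₄ x (σ x) (bar x) (bar (σ x))) (C.trans
      (C.*-congˡ {φ x} (C.*-congˡ {φ (σ x)} (C.*-cong (φ-bar x) (C.*-congʳ {C.1#} (φ-bar (σ x))))))
      (C.trans (regroup (φ x) (φ (σ x)) (conj (φ x)) (conj (φ (σ x))))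
        (C.trans (C.*-cong (*-conj (φ x)) (*-conj (φ (σ x)))) (C.sym (IsRingHomomorphism.*-homo real-isRingHomomorphism _ _)))))
      where
      step₄ : ∀ a b c d → φ (a K.* (b K.* (c K.* (d K.* K.1#)))) C.≈ φ a C.* (φ b C.* (φ c C.* (φ d C.* C.1#)))
      step₄ a b c d = C.trans (φ.*-homo a _) (C.*-congˡ {φ a} (C.trans (φ.*-homo b _) (C.*-congˡ {φ b}
        (C.trans (φ.*-homo c _) (C.*-congˡ {φ c} (C.trans (φ.*-homo d _) (C.*-congˡ {φ d} φ.1#-homo)))))))
      regroup : ∀ z w z′ w′ → z C.* (w C.* (z′ C.* (w′ C.* C.1#))) C.≈ (z C.* z′) C.* (w C.* w′)
      regroup z w z′ w′ = C.trans (C.*-congˡ {z} (C.*-congˡ {w} (C.*-congˡ {z′} (C.*-identityʳ w′))))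
        (C.trans (C.sym (C.*-assoc z w (z′ C.* w′))) (interchange z w z′ w′))

    -- `bar` commutes with every `α k`, so the conjugate basis has the conjugate determinant, and
    -- |det|² N(ζ) is the Gram determinant. This takes the place of the norm of the ideal.
    unimodular : ∀ ζ (f : Vector K.Carrier 4) → (∀ i j → K.sum (λ k → α k (ζ K.* (f i K.* bar (f j)))) K.≈ K.fromℤ (J i j)) →
      norm (φ (det (conjugates f))) R.* ν ζ R.≈ R.1#
    unimodular ζ f h = ≈-re (C.trans (C.sym product≈real) (C.trans (C.sym φ-gram) φ.1#-homo))
      where
      d = det (conjugates f)
      d̄ = det (conjugates (λ j → bar (f j)))
      d̄≈bar-d : d̄ K.≈ bar d
      d̄≈bar-d = K.trans (Determinant.det-cong K.commutativeRing {4} (λ i k → K.sym (bar-α k (f i))))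
        (K.sym (Homomorphism.det-homo K.rawRing K.commutativeRing bar-hom (conjugates f)))
      gram : d K.* Index.norm α α-hom ζ K.* d̄ K.≈ K.1#
      -- The determinant of `J` evaluates to 1.
      gram = K.trans (Index.gram α α-hom f (λ j → bar (f j)) ζ J h) (IsRingHomomorphism.1#-homo K.fromℚ-isRingHomomorphism)
      φ-gram : φ K.1# C.≈ φ d C.* real (ν ζ) C.* conj (φ d)
      φ-gram = C.trans (φ.⟦⟧-cong (K.sym gram)) (C.trans (φ.*-homo _ _) (C.*-cong
        (C.trans (φ.*-homo d _) (C.*-congˡ {φ d} (φ-norm ζ))) (C.trans (φ.⟦⟧-cong d̄≈bar-d) (φ-bar d))))
      product≈real : φ d C.* real (ν ζ) C.* conj (φ d) C.≈ real (norm (φ d) R.* ν ζ)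
      product≈real = C.trans (xy∙z≈xz∙y (φ d) (real (ν ζ)) (conj (φ d)))
        (C.trans (C.*-congʳ {real (ν ζ)} (*-conj (φ d))) (C.sym (IsRingHomomorphism.*-homo real-isRingHomomorphism _ _)))

    D : K.Carrier
    D = e 0F K.* σ (e 2F) K.- σ (e 0F) K.* e 2F

    -- Otherwise the pairing of `e 0F` with `e 2F` would be 0, but it is 1.
    e₀≉0 : ¬ (e 0F K.≈ K.0#)
    e₀≉0 e₀≈0 = K.1≉0 (K.trans (K.sym (IsRingHomomorphism.1#-homo K.fromℚ-isRingHomomorphism)) (K.trans (K.sym (traces 0F 2F))
      (Determinant.sum-zero K.commutativeRing {4} λ k → K.trans (IsRingHomomorphism.⟦⟧-cong (α-hom k)
        (K.trans (K.*-congˡ (K.trans (K.*-congʳ e₀≈0) (K.zeroˡ (bar (e 2F))))) (K.zeroʳ ξ))) (IsRingHomomorphism.0#-homo (α-hom k)))))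

    i²-positive : ∀ i → i ≢ + 0 → ∃[ k ] i ℤ.* i ≡ + suc k
    i²-positive (+ zero)  i≢0 = contradiction ≡.refl i≢0
    i²-positive (+ suc n) _   = _ , ≡.refl
    i²-positive -[1+ n ]  _   = _ , ≡.refl

    ∣i∣²≡i² : ∀ i → + ℤ.∣ i ∣ ℤ.* + ℤ.∣ i ∣ ≡ i ℤ.* i
    ∣i∣²≡i² (+ n)    = ≡.refl
    ∣i∣²≡i² -[1+ n ] = ≡.refl

    fromℤ : ℤ → R.Carrier
    fromℤ i = R.fromℚ (i / 1)

    module fromℤ = IsRingHomomorphism (_∘ʰ_ {C = R.commutativeRing} R.fromℚ-isRingHomomorphism /1-isRingHomomorphism)

    fromℤ-nonNeg : ∀ n → R.NonNeg (fromℤ (+ n))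
    fromℤ-nonNeg n = R.nonNeg-fromℚ (ℚₚ.nonNegative⁻¹ (+ n / 1) {{ℚₚ.normalize-nonNeg n 1}})

    -- The source of the lower bound: applied to the index, it is where integrality becomes an
    -- inequality.
    fromℤ-i²≥1 : ∀ i → i ≢ + 0 → R.NonNeg (fromℤ i R.* fromℤ i R.- R.1#)
    fromℤ-i²≥1 i i≢0 = R.nonNeg-resp-≈ (R.sym (R.trans (R.+-congʳ (R.trans (R.sym (fromℤ.*-homo i i))
        (R.trans (fromℤ.⟦⟧-cong (proj₂ (i²-positive i i≢0))) (R.trans (fromℤ.+-homo (+ 1) (+ k)) (R.+-congʳ fromℤ.1#-homo)))))
        (solve 2 (λ o k → o :+ k :- o := k) R.refl R.1# (fromℤ (+ k)))))
      (fromℤ-nonNeg k)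
      where k = proj₁ (i²-positive i i≢0)

    K-fromℤ-nonzero : ∀ i → i ≢ + 0 → ¬ (K.fromℤ i K.≈ K.0#)
    K-fromℤ-nonzero i i≢0 i≈0 = -positive-impossible (ℚₚ.positive⁻¹ 1ℚ) (R.nonNeg-resp-≈
      (R.trans (R.+-congʳ (R.trans (R.*-cong î≈0 î≈0) (R.zeroˡ R.0#))) (R.trans (R.+-identityˡ _) (R.-‿cong (R.sym ℚ→R.1#-homo))))
      (fromℤ-i²≥1 i i≢0))
      where
      î≈0 : fromℤ i R.≈ R.0#
      î≈0 = ≈-re (C.trans (C.sym (φ-fromℚ (i / 1))) (C.trans (φ.⟦⟧-cong i≈0) φ.0#-homo))

    norm-nonNeg : ∀ z → R.NonNeg (norm z)
    norm-nonNeg (a , b) = R.nonNeg-+ (R.nonNeg-square a) (R.nonNeg-square b)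

    ν-nonNeg : ∀ x → R.NonNeg (ν x)
    ν-nonNeg x = R.nonNeg-* (norm-nonNeg (φ x)) (norm-nonNeg (φ (σ x)))

    -- The index p satisfies p E E′ = Δ N(D), so p is nonzero with Δ and D. Squared absolute values,
    -- with |E|² N(ξ) = |E′|² N(ξ) = 1, give p² = (|Δ| N(D) N(ξ))²; then p² ≥ 1, and nonnegative
    -- numbers compare as their squares do.
    discriminant-bound : ∀ {ω : Vector K.Carrier 4} {Δ} → LinearAlgebra.det ℚ.+-*-rawRing (λ i j → K.Tr (ω i K.* ω j)) ≡ Δ / 1 →
      {A A′ B B′ : Matrix ℤ 4 4} →
      (∀ i → ω i K.* e 0F K.≈ K.sum (λ j → K.fromℤ (A i j) K.* e j)) →
      (∀ i → ω i K.* σ (e 0F) K.≈ K.sum (λ j → K.fromℤ (A′ i j) K.* σ (e j))) →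
      (∀ i → ω i K.* e 2F K.≈ K.sum (λ j → K.fromℤ (B i j) K.* e j)) →
      (∀ i → ω i K.* σ (e 2F) K.≈ K.sum (λ j → K.fromℤ (B′ i j) K.* σ (e j))) →
      Δ ≢ + 0 → ¬ (D K.≈ K.0#) → R.NonNeg (fromℤ (+ ℤ.∣ Δ ∣) R.* (ν D R.* ν ξ) R.- R.1#)
    discriminant-bound {ω} {Δ} disc {A} {A′} {B} {B′} hA hA′ hB hB′ Δ≢0 D≉0 =
      squares-cancel nonNeg-1 (R.nonNeg-* (fromℤ-nonNeg ℤ.∣ Δ ∣) (R.nonNeg-* (ν-nonNeg D) (ν-nonNeg ξ)))
        (R.nonNeg-resp-≈ (R.+-cong (R.sym square) (R.-‿cong (R.sym (R.*-identityˡ R.1#)))) (fromℤ-i²≥1 p p≢0))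
      where
      open SetoidReasoning R.setoid
      E E′ : K.Carrier
      E  = det (conjugates e)
      E′ = det (conjugates (λ j → σ (e j)))
      index = Index.index α α-hom σ-hom {ω} {e} {e 0F} {e 2F} {A} {A′} {B} {B′} e₀≉0 hA hA′ hB hB′
      p = proj₁ index
      p-equation : K.fromℤ p K.* (E K.* E′) K.≈ K.fromℤ Δ K.* Index.norm α α-hom D
      p-equation = K.trans (proj₂ index) (K.*-congʳ (Index.det-conjugates² α α-hom distinct ω Δ disc))
      p≢0 : p ≢ + 0
      p≢0 p≡0 = Index.product-nonzero (λ k → Index.endomorphism-nonzero (α-hom k) D≉0)
        (KP.*-cancelˡ-0 (K-fromℤ-nonzero Δ Δ≢0) (K.trans (K.sym p-equation)
          (K.trans (K.*-congʳ (K.trans (K.reflexive (≡.cong K.fromℤ p≡0)) (IsRingHomomorphism.0#-homo K.fromℚ-isRingHomomorphism))) (K.zeroˡ _))))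
      norms : fromℤ p R.* fromℤ p R.* (norm (φ E) R.* norm (φ E′)) R.≈ fromℤ Δ R.* fromℤ Δ R.* (ν D R.* ν D)
      norms = begin
        fromℤ p R.* fromℤ p R.* (norm (φ E) R.* norm (φ E′))
          ≈⟨ R.*-cong (norm-real (fromℤ p)) (norm-* (φ E) (φ E′)) ⟨
        norm (real (fromℤ p)) R.* norm (φ E C.* φ E′)
          ≈⟨ norm-* (real (fromℤ p)) (φ E C.* φ E′) ⟨
        norm (real (fromℤ p) C.* (φ E C.* φ E′))
          ≈⟨ norm-cong (C.trans (C.*-cong (C.sym (φ-fromℚ (p / 1))) (C.sym (φ.*-homo E E′))) (C.trans (C.sym (φ.*-homo (K.fromℤ p) (E K.* E′)))
               (C.trans (φ.⟦⟧-cong p-equation) (C.trans (φ.*-homo (K.fromℤ Δ) (Index.norm α α-hom D)) (C.*-cong (φ-fromℚ (Δ / 1)) (φ-norm D)))))) ⟩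
        norm (real (fromℤ Δ) C.* real (ν D))
          ≈⟨ norm-* (real (fromℤ Δ)) (real (ν D)) ⟩
        norm (real (fromℤ Δ)) R.* norm (real (ν D))
          ≈⟨ R.*-cong (norm-real (fromℤ Δ)) (norm-real (ν D)) ⟩
        fromℤ Δ R.* fromℤ Δ R.* (ν D R.* ν D) ∎
      unit : norm (φ E) R.* ν ξ R.≈ R.1#
      unit = unimodular ξ e traces
      unit′ : norm (φ E′) R.* ν ξ R.≈ R.1#
      unit′ = R.trans (R.*-congˡ (R.trans (R.*-comm _ _) (R.*-congˡ (R.sym (norm-σσ ξ))))) (unimodular (σ ξ) (λ j → σ (e j)) traces-σ)
      N = fromℤ (+ ℤ.∣ Δ ∣)
      square : N R.* (ν D R.* ν ξ) R.* (N R.* (ν D R.* ν ξ)) R.≈ fromℤ p R.* fromℤ p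
      square = begin
        N R.* (ν D R.* ν ξ) R.* (N R.* (ν D R.* ν ξ))
          ≈⟨ solve 3 (λ n d x → n :* (d :* x) :* (n :* (d :* x)) := n :* n :* (d :* d) :* (x :* x)) R.refl N (ν D) (ν ξ) ⟩
        N R.* N R.* (ν D R.* ν D) R.* (ν ξ R.* ν ξ)
          ≈⟨ R.*-congʳ (R.*-congʳ (R.trans (R.sym (fromℤ.*-homo (+ ℤ.∣ Δ ∣) (+ ℤ.∣ Δ ∣))) (R.trans (fromℤ.⟦⟧-cong (∣i∣²≡i² Δ)) (fromℤ.*-homo Δ Δ)))) ⟩
        fromℤ Δ R.* fromℤ Δ R.* (ν D R.* ν D) R.* (ν ξ R.* ν ξ)
          ≈⟨ R.*-congʳ norms ⟨
        fromℤ p R.* fromℤ p R.* (norm (φ E) R.* norm (φ E′)) R.* (ν ξ R.* ν ξ)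
          ≈⟨ solve 4 (λ p a b x → p :* (a :* b) :* (x :* x) := p :* (a :* x :* (b :* x))) R.refl (fromℤ p R.* fromℤ p) (norm (φ E)) (norm (φ E′)) (ν ξ) ⟩
        fromℤ p R.* fromℤ p R.* (norm (φ E) R.* ν ξ R.* (norm (φ E′) R.* ν ξ))
          ≈⟨ R.*-congˡ (R.trans (R.*-cong unit unit′) (R.*-identityˡ R.1#)) ⟩
        fromℤ p R.* fromℤ p R.* R.1#
          ≈⟨ R.*-identityʳ _ ⟩
        fromℤ p R.* fromℤ p ∎

  record ReducedBasis {S : Symmetry} (B : SymplecticBasis S) : Set where
    open Symmetry S
    open SymplecticBasis B
    field
      z₁ z₁₂ z₂ : C.Carrier
      row₁      : φ (e 2F) C.≈ z₁ C.* φ (e 0F) C.+ z₁₂ C.* φ (e 1F)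
      row₁σ     : φ (σ (e 2F)) C.≈ z₁ C.* φ (σ (e 0F)) C.+ z₁₂ C.* φ (σ (e 1F))
      row₂      : φ (e 3F) C.≈ z₁₂ C.* φ (e 0F) C.+ z₂ C.* φ (e 1F)
      row₂σ     : φ (σ (e 3F)) C.≈ z₁₂ C.* φ (σ (e 0F)) C.+ z₂ C.* φ (σ (e 1F))
      η₁≥0      : R.NonNeg (proj₂ (φ ξ))
      η₂≥0      : R.NonNeg (proj₂ (φ (σ ξ)))
      x₁-bound  : R.NonNeg (fromInt (+ 1) R.- fromInt (+ 4) R.* (proj₁ z₁ R.* proj₁ z₁))
      x₁₂-bound : R.NonNeg (fromInt (+ 1) R.- fromInt (+ 4) R.* (proj₁ z₁₂ R.* proj₁ z₁₂))
      y₁₂≥0     : R.NonNeg (proj₂ z₁₂)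
      2y₁₂≤y₁   : R.NonNeg (proj₂ z₁ R.- fromInt (+ 2) R.* proj₂ z₁₂)
      y₁≤y₂     : R.NonNeg (proj₂ z₂ R.- proj₂ z₁)
      ∣z₁∣≥1    : R.NonNeg (norm z₁ R.- fromInt (+ 1))

  module Reduced {S : Symmetry} {B : SymplecticBasis S} (Z : ReducedBasis B) where
    open Symmetry S
    open Conjugates S
    open SymplecticBasis B
    open Lattice B
    open ReducedBasis Z
    open RingSolver R.commutativeRing
    open SetoidReasoning R.setoid

    u₁ u₂ v₁ v₂ w : C.Carrier
    u₁ = φ (e 0F)
    u₂ = φ (σ (e 0F))
    v₁ = φ (e 1F)
    v₂ = φ (σ (e 1F))
    w = u₁ C.* v₂ C.- u₂ C.* v₁

    W : R.Carrier → R.Carrier → R.Carrier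
    W = weighted η₁ η₂

    a b g : R.Carrier
    a = W (norm u₁) (norm u₂)
    b = W (dot u₁ v₁) (dot u₂ v₂)
    g = W (norm v₁) (norm v₂)

    c≈0 : W (cross u₁ v₁) (cross u₂ v₂) R.≈ R.0#
    c≈0 = R.trans (symplectic 0F 1F) ℚ→R.0#-homo

    drop-c : ∀ s x → s R.+ x R.* W (cross u₁ v₁) (cross u₂ v₂) R.≈ s
    drop-c s x = R.trans (R.+-congˡ (R.trans (R.*-congˡ c≈0) (R.zeroʳ x))) (R.+-identityʳ s)

    -- Only the imaginary parts of `z` and `z′` remain, because what is left is a multiple of the
    -- pairing of e₁ with e₂, which is 0. Together with `pair-v` this shows that the Gram matrix of
    -- (e₁ , e₂) is the inverse of Im Z.
    pair-u : ∀ {f} z z′ → φ f C.≈ z C.* u₁ C.+ z′ C.* v₁ → φ (σ f) C.≈ z C.* u₂ C.+ z′ C.* v₂ →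
      W (cross u₁ (φ f)) (cross u₂ (φ (σ f))) R.≈ proj₂ z R.* a R.+ proj₂ z′ R.* b
    pair-u z z′ h hσ = R.trans (weighted-cong
        (R.trans (cross-cong (C.refl {u₁}) h) (cross-combinationˡ z z′ u₁ v₁))
        (R.trans (cross-cong (C.refl {u₂}) hσ) (cross-combinationˡ z z′ u₂ v₂)))
      (R.trans (weighted-linear₃ η₁ η₂ (proj₂ z) (proj₂ z′) (proj₁ z′) _ _ _ _ _ _) (drop-c _ _))

    pair-v : ∀ {f} z z′ → φ f C.≈ z C.* u₁ C.+ z′ C.* v₁ → φ (σ f) C.≈ z C.* u₂ C.+ z′ C.* v₂ →
      W (cross v₁ (φ f)) (cross v₂ (φ (σ f))) R.≈ proj₂ z R.* b R.+ proj₂ z′ R.* g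
    pair-v z z′ h hσ = R.trans (weighted-cong
        (R.trans (cross-cong (C.refl {v₁}) h) (cross-combinationʳ z z′ u₁ v₁))
        (R.trans (cross-cong (C.refl {v₂}) hσ) (cross-combinationʳ z z′ u₂ v₂)))
      (R.trans (weighted-linear₃ η₁ η₂ (proj₂ z) (proj₂ z′) (R.- proj₁ z) _ _ _ _ _ _) (drop-c _ _))

    ⟨1⟩ : R.fromℚ 1ℚ R.≈ fromInt (+ 1)
    ⟨1⟩ = R.trans ℚ→R.1#-homo (R.sym 1-homo)

    -- Lagrange's identity for e₁ and e₂, which are orthogonal for the Riemann form.
    r≈ : a R.* g R.- b R.* b R.≈ fromInt (+ 4) R.* (η₁ R.* η₂) R.* norm w
    r≈ = R.trans (R.+-congʳ (R.trans (lagrange η₁ η₂ u₁ u₂ v₁ v₂) (R.+-congʳ (drop-c _ _))))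
      (solve 2 (λ s t → s :+ t :- s := t) R.refl (b R.* b) (fromInt (+ 4) R.* (η₁ R.* η₂) R.* norm w))

    4η₁η₂≥0 : R.NonNeg (fromInt (+ 4) R.* (η₁ R.* η₂))
    4η₁η₂≥0 = R.nonNeg-* (nonNeg-ℕ 4) (R.nonNeg-* η₁≥0 η₂≥0)

    reducedForm : Estimate.ReducedForm R
    reducedForm = record
      { x₁ = proj₁ z₁ ; x₁₂ = proj₁ z₁₂ ; y₁ = proj₂ z₁ ; y₁₂ = proj₂ z₁₂ ; y₂ = proj₂ z₂ ; a = a ; b = b ; g = g
      ; 1-4x₁²≥0 = x₁-bound ; 1-4x₁₂²≥0 = x₁₂-bound
      ; y₁₂≥0 = y₁₂≥0 ; 2y₁₂≤y₁ = 2y₁₂≤y₁ ; y₁≤y₂ = y₁≤y₂ ; ∣z₁∣≥1 = ∣z₁∣≥1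
      ; e₁₃ = R.trans (R.sym (pair-u z₁ z₁₂ row₁ row₁σ)) (R.trans (symplectic 0F 2F) ⟨1⟩)
      ; e₁₄ = R.trans (R.sym (pair-u z₁₂ z₂ row₂ row₂σ)) (R.trans (symplectic 0F 3F) ℚ→R.0#-homo)
      ; e₂₃ = R.trans (R.sym (pair-v z₁ z₁₂ row₁ row₁σ)) (R.trans (symplectic 1F 2F) ℚ→R.0#-homo)
      ; e₂₄ = R.trans (R.sym (pair-v z₁₂ z₂ row₂ row₂σ)) (R.trans (symplectic 1F 3F) ⟨1⟩)
      ; r≥0 = R.nonNeg-resp-≈ (R.sym r≈) (R.nonNeg-* 4η₁η₂≥0 (norm-nonNeg w))
      }

    module E = Estimate.InverseImaginaryPart R reducedForm

    h≈ : W (norm (φ (e 2F))) (norm (φ (σ (e 2F)))) R.≈ E.h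
    h≈ = R.trans (weighted-cong (norm-cong row₁) (norm-cong row₁σ))
      (R.trans (weighted-norm-combination η₁ η₂ z₁ z₁₂ u₁ u₂ v₁ v₂)
        (R.trans (R.+-congˡ (R.-‿cong (R.*-congˡ (R.trans (R.*-congˡ c≈0) (R.zeroʳ _)))))
          (solve 1 (λ s → s :- con (+ 2) :* con (+ 0) := s) R.refl E.h)))

    φD≈ : φ D C.≈ z₁₂ C.* w
    φD≈ = C.trans (φ.+-homo _ _) (C.trans (C.+-cong (φ.*-homo (e 0F) (σ (e 2F))) (C.trans (φ.-‿homo _) (C.-‿cong (φ.*-homo (σ (e 0F)) (e 2F)))))
      (C.trans (C.+-cong (C.*-congˡ {u₁} row₁σ) (C.-‿cong (C.*-congˡ {u₂} row₁)))
        (Elimination.eliminate gaussianRing z₁ z₁₂ u₁ u₂ v₁ v₂)))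

    -- Scaled like `r≈`: then n |z₁₂|² r f contains (4 η₁ η₂)² = 16 N(ξ), and equals 16 n N(D) N(ξ).
    f : R.Carrier
    f = fromInt (+ 4) R.* (η₁ R.* η₂) R.* norm (φ (σ D))

    -- Cauchy–Schwarz, using |φ (σ (σ x))| = |φ x|.
    f≤ah : R.NonNeg (a R.* E.h R.- f)
    f≤ah = R.nonNeg-resp-≈ (begin
      p R.* p R.+ q R.* q
        ≈⟨ solve 2 (λ s t → s := s :+ t :- t) R.refl (p R.* p R.+ q R.* q) (fromInt (+ 4) R.* (η₁ R.* η₂) R.* norm (U C.* t₂ C.- u₂ C.* T)) ⟩
      p R.* p R.+ q R.* q R.+ fromInt (+ 4) R.* (η₁ R.* η₂) R.* norm (U C.* t₂ C.- u₂ C.* T) R.- fromInt (+ 4) R.* (η₁ R.* η₂) R.* norm (U C.* t₂ C.- u₂ C.* T)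
        ≈⟨ R.+-cong (R.sym (lagrange η₁ η₂ U u₂ T t₂)) (R.-‿cong (R.*-congˡ (R.trans (norm-swap (U C.* t₂) (u₂ C.* T)) (R.sym (norm-cong φσD≈))))) ⟩
      W (norm U) (norm u₂) R.* W (norm T) (norm t₂) R.- f
        ≈⟨ R.+-congʳ (R.*-cong (weighted-cong (norm-σσ (e 0F)) R.refl) (R.trans (weighted-cong (norm-σσ (e 2F)) R.refl) h≈)) ⟩
      a R.* E.h R.- f ∎)
      (R.nonNeg-+ (R.nonNeg-square p) (R.nonNeg-square q))
      where
      -- The components of (U , u₂) have the absolute values of (u₁ , u₂), so its Hermitian norm is
      -- still `a`; likewise (T , t₂) has norm `h`. The determinant of the two vectors is -φ(σ D).
      U T t₂ : C.Carrier
      U = φ (σ (σ (e 0F)))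
      T = φ (σ (σ (e 2F)))
      t₂ = φ (σ (e 2F))
      p q : R.Carrier
      p = W (dot U T) (dot u₂ t₂)
      q = W (cross U T) (cross u₂ t₂)
      φσD≈ : φ (σ D) C.≈ u₂ C.* T C.- U C.* t₂
      φσD≈ = C.trans (φ.⟦⟧-cong (K.trans (σ.+-homo _ _) (K.+-cong (σ.*-homo (e 0F) (σ (e 2F)))
          (K.trans (σ.-‿homo _) (K.-‿cong (σ.*-homo (σ (e 0F)) (e 2F)))))))
        (C.trans (φ.+-homo _ _) (C.+-cong (φ.*-homo (σ (e 0F)) (σ (σ (e 2F))))
            (C.trans (φ.-‿homo _) (C.-‿cong (φ.*-homo (σ (σ (e 0F))) (σ (e 2F)))))))

    norm-imaginary : ∀ {z} → proj₁ z R.≈ R.0# → norm z R.≈ proj₂ z R.* proj₂ z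
    norm-imaginary {x , y} x≈0 = R.trans (R.+-congʳ (R.trans (R.*-congʳ x≈0) (R.zeroˡ x))) (R.+-identityˡ _)

    -- Since |φ(D)|² = |z₁₂|² |w|² and N(ξ) = (η₁ η₂)², sixteen times the hypothesis is the input m
    -- r f ≥ 16 of `estimate`, with m = n |z₁₂|².
    z₁₂-bound : ∀ {n} → R.NonNeg n → R.NonNeg (n R.* (ν D R.* ν ξ) R.- R.1#) → R.NonNeg (n R.* norm z₁₂ R.- fromInt (+ 2))
    z₁₂-bound {n} n≥0 h = E.estimate (R.nonNeg-* n≥0 (norm-nonNeg z₁₂)) f≤ah (R.nonNeg-resp-≈ (begin
      fromInt (+ 16) R.* (n R.* (ν D R.* ν ξ) R.- R.1#)
        ≈⟨ R.*-congˡ (R.+-cong (R.*-congˡ (R.*-cong (R.*-congʳ (R.trans (norm-cong φD≈) (norm-* z₁₂ w)))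
             (R.*-cong (norm-imaginary ξ-imaginary) (norm-imaginary σξ-imaginary)))) (R.-‿cong (R.sym 1-homo))) ⟩
      fromInt (+ 16) R.* (n R.* (norm z₁₂ R.* norm w R.* norm (φ (σ D)) R.* (η₁ R.* η₁ R.* (η₂ R.* η₂))) R.- fromInt (+ 1))
        ≈⟨ solve 6 (λ n z w d s t → con (+ 16) :* (n :* (z :* w :* d :* (s :* s :* (t :* t))) :- con (+ 1)) :=
             n :* z :* (con (+ 4) :* (s :* t) :* w :* (con (+ 4) :* (s :* t) :* d)) :- con (+ 16)) R.refl n (norm z₁₂) (norm w) (norm (φ (σ D))) η₁ η₂ ⟩
      n R.* norm z₁₂ R.* (fromInt (+ 4) R.* (η₁ R.* η₂) R.* norm w R.* f) R.- fromInt (+ 16)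
        ≈⟨ R.+-congʳ (R.*-congˡ (R.*-congʳ r≈)) ⟨
      n R.* norm z₁₂ R.* ((a R.* g R.- b R.* b) R.* f) R.- fromInt (+ 16) ∎)
      (R.nonNeg-* (nonNeg-ℕ 16) h))

    -- φ(D) = z₁₂ w, and w has an explicit inverse: 4 η₁ η₂ |w|² = r and d r = 1, so conj w times 4
    -- η₁ η₂ d inverts it.
    D≈0⇒z₁₂≈0 : D K.≈ K.0# → z₁₂ C.≈ C.0#
    D≈0⇒z₁₂≈0 D≈0 = C.trans (C.sym (C.*-identityʳ z₁₂)) (C.trans (C.*-congˡ {z₁₂} (C.sym unit))
      (C.trans (C.sym (C.*-assoc z₁₂ w _)) (C.trans (C.*-congʳ {_} (C.trans (C.sym φD≈) (C.trans (φ.⟦⟧-cong D≈0) φ.0#-homo))) (C.zeroˡ _))))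
      where
      k = fromInt (+ 4) R.* (η₁ R.* η₂) R.* E.d
      unit : w C.* (conj w C.* real k) C.≈ C.1#
      unit = C.trans (C.sym (C.*-assoc w (conj w) (real k))) (C.trans (C.*-congʳ {real k} (*-conj w))
        (C.trans (C.sym (IsRingHomomorphism.*-homo real-isRingHomomorphism (norm w) k)) (R.trans
          (solve 4 (λ n s d f → n :* (f :* s :* d) := d :* (f :* s :* n)) R.refl (norm w) (η₁ R.* η₂) E.d (fromInt (+ 4)))
          (R.trans (R.*-congˡ (R.sym r≈)) (R.trans E.rd≈1 1-homo)) & R.refl)))

    z₁₂≈0⇒imaginary-square-root : z₁₂ C.≈ C.0# →
      ∃[ r ] (0ℚ ℚ.< r × ∃[ s ] (s K.* s K.≈ K.fromℚ (ℚ.- r) × φ s C.≈ φ (σ s)))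
    z₁₂≈0⇒imaginary-square-root z₁₂≈0 = imaginary-square-root t (C.trans φt≈z₁ (C.sym φσt≈z₁))
      (R.nonNeg-resp-≈ (R.+-congʳ (R.*-congˡ (R.*-cong (R.sym (≈-im φt≈z₁)) (R.sym (≈-im φt≈z₁))))) E.4y₁²≥3)
      where
      e₀⁻¹ = proj₁ (K.inverse (e 0F) e₀≉0)
      t = e 2F K.* e₀⁻¹
      quotient-is-z₁ : ∀ {x u v i} → x C.≈ z₁ C.* u C.+ z₁₂ C.* v → u C.* i C.≈ C.1# → x C.* i C.≈ z₁
      quotient-is-z₁ {x} {u} {v} {i} hx hu = C.trans (C.*-congʳ {i}
          (C.trans hx (C.trans (C.+-congˡ {z₁ C.* u} (C.trans (C.*-congʳ {v} z₁₂≈0) (C.zeroˡ v))) (C.+-identityʳ _))))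
        (C.trans (C.*-assoc z₁ u i) (C.trans (C.*-congˡ {z₁} hu) (C.*-identityʳ z₁)))
      φt≈z₁ : φ t C.≈ z₁
      φt≈z₁ = C.trans (φ.*-homo (e 2F) e₀⁻¹) (quotient-is-z₁ row₁
        (C.trans (C.sym (φ.*-homo (e 0F) e₀⁻¹)) (C.trans (φ.⟦⟧-cong (proj₂ (K.inverse (e 0F) e₀≉0))) φ.1#-homo)))
      φσt≈z₁ : φ (σ t) C.≈ z₁
      φσt≈z₁ = C.trans (φ.⟦⟧-cong (σ.*-homo (e 2F) e₀⁻¹)) (C.trans (φ.*-homo (σ (e 2F)) (σ e₀⁻¹)) (quotient-is-z₁ row₁σ
        (C.trans (C.sym (φ.*-homo (σ (e 0F)) (σ e₀⁻¹))) (C.trans (φ.⟦⟧-cong (K.trans (K.sym (σ.*-homo (e 0F) e₀⁻¹))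
            (K.trans (σ.⟦⟧-cong (proj₂ (K.inverse (e 0F) e₀≉0))) σ.1#-homo))) φ.1#-homo))))

module IntegralElements {n} (K : NumberField n) where
  open NumberField K hiding (zero)
  open NumberFieldProperties K

  -- σ fixes the integer coefficients of the monic equation of `y` and is injective, so the same
  -- equation holds for `x`. This is what makes the integers act on σ I.
  integer-preimage : ∀ {σ} → Endomorphism σ → ∀ {x y} → σ x ≈ y → IsInteger y → IsInteger x
  integer-preimage {σ} σ-hom {x} {y} σx≈y (m , c , root) = m , c ,
    Into.injective commutativeRing σ-hom 1≉0 (trans image (trans root (sym σ.0#-homo)))
    where
    module σ = IsRingHomomorphism σ-hom
    open Homomorphism rawRing commutativeRing σ-hom
    ^-cong : ∀ k → σ x ^ k ≈ y ^ k
    ^-cong zero    = refl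
    ^-cong (suc k) = *-cong σx≈y (^-cong k)
    image : σ (x ^ m + sum (λ i → fromℤ (c i) * x ^ toℕ i)) ≈ y ^ m + sum (λ i → fromℤ (c i) * y ^ toℕ i)
    image = trans (σ.+-homo _ _) (+-cong (trans (^-homo x m) (^-cong m))
      (trans (sum-homo (λ i → fromℤ (c i) * x ^ toℕ i)) (Determinant.sum-cong commutativeRing
          (λ i → σ (fromℤ (c i) * x ^ toℕ i)) (λ i → fromℤ (c i) * y ^ toℕ i)
        λ i → trans (σ.*-homo _ _) (*-cong (endomorphism-fixes-ℚ σ-hom (c i / 1)) (trans (^-homo x (toℕ i)) (^-cong (toℕ i)))))))

-- The Galois group from the CM type.

module GaloisGroup (R : OrderedRing) (K : NumberField 4) where
  private
    module K = NumberField K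
    module KP = NumberFieldProperties K
  open Gaussian (OrderedRing.commutativeRing R)
  open HermitianIdentities (OrderedRing.commutativeRing R) using (module C)
  open GaloisCM R K using (1≉0; automorphisms; Symmetry)

  IsEmbedding : (K.Carrier → C.Carrier) → Set
  IsEmbedding = IsRingHomomorphism K.rawRing C.rawRing

  injective : ∀ {ψ} → IsEmbedding ψ → ∀ {x y} → ψ x C.≈ ψ y → x K.≈ y
  injective ψ-hom = KP.Into.injective gaussianRing ψ-hom 1≉0

  identity : KP.Endomorphism id
  identity = mkRingHomomorphism id id (λ _ _ → K.refl) (λ _ _ → K.refl) (λ _ → K.refl) K.refl K.refl

  conjugate-embeddings : (φ₀ φ₁ : K.Carrier → C.Carrier) → Fin 4 → K.Carrier → C.Carrier
  conjugate-embeddings φ₀ φ₁ 0F x = φ₀ x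
  conjugate-embeddings φ₀ φ₁ 1F x = φ₁ x
  conjugate-embeddings φ₀ φ₁ 2F x = conj (φ₀ x)
  conjugate-embeddings φ₀ φ₁ 3F x = conj (φ₁ x)

  record CMEmbeddings : Set₁ where
    field
      {φ₀ φ₁}  : K.Carrier → C.Carrier
      φ₀-hom   : IsEmbedding φ₀
      φ₁-hom   : IsEmbedding φ₁
      covers   : ∀ {τ} → KP.Endomorphism τ → ∃[ c ] (∀ x → φ₀ (τ x) C.≈ conjugate-embeddings φ₀ φ₁ c x)
      distinct : ∀ c d → c ≢ d → ¬ (∀ x → conjugate-embeddings φ₀ φ₁ c x C.≈ conjugate-embeddings φ₀ φ₁ d x)
      {bar}    : K.Carrier → K.Carrier
      bar-conj : ∀ {τ} → KP.Endomorphism τ → ∀ x → φ₀ (τ (bar x)) C.≈ conj (φ₀ (τ x))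
      galois   : K.IsGalois

  module Translation (Φ : CMEmbeddings) where
    open CMEmbeddings Φ using (φ₀; φ₁; φ₀-hom; φ₁-hom; covers; distinct; bar; bar-conj)
    private
      module φ₀ = IsRingHomomorphism φ₀-hom
      module conj = IsRingHomomorphism conj-isRingHomomorphism
      module galois = Inverse (CMEmbeddings.galois Φ)
      τ : Fin 4 → K.Carrier → K.Carrier
      τ k = K.Automorphism.map (galois.to k)
      τ-iso = λ k → K.Automorphism.isRingIsomorphism (galois.to k)
      τ-hom : ∀ k → KP.Endomorphism (τ k)
      τ-hom k = IsRingIsomorphism.isRingHomomorphism (τ-iso k)
      code : Fin 4 → Fin 4
      code k = proj₁ (covers (τ-hom k))
      code-injective : ∀ i j → code i ≡ code j → i ≡ j
      code-injective i j eq = galois-injective λ x → injective φ₀-hom (C.trans (proj₂ (covers (τ-hom i)) x)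
        (C.trans (C.reflexive (≡.cong (λ c → conjugate-embeddings φ₀ φ₁ c x) eq)) (C.sym (proj₂ (covers (τ-hom j)) x))))
        where
        galois-injective : (∀ x → τ i x K.≈ τ j x) → i ≡ j
        galois-injective h = ≡.trans (≡.sym (galois.strictlyInverseʳ i)) (≡.trans (galois.from-cong h) (galois.strictlyInverseʳ j))

    -- Four distinct automorphisms give four distinct embeddings φ₀ ∘ τ, so φ₁ is one of them.
    translate : ∃[ k ] code k ≡ 1F
    translate with Finₚ.any? (λ k → code k Finₚ.≟ 1F)
    ... | yes found = found
    ... | no none = contradiction (Finₚ.pigeonhole (ℕₚ.n<1+n 3) (λ k → punchOut (avoids k)))
      λ (i , j , i<j , eq) → Finₚ.<⇒≢ i<j (code-injective i j (Finₚ.punchOut-injective (avoids i) (avoids j) eq))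
      where
      avoids : ∀ k → 1F ≢ code k
      avoids k 1≡ = none (k , ≡.sym 1≡)

    σ : K.Carrier → K.Carrier
    σ = τ (proj₁ translate)

    σ-hom : KP.Endomorphism σ
    σ-hom = τ-hom (proj₁ translate)

    σ-preimage : ∀ y → ∃[ x ] σ x K.≈ y
    σ-preimage y = let (x , h) = IsRingIsomorphism.surjective (τ-iso (proj₁ translate)) y in x , h K.refl

    private
      module σ = IsRingHomomorphism σ-hom

    φ₀σ≈φ₁ : ∀ x → φ₀ (σ x) C.≈ φ₁ x
    φ₀σ≈φ₁ x = C.trans (proj₂ (covers (τ-hom (proj₁ translate))) x)
      (C.reflexive (≡.cong (λ c → conjugate-embeddings φ₀ φ₁ c x) (proj₂ translate)))

    φ₀-bar : ∀ x → φ₀ (bar x) C.≈ conj (φ₀ x)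
    φ₀-bar = bar-conj identity

    φ₀σ-bar : ∀ x → φ₀ (σ (bar x)) C.≈ conj (φ₀ (σ x))
    φ₀σ-bar = bar-conj σ-hom

    -- `bar` is given as a mere function. The injective φ₀ carries it to complex conjugation, from
    -- which the homomorphism laws are read back.
    bar-hom : KP.Endomorphism bar
    bar-hom = mkRingHomomorphism bar
      (λ {x} {y} x≈y → by (C.trans (conj.⟦⟧-cong (φ₀.⟦⟧-cong x≈y)) (C.sym (φ₀-bar y))))
      (λ x y → by (C.trans (conj.⟦⟧-cong (φ₀.+-homo x y)) (C.trans (conj.+-homo (φ₀ x) (φ₀ y))
        (C.sym (C.trans (φ₀.+-homo (bar x) (bar y)) (C.+-cong (φ₀-bar x) (φ₀-bar y)))))))
      (λ x y → by (C.trans (conj.⟦⟧-cong (φ₀.*-homo x y)) (C.trans (conj.*-homo (φ₀ x) (φ₀ y))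
        (C.sym (C.trans (φ₀.*-homo (bar x) (bar y)) (C.*-cong (φ₀-bar x) (φ₀-bar y)))))))
      (λ x → by (C.trans (conj.⟦⟧-cong (φ₀.-‿homo x)) (C.trans (conj.-‿homo (φ₀ x))
        (C.sym (C.trans (φ₀.-‿homo (bar x)) (C.-‿cong (φ₀-bar x)))))))
      (by (C.trans (conj.⟦⟧-cong φ₀.0#-homo) (C.trans conj.0#-homo (C.sym φ₀.0#-homo))))
      (by (C.trans (conj.⟦⟧-cong φ₀.1#-homo) (C.trans conj.1#-homo (C.sym φ₀.1#-homo))))
      where
      by : ∀ {x y} → conj (φ₀ x) C.≈ φ₀ y → bar x K.≈ y
      by {x} h = injective φ₀-hom (C.trans (φ₀-bar x) h)

    private
      α : Fin 4 → K.Carrier → K.Carrier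
      α = automorphisms σ bar

    φ₀α : ∀ k x → φ₀ (α k x) C.≈ conjugate-embeddings φ₀ φ₁ k x
    φ₀α 0F x = C.refl
    φ₀α 1F x = φ₀σ≈φ₁ x
    φ₀α 2F x = φ₀-bar x
    φ₀α 3F x = C.trans (φ₀-bar (σ x)) (conj.⟦⟧-cong (φ₀σ≈φ₁ x))

    α-distinct : ∀ k l → k ≢ l → ¬ (∀ x → α k x K.≈ α l x)
    α-distinct k l k≢l h = distinct k l k≢l λ x → C.trans (C.sym (φ₀α k x)) (C.trans (φ₀.⟦⟧-cong (h x)) (φ₀α l x))

    -- The square of σ is one of the four automorphisms. If it were σ or bar σ, cancelling one σ
    -- would make σ equal to 1 or to bar.
    σσ : (∀ x → σ (σ x) K.≈ x) ⊎ (∀ x → σ (σ x) K.≈ bar x)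
    σσ = cases (covers (_∘ʰ_ {C = K.commutativeRing} σ-hom σ-hom))
      where
      σ-injective : ∀ {x y} → σ x K.≈ σ y → x K.≈ y
      σ-injective = KP.Into.injective K.commutativeRing σ-hom K.1≉0
      cases : ∃[ c ] (∀ x → φ₀ (σ (σ x)) C.≈ conjugate-embeddings φ₀ φ₁ c x) → _
      cases (0F , h) = inj₁ λ x → injective φ₀-hom (h x)
      cases (2F , h) = inj₂ λ x → injective φ₀-hom (C.trans (h x) (C.sym (φ₀-bar x)))
      cases (1F , h) = contradiction (λ x → σ-injective (injective φ₀-hom (C.trans (h x) (C.sym (φ₀σ≈φ₁ x))))) (α-distinct 1F 0F (λ ()))
      cases (3F , h) = contradiction (λ x → σ-injective (injective φ₀-hom (C.trans (h x)
        (C.sym (C.trans (φ₀σ-bar x) (conj.⟦⟧-cong (φ₀σ≈φ₁ x))))))) (α-distinct 1F 2F (λ ()))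

    symmetry : Symmetry
    symmetry = record
      { φ-hom = φ₀-hom ; σ-hom = σ-hom ; bar-hom = bar-hom ; φ-bar = φ₀-bar ; φσ-bar = φ₀σ-bar
      ; distinct = α-distinct ; σσ = σσ }

open import Data.Integer.Base using (∣_∣)

-- The conditions of the fundamental domain as polynomial inequalities.

module FundamentalDomainInequalities (R : OrderedRing) where
  open OrderedRing R
  open OrderedRingProperties R
  open RingSolver commutativeRing
  open IntegerCoefficients commutativeRing using (fromInt; 1-homo)
  open HermitianIdentities commutativeRing
  open Gaussian commutativeRing

  half+half : fromℚ ½ + fromℚ ½ ≈ fromInt (+ 1)
  half+half = trans (sym (fromℚ.+-homo ½ ½)) (trans fromℚ.1#-homo (sym 1-homo))

  ∣x∣≤½ : ∀ {x} → NonNeg (x - fromℚ (ℚ.- ½)) → NonNeg (fromℚ ½ - x) → NonNeg (fromInt (+ 1) - fromInt (+ 4) * (x * x))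
  ∣x∣≤½ {x} l u = nonNeg-resp-≈
    (trans (*-congˡ (*-cong (+-congˡ (-‿cong (fromℚ.-‿homo ½))) refl))
      (trans (solve 2 (λ h x → con (+ 4) :* ((x :- :- h) :* (h :- x)) := (h :+ h) :* (h :+ h) :- con (+ 4) :* (x :* x)) refl (fromℚ ½) x)
        (+-congʳ (trans (*-cong half+half half+half) (solve 0 (con (+ 1) :* con (+ 1) := con (+ 1)) refl)))))
    (nonNeg-* (nonNeg-ℕ 4) (nonNeg-* l u))

  fromℚ-2 : fromℚ (+ 2 / 1) ≈ fromInt (+ 2)
  fromℚ-2 = trans (fromℚ.+-homo 1ℚ 1ℚ) (trans (+-cong fromℚ.1#-homo fromℚ.1#-homo) (+-congˡ (sym 1-homo)))

  y₁₂≥0 : ∀ {y} → NonNeg (fromℚ (+ 2 / 1) * y - 0#) → NonNeg y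
  y₁₂≥0 {y} h = cancelˡ-ℕ 1 (nonNeg-resp-≈ (trans (+-congʳ (*-congʳ fromℚ-2)) (solve 1 (λ y → con (+ 2) :* y :- con (+ 0) := con (+ 2) :* y) refl y)) h)

  2y₁₂≤y₁ : ∀ {y y′} → NonNeg (y′ - fromℚ (+ 2 / 1) * y) → NonNeg (y′ - fromInt (+ 2) * y)
  2y₁₂≤y₁ = nonNeg-resp-≈ (+-congˡ (-‿cong (*-congʳ fromℚ-2)))

  -- s stands for √x.
  1≤√x⇒1≤x : ∀ {s x y} → NonNeg (s - 1#) → NonNeg (x - s * s) → x ≈ y → NonNeg (y - fromInt (+ 1))
  1≤√x⇒1≤x {s} {x} {y} 1≤s s²≤x x≈y = nonNeg-resp-≈
    (trans (solve 3 (λ s x o → (x :- s :* s) :+ (s :- o) :* ((s :- o) :+ o :+ o) := x :- o :* o) refl s x 1#)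
      (+-cong x≈y (-‿cong (trans (*-identityˡ 1#) (sym 1-homo)))))
    (nonNeg-+ s²≤x (nonNeg-* 1≤s (nonNeg-+ (nonNeg-+ 1≤s nonNeg-1) nonNeg-1)))

  -- s and z stand for √q, where q = 1 / n, and √x.
  final-bound : ∀ {n q s z x c} → NonNeg q → NonNeg s → NonNeg z → NonNeg c → NonNeg (1# - c) → n * q ≈ 1# →
    NonNeg (q - s * s) → NonNeg (z * z - x) → NonNeg (n * x - fromInt (+ 2)) → NonNeg (z - c * s)
  -- The chain is z² ≥ x ≥ 2 q ≥ c² q ≥ (c s)², for any c between 0 and 1.
  final-bound {n} {q} {s} {z} {x} {c} q≥0 s≥0 z≥0 c≥0 c≤1 nq≈1 s²≤q x≤z² nx≥2 = squares-cancel (nonNeg-* c≥0 s≥0) z≥0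
    (nonNeg-resp-≈ (trans (solve 7 (λ n q s z x c o →
        (z :* z :- x) :+ q :* (n :* x :- con (+ 2)) :+ c :* c :* (q :- s :* s) :+ ((o :- c) :* (o :+ c) :* q :+ q) :=
        (z :* z :- c :* s :* (c :* s)) :+ (n :* q :* x :- x) :+ (o :* o :* q :- q)) refl n q s z x c 1#)
      (trans (+-cong (+-congˡ (trans (+-congʳ (trans (*-congʳ nq≈1) (*-identityˡ x))) (-‿inverseʳ x)))
          (trans (+-congʳ (trans (*-congʳ (*-identityˡ 1#)) (*-identityˡ q))) (-‿inverseʳ q)))
        (trans (+-identityʳ _) (+-identityʳ _))))
      (nonNeg-+ (nonNeg-+ (nonNeg-+ x≤z² (nonNeg-* q≥0 nx≥2)) (nonNeg-* (nonNeg-* c≥0 c≥0) s²≤q))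
        (nonNeg-+ (nonNeg-* (nonNeg-* c≤1 (nonNeg-+ nonNeg-1 c≥0)) q≥0) q≥0)))

  symplectic-form : ∀ ξ₁ ξ₂ z₁ w₁ z₂ w₂ →
    proj₁ (ξ₁ C.* (z₁ C.* conj w₁ C.- conj z₁ C.* w₁)) + (proj₁ (ξ₂ C.* (z₂ C.* conj w₂ C.- conj z₂ C.* w₂)) + 0#) ≈
    weighted (proj₂ ξ₁) (proj₂ ξ₂) (cross z₁ w₁) (cross z₂ w₂)
  symplectic-form ξ₁ ξ₂ z₁ w₁ z₂ w₂ = trans (+-cong (form-cross ξ₁ z₁ w₁) (+-congʳ (form-cross ξ₂ z₂ w₂)))
    (solve 4 (λ η₁ η₂ s t → con (+ 2) :* (η₁ :* s) :+ (con (+ 2) :* (η₂ :* t) :+ con (+ 0)) := con (+ 2) :* (η₁ :* s :+ η₂ :* t))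
      refl (proj₂ ξ₁) (proj₂ ξ₂) (cross z₁ w₁) (cross z₂ w₂))

  weighted-η-cong : ∀ {η η₁ η₂ s s₁ s₂} → η₁ ≈ η₂ → s₁ ≈ s₂ → weighted η η₁ s s₁ ≈ weighted η η₂ s s₂
  weighted-η-cong p q = *-congˡ (+-congˡ (*-cong p q))

module CornerDeterminant (A : RawRing 0ℓ 0ℓ) (B : CommutativeRing 0ℓ 0ℓ)
  {f : RawRing.Carrier A → CommutativeRing.Carrier B} (hom : IsRingHomomorphism A (CommutativeRing.rawRing B) f) where
  private
    module A = RawRing A
    module LA = LinearAlgebra A
  open CommutativeRing B hiding (zero)
  open LinearAlgebra rawRing using (det)
  open IsRingHomomorphism hom
  open RingSolver B

  det-corner : ∀ (M : Matrix Carrier 2 2) {z z′} → M 0F 0F ≈ z → M 0F 1F ≈ z′ → M 1F 0F ≈ 0# → M 1F 1F ≈ 1# → det M ≈ z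
  det-corner M {z} {z′} h₀₀ h₀₁ h₁₀ h₁₁ = trans
    (+-cong (*-congˡ (*-cong h₀₀ (+-congʳ (*-congˡ (*-congʳ h₁₁))))) (+-congʳ (*-congˡ (*-cong h₀₁ (+-congʳ (*-congˡ (*-congʳ h₁₀)))))))
    (trans (solve 4 (λ z z′ o t → o :* (z :* (o :* (o :* o) :+ con (+ 0))) :+ (t :* (z′ :* (o :* (con (+ 0) :* o) :+ con (+ 0))) :+ con (+ 0)) :=
        o :* o :* o :* o :* z) refl z z′ 1# (- 1# * 1#))
      (trans (*-congʳ (trans (*-identityʳ _) (trans (*-identityʳ _) (*-identityʳ _)))) (*-identityˡ z)))

  -- The rows (1 , 0) and (0 , 1) of C and D select the first row of Z and the second row of the identity.
  det-CZ+D : ∀ {C D : Matrix A.Carrier 2 2} (Z : Matrix A.Carrier 2 2) →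
    f (C 0F 0F) ≈ 1# → f (C 0F 1F) ≈ 0# → f (C 1F 0F) ≈ 0# → f (C 1F 1F) ≈ 0# →
    f (D 0F 0F) ≈ 0# → f (D 0F 1F) ≈ 0# → f (D 1F 0F) ≈ 0# → f (D 1F 1F) ≈ 1# →
    f (LA.det (C LA.⊗ Z LA.⊕ D)) ≈ f (Z 0F 0F)
  det-CZ+D {C} {D} Z c₀₀ c₀₁ c₁₀ c₁₁ d₀₀ d₀₁ d₁₀ d₁₁ = trans (Homomorphism.det-homo A B hom (C LA.⊗ Z LA.⊕ D))
    (det-corner (λ i j → f ((C LA.⊗ Z LA.⊕ D) i j))
      (trans (entry 0F 0F) (first c₀₀ c₀₁ d₀₀)) (trans (entry 0F 1F) (first c₀₀ c₀₁ d₀₁))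
      (trans (entry 1F 0F) (second c₁₀ c₁₁ d₁₀)) (trans (entry 1F 1F) (second c₁₀ c₁₁ d₁₁)))
    where
    entry : ∀ i j → f ((C LA.⊗ Z LA.⊕ D) i j) ≈ (f (C i 0F) * f (Z 0F j) + (f (C i 1F) * f (Z 1F j) + 0#)) + f (D i j)
    entry i j = trans (+-homo _ _) (+-congʳ (trans (+-homo _ _) (+-cong (*-homo _ _)
      (trans (+-homo _ _) (+-cong (*-homo _ _) 0#-homo)))))
    first : ∀ {c₀ c₁ d z w} → c₀ ≈ 1# → c₁ ≈ 0# → d ≈ 0# → (c₀ * z + (c₁ * w + 0#)) + d ≈ z
    first {z = z} {w} h₀ h₁ h = trans (+-cong (+-cong (trans (*-congʳ h₀) (*-identityˡ z)) (+-congʳ (trans (*-congʳ h₁) (zeroˡ w)))) h)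
      (solve 1 (λ z → (z :+ (con (+ 0) :+ con (+ 0))) :+ con (+ 0) := z) refl z)
    second : ∀ {c₀ c₁ d d′ z w} → c₀ ≈ 0# → c₁ ≈ 0# → d ≈ d′ → (c₀ * z + (c₁ * w + 0#)) + d ≈ d′
    second {d′ = d′} {z} {w} h₀ h₁ h = trans (+-cong (+-cong (trans (*-congʳ h₀) (zeroˡ z)) (+-congʳ (trans (*-congʳ h₁) (zeroˡ w)))) h)
      (solve 1 (λ d → (con (+ 0) :+ (con (+ 0) :+ con (+ 0))) :+ d := d) refl d′)

-- The theorem over an ordered ring.

module Main (R : OrderedRing) (K : NumberField 4) where
  private
    module R = OrderedRing R
    module K = NumberField K
    module KP = NumberFieldProperties K
  open HermitianIdentities R.commutativeRing
  open Gaussian R.commutativeRing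
  open FundamentalDomainInequalities R using (symplectic-form; weighted-η-cong)
  open GaloisGroup R K using (identity; injective; CMEmbeddings; module CMEmbeddings; module Translation)
  open GaloisCM R K using (SymplecticBasis; ReducedBasis; module Lattice; module Reduced)
  open IntegerCoefficients R.commutativeRing using (fromInt)

  record ReducedTriple : Set₁ where
    field
      Φ : CMEmbeddings
    open CMEmbeddings Φ public
    field
      I : K.FractionalIdeal
      ξ : K.Carrier
      ξ-imaginary : ∀ {τ} → KP.Endomorphism τ → proj₁ (φ₀ (τ ξ)) R.≈ R.0#
      ξ-positive₀ : R.NonNeg (proj₂ (φ₀ ξ))
      ξ-positive₁ : R.NonNeg (proj₂ (φ₁ ξ))
      e : Vector K.Carrier 4
      e-basis : IsBasis ℤ.+-*-rawRing K.rawRing K.fromℤ (NumberField.FractionalIdeal._∈I I) e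
      e-symplectic : ∀ i j →
        proj₁ (φ₀ ξ C.* (φ₀ (e i) C.* conj (φ₀ (e j)) C.- conj (φ₀ (e i)) C.* φ₀ (e j))) R.+
        (proj₁ (φ₁ ξ C.* (φ₁ (e i) C.* conj (φ₁ (e j)) C.- conj (φ₁ (e i)) C.* φ₁ (e j))) R.+ R.0#) R.≈ R.fromℚ (J i j / 1)
      z₁ z₁₂ z₂ : C.Carrier
      row₁₀ : φ₀ (e 2F) C.≈ z₁ C.* φ₀ (e 0F) C.+ z₁₂ C.* φ₀ (e 1F)
      row₁₁ : φ₁ (e 2F) C.≈ z₁ C.* φ₁ (e 0F) C.+ z₁₂ C.* φ₁ (e 1F)
      row₂₀ : φ₀ (e 3F) C.≈ z₁₂ C.* φ₀ (e 0F) C.+ z₂ C.* φ₀ (e 1F)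
      row₂₁ : φ₁ (e 3F) C.≈ z₁₂ C.* φ₁ (e 0F) C.+ z₂ C.* φ₁ (e 1F)
      x₁-bound  : R.NonNeg (fromInt (+ 1) R.- fromInt (+ 4) R.* (proj₁ z₁ R.* proj₁ z₁))
      x₁₂-bound : R.NonNeg (fromInt (+ 1) R.- fromInt (+ 4) R.* (proj₁ z₁₂ R.* proj₁ z₁₂))
      y₁₂≥0     : R.NonNeg (proj₂ z₁₂)
      2y₁₂≤y₁   : R.NonNeg (proj₂ z₁ R.- fromInt (+ 2) R.* proj₂ z₁₂)
      y₁≤y₂     : R.NonNeg (proj₂ z₂ R.- proj₂ z₁)
      ∣z₁∣≥1    : R.NonNeg (norm z₁ R.- fromInt (+ 1))

  module Theorem (T : ReducedTriple) where
    open ReducedTriple T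
    open Translation Φ using (σ; σ-hom; σ-preimage; φ₀σ≈φ₁; symmetry)
    private
      module I = NumberField.FractionalIdeal I
      module φ₀ = IsRingHomomorphism φ₀-hom
      module σ = IsRingHomomorphism σ-hom

      φ₁≈ : ∀ x → φ₁ x C.≈ φ₀ (σ x)
      φ₁≈ x = C.sym (φ₀σ≈φ₁ x)

      row-σ : ∀ {f} z w → φ₁ f C.≈ z C.* φ₁ (e 0F) C.+ w C.* φ₁ (e 1F) → φ₀ (σ f) C.≈ z C.* φ₀ (σ (e 0F)) C.+ w C.* φ₀ (σ (e 1F))
      row-σ {f} z w h = C.trans (φ₀σ≈φ₁ f) (C.trans h (C.+-cong (C.*-congˡ {z} (φ₁≈ (e 0F))) (C.*-congˡ {w} (φ₁≈ (e 1F)))))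

      basis : SymplecticBasis symmetry
      basis = record
        { ξ = ξ ; ξ-imaginary = ξ-imaginary identity ; σξ-imaginary = ξ-imaginary σ-hom ; e = e
        ; symplectic = λ i j → R.trans (weighted-η-cong (≈-im (φ₀σ≈φ₁ ξ)) (cross-cong (φ₀σ≈φ₁ (e i)) (φ₀σ≈φ₁ (e j))))
            (R.trans (R.sym (symplectic-form (φ₀ ξ) (φ₁ ξ) (φ₀ (e i)) (φ₀ (e j)) (φ₁ (e i)) (φ₁ (e j)))) (e-symplectic i j))
        }

      reduced : ReducedBasis basis
      reduced = record
        { z₁ = z₁ ; z₁₂ = z₁₂ ; z₂ = z₂
        ; row₁ = row₁₀ ; row₁σ = row-σ z₁ z₁₂ row₁₁ ; row₂ = row₂₀ ; row₂σ = row-σ z₁₂ z₂ row₂₁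
        ; η₁≥0 = ξ-positive₀ ; η₂≥0 = R.nonNeg-resp-≈ (≈-im (φ₁≈ ξ)) ξ-positive₁
        ; x₁-bound = x₁-bound ; x₁₂-bound = x₁₂-bound
        ; y₁₂≥0 = y₁₂≥0 ; 2y₁₂≤y₁ = 2y₁₂≤y₁ ; y₁≤y₂ = y₁≤y₂ ; ∣z₁∣≥1 = ∣z₁∣≥1
        }

      module L = Lattice basis
      module Red = Reduced reduced

    -- By injectivity of φ₀ the square root s is fixed by σ, hence so is all of ℚ(s), and there φ₁ =
    -- φ₀ ∘ σ agrees with φ₀.
    z₁₂≈0⇒imprimitive : z₁₂ C.≈ C.0# → ∃[ r ] Σ (0ℚ ℚ.< r) λ 0<r →
      Σ (FieldHom (ImaginaryQuadraticField.field′ r 0<r) K) λ h → ∀ x → φ₀ (FieldHom.map h x) C.≈ φ₁ (FieldHom.map h x)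
    z₁₂≈0⇒imprimitive z₁₂≈0 = conclude (Red.z₁₂≈0⇒imaginary-square-root z₁₂≈0)
      where
      fixed : ∀ {s} → φ₀ s C.≈ φ₀ (σ s) → ∀ a b → σ (K.fromℚ a K.+ K.fromℚ b K.* s) K.≈ K.fromℚ a K.+ K.fromℚ b K.* s
      fixed φs≈φσs a b = K.trans (σ.+-homo _ _) (K.+-cong (KP.endomorphism-fixes-ℚ σ-hom a)
        (K.trans (σ.*-homo _ _) (K.*-cong (KP.endomorphism-fixes-ℚ σ-hom b) (injective φ₀-hom (C.sym φs≈φσs)))))
      conclude : ∃[ r ] (0ℚ ℚ.< r × ∃[ s ] (s K.* s K.≈ K.fromℚ (ℚ.- r) × φ₀ s C.≈ φ₀ (σ s))) → _
      conclude (r , 0<r , s , s²≈-r , φs≈φσs) = r , 0<r , ImaginaryQuadraticField.adjoin r 0<r K s²≈-r ,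
        λ (a , b) → C.trans (φ₀.⟦⟧-cong (K.sym (fixed φs≈φσs a b))) (φ₀σ≈φ₁ _)

    main-bound : ∀ {ω : Vector K.Carrier 4} {Δ} → (∀ i → K.IsInteger (ω i)) →
      LinearAlgebra.det ℚ.+-*-rawRing (λ i j → K.Tr (ω i K.* ω j)) ≡ Δ / 1 → Δ ≢ + 0 → ¬ (z₁₂ C.≈ C.0#) →
      R.NonNeg (R.fromℚ (+ ∣ Δ ∣ / 1) R.* norm z₁₂ R.- fromInt (+ 2))
    main-bound {ω} {Δ} ω-integer disc Δ≢0 z₁₂≉0 = Red.z₁₂-bound (L.fromℤ-nonNeg ∣ Δ ∣)
      (L.discriminant-bound disc
        {coefficients ω ω-integer 0F} {coefficients υ υ-integer 0F} {coefficients ω ω-integer 2F} {coefficients υ υ-integer 2F}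
        (expansion ω ω-integer 0F) (λ i → expansion-σ i 0F)
        (expansion ω ω-integer 2F) (λ i → expansion-σ i 2F) Δ≢0 (z₁₂≉0 ∘ Red.D≈0⇒z₁₂≈0))
      where
      coefficients : ∀ (υ : Vector K.Carrier 4) → (∀ i → K.IsInteger (υ i)) → Fin 4 → Matrix ℤ 4 4
      coefficients υ h l i = proj₁ (proj₂ e-basis (υ i K.* e l) (I.*-closed (h i) (proj₁ e-basis l)))
      expansion : ∀ υ h l i → υ i K.* e l K.≈ K.sum (λ j → K.fromℤ (coefficients υ h l i j) K.* e j)
      expansion υ h l i = proj₁ (proj₂ (proj₂ e-basis (υ i K.* e l) (I.*-closed (h i) (proj₁ e-basis l))))
      -- With υᵢ = σ⁻¹(ωᵢ) one has ωᵢ σ(x) = σ(υᵢ x), so the coordinates of υᵢ x over e are those of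
      -- ωᵢ σ(x) over σ e.
      υ : Vector K.Carrier 4
      υ i = proj₁ (σ-preimage (ω i))
      υ-integer : ∀ i → K.IsInteger (υ i)
      υ-integer i = IntegralElements.integer-preimage K σ-hom (proj₂ (σ-preimage (ω i))) (ω-integer i)
      expansion-σ : ∀ i l → ω i K.* σ (e l) K.≈ K.sum (λ j → K.fromℤ (coefficients υ υ-integer l i j) K.* σ (e j))
      expansion-σ i l = K.trans (K.*-congʳ (K.sym (proj₂ (σ-preimage (ω i))))) (K.trans (K.sym (σ.*-homo (υ i) (e l)))
        (K.trans (σ.⟦⟧-cong (expansion υ υ-integer l i))
          (K.trans (Homomorphism.sum-homo K.rawRing K.commutativeRing σ-hom (λ j → K.fromℤ (coefficients υ υ-integer l i j) K.* e j))
            (Determinant.sum-cong K.commutativeRing (λ j → σ (K.fromℤ (coefficients υ υ-integer l i j) K.* e j))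
              (λ j → K.fromℤ (coefficients υ υ-integer l i j) K.* σ (e j))
              (λ j → K.trans (σ.*-homo _ (e j)) (K.*-congʳ (KP.endomorphism-fixes-ℚ σ-hom (coefficients υ υ-integer l i j / 1))))))))

-- Transfer of the given data into an ordered ring.

module HermitianForm (A : RawRing 0ℓ 0ℓ) (R : CommutativeRing 0ℓ 0ℓ) (cj : RawRing.Carrier A → RawRing.Carrier A)
  {f : RawRing.Carrier A → HermitianIdentities.C.Carrier R} (hom : IsRingHomomorphism A (HermitianIdentities.C.rawRing R) f)
  (f-cj : ∀ z → HermitianIdentities.C._≈_ R (f (cj z)) (Gaussian.conj R (f z))) where
  private
    module A = RawRing A
    module LA = LinearAlgebra A
  open HermitianIdentities R using (module C)
  open Gaussian R using (conj)
  open IsRingHomomorphism hom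

  form-homo : ∀ (ξ z w : Vector A.Carrier 2) {c} →
    LA.sum (λ j → ξ j A.* (z j A.* cj (w j) A.+ A.- (cj (z j) A.* w j))) A.≈ c →
    f (ξ 0F) C.* (f (z 0F) C.* conj (f (w 0F)) C.- conj (f (z 0F)) C.* f (w 0F)) C.+
    (f (ξ 1F) C.* (f (z 1F) C.* conj (f (w 1F)) C.- conj (f (z 1F)) C.* f (w 1F)) C.+ C.0#) C.≈ f c
  form-homo ξ z w h = C.trans (C.sym (C.trans (+-homo _ _) (C.+-cong (term 0F) (C.trans (+-homo _ _) (C.+-cong (term 1F) 0#-homo))))) (⟦⟧-cong h)
    where
    term : ∀ j → f (ξ j A.* (z j A.* cj (w j) A.+ A.- (cj (z j) A.* w j))) C.≈
      f (ξ j) C.* (f (z j) C.* conj (f (w j)) C.- conj (f (z j)) C.* f (w j))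
    term j = C.trans (*-homo (ξ j) _) (C.*-congˡ {f (ξ j)} (C.trans (+-homo _ _) (C.+-cong
      (C.trans (*-homo (z j) (cj (w j))) (C.*-congˡ {f (z j)} (f-cj (w j))))
      (C.trans (-‿homo _) (C.-‿cong (C.trans (*-homo (cj (z j)) (w j)) (C.*-congʳ {f (w j)} (f-cj (z j)))))))))

-- The inversion z₁ ↦ −1 / z₁, for which det (C Z + D) = z₁.
inversion : Matrix ℤ 4 4
inversion 0F 2F = -[1+ 0 ]
inversion 1F 1F = + 1
inversion 2F 0F = + 1
inversion 3F 3F = + 1
inversion _  _  = + 0

inversion-symplectic : IsSymplectic inversion
inversion-symplectic = from-yes (Finₚ.all? λ i → Finₚ.all? λ j → (inversion ᵀ ⊗ J ⊗ inversion) i j ℤₚ.≟ J i j)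
  where open LinearAlgebra ℤ.+-*-rawRing

-- ℝ seen through an opaque ordered ring: comparing terms built from the operations of ℝ would
-- compare the proofs that sequences are Cauchy.
open Real using (1/[1+_])

record RealModel : Set₁ where
  field
    orderedRing : OrderedRing
  open OrderedRing orderedRing
  field
    ⟦_⟧         : ℝ → Carrier
    isRingHomomorphism : IsRingHomomorphism ℝ-rawRing rawRing ⟦_⟧
    reflects    : ∀ {x y} → ⟦ x ⟧ ≈ ⟦ y ⟧ → x Real.≈ y
    ⟦⟧-fromℚ    : ∀ q → ⟦ Real.fromℚ q ⟧ ≈ fromℚ q
    ⟦⟧-nonNeg   : ∀ {x} → NonNegative x → NonNeg ⟦ x ⟧
    nonNeg-⟦⟧   : ∀ {x} → NonNeg ⟦ x ⟧ → NonNegative x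

ℝ-model : RealModel
ℝ-model = record
  { orderedRing = ℝ-orderedRing
  ; ⟦_⟧ = id
  ; isRingHomomorphism = mkRingHomomorphism id id
      (λ x y → RealEquality.≈-refl {x Real.+ y}) (λ x y → RealEquality.≈-refl {x Real.* y}) (λ x → RealEquality.≈-refl {Real.- x})
      (RealEquality.≈-refl {Real.0#}) (RealEquality.≈-refl {Real.1#})
  ; reflects = id
  ; ⟦⟧-fromℚ = λ q → RealEquality.≈-refl {Real.fromℚ q}
  ; ⟦⟧-nonNeg = id
  ; nonNeg-⟦⟧ = id
  }

<⇒≤ : ∀ {x y} → x Real.< y → x Real.≤ y
<⇒≤ {x} {y} (ε , 0<ε , N , x+ε<y) (δ , 0<δ , M , y+δ<x) = ℚₚ.<-asym
  (below (ℝ.seq x n) (ℝ.seq y n) ε 0<ε (x+ε<y n (ℕₚ.m≤m⊔n N M))) (below (ℝ.seq y n) (ℝ.seq x n) δ 0<δ (y+δ<x n (ℕₚ.m≤n⊔m N M)))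
  where
  n = N ℕ.⊔ M
  below : ∀ p q e → 0ℚ ℚ.< e → p ℚ.+ e ℚ.< q → p ℚ.< q
  below p q e 0<e p+e<q = ℚₚ.<-trans (≡.subst (ℚ._< p ℚ.+ e) (ℚₚ.+-identityʳ p) (ℚₚ.+-monoʳ-< p 0<e)) p+e<q

module Model (M : RealModel) where
  open RealModel M
  module R = OrderedRing orderedRing
  open HermitianIdentities R.commutativeRing
  open Gaussian R.commutativeRing
  open OrderedRingProperties orderedRing using (module fromℚ)
  open IntegerCoefficients R.commutativeRing using (fromInt)

  private
    module hom = IsRingHomomorphism isRingHomomorphism

  ⟦⟧-cong : ∀ {x y} → x Real.≈ y → ⟦ x ⟧ R.≈ ⟦ y ⟧
  ⟦⟧-cong {x} {y} = hom.⟦⟧-cong {x} {y}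

  ⟦⟧-+ : ∀ x y → ⟦ x Real.+ y ⟧ R.≈ ⟦ x ⟧ R.+ ⟦ y ⟧
  ⟦⟧-+ = hom.+-homo

  ⟦⟧-* : ∀ x y → ⟦ x Real.* y ⟧ R.≈ ⟦ x ⟧ R.* ⟦ y ⟧
  ⟦⟧-* = hom.*-homo

  ⟦⟧-neg : ∀ x → ⟦ Real.- x ⟧ R.≈ R.- ⟦ x ⟧
  ⟦⟧-neg = hom.-‿homo

  ⟦⟧-minus : ∀ x y → ⟦ x Real.- y ⟧ R.≈ ⟦ x ⟧ R.- ⟦ y ⟧
  ⟦⟧-minus x y = R.trans (⟦⟧-+ x (Real.- y)) (R.+-congˡ (⟦⟧-neg y))

  ⟦⟧-0 : ⟦ Real.0# ⟧ R.≈ R.0#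
  ⟦⟧-0 = R.trans (⟦⟧-fromℚ 0ℚ) fromℚ.0#-homo

  ⟦⟧-1 : ⟦ Real.1# ⟧ R.≈ R.1#
  ⟦⟧-1 = R.trans (⟦⟧-fromℚ 1ℚ) fromℚ.1#-homo

  ⟦⟧-≤ : ∀ {x y} → x Real.≤ y → R.NonNeg (⟦ y ⟧ R.- ⟦ x ⟧)
  ⟦⟧-≤ {x} {y} x≤y = R.nonNeg-resp-≈ (⟦⟧-minus y x) (⟦⟧-nonNeg {y Real.- x} (RealOrder.≤⇒nonNeg {x} {y} x≤y))

  ⟦⟧-< : ∀ {x y} → x Real.< y → R.NonNeg (⟦ y ⟧ R.- ⟦ x ⟧)
  ⟦⟧-< {x} {y} x<y = ⟦⟧-≤ {x} {y} (<⇒≤ {x} {y} x<y)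

  ≤-⟦⟧ : ∀ {x y} → R.NonNeg (⟦ y ⟧ R.- ⟦ x ⟧) → x Real.≤ y
  ≤-⟦⟧ {x} {y} h = RealOrder.nonNeg⇒≤ {x} {y} (nonNeg-⟦⟧ {y Real.- x} (R.nonNeg-resp-≈ (R.sym (⟦⟧-minus y x)) h))

  toPair : ℂ → C.Carrier
  toPair z = ⟦ Defs.re z ⟧ , ⟦ Defs.im z ⟧

  toPair-cong : ∀ {z w} → z Complex.≈ w → toPair z C.≈ toPair w
  toPair-cong {z} {w} (p , q) = ⟦⟧-cong {Defs.re z} {Defs.re w} p & ⟦⟧-cong {Defs.im z} {Defs.im w} q

  toPair-reflects : ∀ {z w} → toPair z C.≈ toPair w → z Complex.≈ w
  toPair-reflects {z} {w} (p & q) = reflects {Defs.re z} {Defs.re w} p , reflects {Defs.im z} {Defs.im w} q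

  toPair-conj : ∀ z → toPair (Complex.conj z) C.≈ conj (toPair z)
  toPair-conj z = R.refl & ⟦⟧-neg (Defs.im z)

  toPair-isRingHomomorphism : IsRingHomomorphism ℂ-rawRing C.rawRing toPair
  toPair-isRingHomomorphism = mkRingHomomorphism toPair (λ {z} {w} → toPair-cong {z} {w})
    (λ z w → ⟦⟧-+ (Defs.re z) (Defs.re w) & ⟦⟧-+ (Defs.im z) (Defs.im w))
    (λ z w → R.trans (⟦⟧-minus (Defs.re z Real.* Defs.re w) (Defs.im z Real.* Defs.im w))
               (R.+-cong (⟦⟧-* (Defs.re z) (Defs.re w)) (R.-‿cong (⟦⟧-* (Defs.im z) (Defs.im w))))
           & R.trans (⟦⟧-+ (Defs.re z Real.* Defs.im w) (Defs.im z Real.* Defs.re w))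
               (R.+-cong (⟦⟧-* (Defs.re z) (Defs.im w)) (⟦⟧-* (Defs.im z) (Defs.re w))))
    (λ z → ⟦⟧-neg (Defs.re z) & ⟦⟧-neg (Defs.im z))
    (⟦⟧-0 & ⟦⟧-0) (⟦⟧-1 & ⟦⟧-0)

  toPair-0 : toPair Complex.0# C.≈ C.0#
  toPair-0 = ⟦⟧-0 & ⟦⟧-0

  toPair-1 : toPair Complex.1# C.≈ C.1#
  toPair-1 = ⟦⟧-1 & ⟦⟧-0

  module _ (Z : Sym₂ℂ) (Z∈F : InFundamentalDomain Z) where
    open Sym₂ℂ Z
    open InFundamentalDomain Z∈F
    open FundamentalDomainInequalities orderedRing

    private
      ∣x∣-bound : ∀ x → (x ≡ x₁ ⊎ x ≡ x₂ ⊎ x ≡ x₁₂) → R.NonNeg (fromInt (+ 1) R.- fromInt (+ 4) R.* (⟦ x ⟧ R.* ⟦ x ⟧))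
      ∣x∣-bound x x∈Z = ∣x∣≤½
        (R.nonNeg-resp-≈ (R.+-congˡ (R.-‿cong (⟦⟧-fromℚ (ℚ.- ½)))) (⟦⟧-≤ {Real.fromℚ (ℚ.- ½)} {x} (proj₁ (S1 x x∈Z))))
        (R.nonNeg-resp-≈ (R.+-congʳ (⟦⟧-fromℚ ½)) (⟦⟧-< {x} {Real.fromℚ ½} (proj₂ (S1 x x∈Z))))

      ⟦2y⟧ : ∀ y → ⟦ Real.fromℤ (+ 2) Real.* y ⟧ R.≈ R.fromℚ (+ 2 / 1) R.* ⟦ y ⟧
      ⟦2y⟧ y = R.trans (⟦⟧-* (Real.fromℤ (+ 2)) y) (R.*-congʳ (⟦⟧-fromℚ (+ 2 / 1)))

      ∣w∣≥1 : ∀ {w z} → Real.1# Real.≤ Complex.∣ w ∣ → toPair w C.≈ z → R.NonNeg (norm z R.- fromInt (+ 1))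
      ∣w∣≥1 {w} 1≤∣w∣ w≈z = 1≤√x⇒1≤x {⟦ Real.√ N ⟧} {⟦ N ⟧}
        (R.nonNeg-resp-≈ (R.+-congˡ (R.-‿cong ⟦⟧-1)) (⟦⟧-≤ {Real.1#} {Real.√ N} 1≤∣w∣))
        (R.nonNeg-resp-≈ (R.trans (⟦⟧-minus N (Real.√ N Real.* Real.√ N)) (R.+-congˡ (R.-‿cong (⟦⟧-* (Real.√ N) (Real.√ N)))))
          (⟦⟧-nonNeg {N Real.- Real.√ N Real.* Real.√ N} (RealOrder.√-lower {N}
              (RealOrder.nonNeg-+ {a Real.* a} {b Real.* b} (RealOrder.nonNeg-square a) (RealOrder.nonNeg-square b)))))
        (R.trans (R.trans (⟦⟧-+ (a Real.* a) (b Real.* b)) (R.+-cong (⟦⟧-* a a) (⟦⟧-* b b))) (norm-cong w≈z))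
        where
        a = Defs.re w
        b = Defs.im w
        N = a Real.* a Real.+ b Real.* b

    x₁-bound : R.NonNeg (fromInt (+ 1) R.- fromInt (+ 4) R.* (⟦ x₁ ⟧ R.* ⟦ x₁ ⟧))
    x₁-bound = ∣x∣-bound x₁ (inj₁ ≡.refl)

    x₁₂-bound : R.NonNeg (fromInt (+ 1) R.- fromInt (+ 4) R.* (⟦ x₁₂ ⟧ R.* ⟦ x₁₂ ⟧))
    x₁₂-bound = ∣x∣-bound x₁₂ (inj₂ (inj₂ ≡.refl))

    y₁₂-bound : R.NonNeg ⟦ y₁₂ ⟧
    y₁₂-bound = y₁₂≥0 (R.nonNeg-resp-≈ (R.+-cong (⟦2y⟧ y₁₂) (R.-‿cong ⟦⟧-0)) (⟦⟧-≤ {Real.0#} {Real.fromℤ (+ 2) Real.* y₁₂} (proj₁ S2)))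

    y₁-bound : R.NonNeg (⟦ y₁ ⟧ R.- fromInt (+ 2) R.* ⟦ y₁₂ ⟧)
    y₁-bound = 2y₁₂≤y₁ (R.nonNeg-resp-≈ (R.+-congˡ (R.-‿cong (⟦2y⟧ y₁₂))) (⟦⟧-≤ {Real.fromℤ (+ 2) Real.* y₁₂} {y₁} (proj₁ (proj₂ S2))))

    y₂-bound : R.NonNeg (⟦ y₂ ⟧ R.- ⟦ y₁ ⟧)
    y₂-bound = ⟦⟧-≤ {y₁} {y₂} (proj₂ (proj₂ S2))

    ∣z₁∣-bound : R.NonNeg (norm (toPair z₁) R.- fromInt (+ 1))
    ∣z₁∣-bound = ∣w∣≥1 (S3 inversion inversion-symplectic)
      (CornerDeterminant.det-CZ+D ℂ-rawRing gaussianRing toPair-isRingHomomorphism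
        {λ i j → Complex.fromℤ (lowerLeft inversion i j)} {λ i j → Complex.fromℤ (lowerRight inversion i j)} toMatrix
        toPair-1 toPair-0 toPair-0 toPair-0 toPair-0 toPair-0 toPair-0 toPair-1)

  ∣z∣-bound : ∀ z n → R.NonNeg (R.fromℚ (+ suc n / 1) R.* norm (toPair z) R.- fromInt (+ 2)) →
    Real.fromℚ (+ 2 / 3) Real.* Real.√ (Real.fromℚ 1/[1+ n ]) Real.≤ Complex.∣ z ∣
  ∣z∣-bound z n h = ≤-⟦⟧ {c Real.* Real.√ q} {Real.√ N} (R.nonNeg-resp-≈ (R.+-congˡ (R.-‿cong (R.sym (⟦⟧-* c (Real.√ q)))))
    (FundamentalDomainInequalities.final-bound orderedRing {R.fromℚ (+ suc n / 1)} {⟦ q ⟧} {⟦ Real.√ q ⟧} {⟦ Real.√ N ⟧} {norm (toPair z)} {⟦ c ⟧}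
      (⟦⟧-nonNeg {q} q≥0) (⟦⟧-nonNeg {Real.√ q} (RealOrder.nonNeg-√ q)) (⟦⟧-nonNeg {Real.√ N} (RealOrder.nonNeg-√ N))
      (⟦⟧-nonNeg {c} (RealOrder.nonNeg-fromℚ (ℚₚ.nonNegative⁻¹ (+ 2 / 3))))
      (R.nonNeg-resp-≈ (R.trans (⟦⟧-minus Real.1# c) (R.+-congʳ ⟦⟧-1))
          (⟦⟧-nonNeg {Real.1# Real.- c} (RealOrder.nonNeg-fromℚ (ℚₚ.nonNegative⁻¹ (+ 1 / 3)))))
      (R.trans (R.*-congˡ (⟦⟧-fromℚ 1/[1+ n ])) (R.trans (R.sym (fromℚ.*-homo (+ suc n / 1) 1/[1+ n ]))
        (R.trans (fromℚ.⟦⟧-cong ([1+d]*1/[1+d] n)) fromℚ.1#-homo)))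
      (R.nonNeg-resp-≈ (R.trans (⟦⟧-minus q (Real.√ q Real.* Real.√ q)) (R.+-congˡ (R.-‿cong (⟦⟧-* (Real.√ q) (Real.√ q)))))
        (⟦⟧-nonNeg {q Real.- Real.√ q Real.* Real.√ q} (RealOrder.√-lower {q} q≥0)))
      (R.nonNeg-resp-≈ (R.trans (⟦⟧-minus (Real.√ N Real.* Real.√ N) N) (R.+-cong (⟦⟧-* (Real.√ N) (Real.√ N))
          (R.-‿cong (R.trans (⟦⟧-+ (a Real.* a) (b Real.* b)) (R.+-cong (⟦⟧-* a a) (⟦⟧-* b b))))))
        (⟦⟧-nonNeg {Real.√ N Real.* Real.√ N Real.- N} (RealOrder.√-upper N)))
      h))
    where
    a = Defs.re z
    b = Defs.im z
    c q N : ℝ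
    c = Real.fromℚ (+ 2 / 3)
    q = Real.fromℚ 1/[1+ n ]
    N = a Real.* a Real.+ b Real.* b
    q≥0 : NonNegative q
    q≥0 = RealOrder.nonNeg-fromℚ (ℚₚ.<⇒≤ (Real.ℚ-√-Lemmas.0<1/[1+_] n))

  0≤∣z∣ : ∀ z → Real.fromℚ (+ 2 / 3) Real.* Real.0# Real.≤ Complex.∣ z ∣
  0≤∣z∣ z = ≤-⟦⟧ {c Real.* Real.0#} {Real.√ N} (R.nonNeg-resp-≈
    (R.trans (R.sym (R.+-identityʳ _)) (R.+-congˡ (R.trans (R.sym -0#≈0#)
        (R.-‿cong (R.sym (R.trans (⟦⟧-* c Real.0#) (R.trans (R.*-congˡ ⟦⟧-0) (R.zeroʳ _))))))))
    (⟦⟧-nonNeg {Real.√ N} (RealOrder.nonNeg-√ N)))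
    where
    open RingProperties R.ring using (-0#≈0#)
    c N : ℝ
    c = Real.fromℚ (+ 2 / 3)
    N = Defs.re z Real.* Defs.re z Real.+ Defs.im z Real.* Defs.im z

Complex-trans : ∀ {x y z} → x Complex.≈ y → y Complex.≈ z → x Complex.≈ z
Complex-trans {x} {y} {z} (p , q) (p′ , q′) =
  RealEquality.≈-trans {Defs.re x} {Defs.re y} {Defs.re z} p p′ , RealEquality.≈-trans {Defs.im x} {Defs.im y} {Defs.im z} q q′

precompose : ∀ {n} {K : NumberField n} → Embedding K → ∀ {τ} → NumberFieldProperties.Endomorphism K τ → Embedding K
precompose ψ {τ} τ-hom = record
  { map = Embedding.map ψ ∘ τ
  ; isRingHomomorphism = Composition.isRingHomomorphism (λ {x} {y} {z} → Complex-trans {x} {y} {z}) τ-hom (Embedding.isRingHomomorphism ψ)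
  }

-- The CM triple inside the model, and the conclusion.

module CMTypes (M : RealModel) {K : CMField 4} (Φ : CMType K) (galois : CMField.IsGalois K) where
  open RealModel M using (orderedRing)
  open Model M
  open HermitianIdentities R.commutativeRing
  open Gaussian R.commutativeRing
  open CMField K using (numberField; Carrier)
  open NumberFieldProperties numberField using (Endomorphism)
  open CMType Φ
  open GaloisGroup orderedRing numberField using (IsEmbedding; conjugate-embeddings; CMEmbeddings)

  embed : Fin 2 → Carrier → C.Carrier
  embed j x = toPair (j $ x)

  embed-hom : ∀ j → IsEmbedding (embed j)
  embed-hom j = _∘ʰ_ {C = gaussianRing} toPair-isRingHomomorphism (Embedding.isRingHomomorphism (φ j))

  embed-covers : ∀ {τ} → Endomorphism τ → ∃[ c ] (∀ x → embed 0F (τ x) C.≈ conjugate-embeddings (embed 0F) (embed 1F) c x)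
  embed-covers {τ} τ-hom = cases (covers (precompose (φ 0F) τ-hom))
    where
    cases : ∃[ j ] ((∀ x → 0F $ (τ x) Complex.≈ j $ x) ⊎ (∀ x → 0F $ (τ x) Complex.≈ Complex.conj (j $ x))) →
      ∃[ c ] (∀ x → embed 0F (τ x) C.≈ conjugate-embeddings (embed 0F) (embed 1F) c x)
    cases (0F , inj₁ h) = 0F , λ x → toPair-cong {0F $ (τ x)} {0F $ x} (h x)
    cases (1F , inj₁ h) = 1F , λ x → toPair-cong {0F $ (τ x)} {1F $ x} (h x)
    cases (0F , inj₂ h) = 2F , λ x → C.trans (toPair-cong {0F $ (τ x)} {Complex.conj (0F $ x)} (h x)) (toPair-conj (0F $ x))
    cases (1F , inj₂ h) = 3F , λ x → C.trans (toPair-cong {0F $ (τ x)} {Complex.conj (1F $ x)} (h x)) (toPair-conj (1F $ x))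

  private
    apart : ¬ (∀ x → embed 0F x C.≈ embed 1F x)
    apart h = distinct λ x → toPair-reflects {0F $ x} {1F $ x} (h x)

    apart-conj : ∀ i j → ¬ (∀ x → embed i x C.≈ conj (embed j x))
    apart-conj i j h = disjoint i j λ x → toPair-reflects {i $ x} {Complex.conj (j $ x)} (C.trans (h x) (C.sym (toPair-conj (j $ x))))

  embed-distinct : ∀ c d → c ≢ d → ¬ (∀ x → conjugate-embeddings (embed 0F) (embed 1F) c x C.≈ conjugate-embeddings (embed 0F) (embed 1F) d x)
  embed-distinct 0F 0F c≢d h = c≢d ≡.refl
  embed-distinct 0F 1F _   h = apart h
  embed-distinct 0F 2F _   h = apart-conj 0F 0F h
  embed-distinct 0F 3F _   h = apart-conj 0F 1F h
  embed-distinct 1F 0F _   h = apart λ x → C.sym (h x)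
  embed-distinct 1F 1F c≢d h = c≢d ≡.refl
  embed-distinct 1F 2F _   h = apart-conj 1F 0F h
  embed-distinct 1F 3F _   h = apart-conj 1F 1F h
  embed-distinct 2F 0F _   h = apart-conj 0F 0F λ x → C.sym (h x)
  embed-distinct 2F 1F _   h = apart-conj 1F 0F λ x → C.sym (h x)
  embed-distinct 2F 2F c≢d h = c≢d ≡.refl
  embed-distinct 2F 3F _   h = apart λ x → conj-injective (h x)
  embed-distinct 3F 0F _   h = apart-conj 0F 1F λ x → C.sym (h x)
  embed-distinct 3F 1F _   h = apart-conj 1F 1F λ x → C.sym (h x)
  embed-distinct 3F 2F _   h = apart λ x → C.sym (conj-injective (h x))
  embed-distinct 3F 3F c≢d h = c≢d ≡.refl

  embed-bar : ∀ {τ} → Endomorphism τ → ∀ x → embed 0F (τ (CMField.bar K x)) C.≈ conj (embed 0F (τ x))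
  embed-bar {τ} τ-hom x = C.trans
    (toPair-cong {0F $ τ (CMField.bar K x)} {Complex.conj (0F $ τ x)} (CMField.bar-conj K (precompose (φ 0F) τ-hom) x))
    (toPair-conj (0F $ τ x))

  embeddings : CMEmbeddings
  embeddings = record
    { φ₀-hom = embed-hom 0F ; φ₁-hom = embed-hom 1F ; covers = embed-covers ; distinct = embed-distinct
    ; bar-conj = embed-bar ; galois = galois }

module Transfer (M : RealModel) {K : CMField 4} (galois : CMField.IsGalois K) (T : CMTriple K)
  (Z : Sym₂ℂ) (Z∈F : InFundamentalDomain Z) (e : Vector (CMField.Carrier K) 4) (e-basis : CMTriple.IsSymplecticBasis T e)
  (row₁ : ∀ j → CMTriple.Φ T (e 2F) j Complex.≈ Sym₂ℂ.z₁ Z Complex.* CMTriple.Φ T (e 0F) j Complex.+ Sym₂ℂ.z₁₂ Z Complex.* CMTriple.Φ T (e 1F) j)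
  (row₂ : ∀ j → CMTriple.Φ T (e 3F) j Complex.≈ Sym₂ℂ.z₁₂ Z Complex.* CMTriple.Φ T (e 0F) j Complex.+ Sym₂ℂ.z₂ Z Complex.* CMTriple.Φ T (e 1F) j) where
  open RealModel M using (orderedRing; ⟦_⟧; ⟦⟧-fromℚ)
  open Model M
  open HermitianIdentities R.commutativeRing
  open Gaussian R.commutativeRing
  open CMField K using (numberField; Carrier)
  open CMTriple T
  open Sym₂ℂ Z
  open CMTypes M cmType galois

  private
    row : ∀ {x} z u w v → x Complex.≈ z Complex.* u Complex.+ w Complex.* v → toPair x C.≈ toPair z C.* toPair u C.+ toPair w C.* toPair v
    row {x} = Homomorphism.combination-homo ℂ-rawRing gaussianRing toPair-isRingHomomorphism {x}

    positive : ∀ {x} → Real.0# Real.< x → R.NonNeg ⟦ x ⟧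
    positive {x} 0<x = R.nonNeg-resp-≈ (R.trans (R.+-congˡ (R.-‿cong ⟦⟧-0)) (R.trans (R.+-congˡ -0#≈0#) (R.+-identityʳ _))) (⟦⟧-< {Real.0#} {x} 0<x)
      where open RingProperties R.ring using (-0#≈0#)

  reducedTriple : Main.ReducedTriple orderedRing numberField
  reducedTriple = record
    { Φ = embeddings
    ; I = ideal
    ; ξ = ξ
    ; ξ-imaginary = λ τ-hom → R.trans (⟦⟧-cong {_} {Real.0#} (ξ-imaginary (precompose (φ 0F) τ-hom))) ⟦⟧-0
    ; ξ-positive₀ = positive {Defs.im (0F $ ξ)} (ξ-positive 0F)
    ; ξ-positive₁ = positive {Defs.im (1F $ ξ)} (ξ-positive 1F)
    ; e = e
    ; e-basis = proj₁ e-basis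
    ; e-symplectic = λ i j → R.trans
        (≈-re (HermitianForm.form-homo ℂ-rawRing R.commutativeRing Complex.conj toPair-isRingHomomorphism toPair-conj
          (λ k → k $ ξ) (Φ (e i)) (Φ (e j)) {Complex.fromℤ (J i j)} (proj₂ e-basis i j)))
        (⟦⟧-fromℚ (J i j / 1))
    ; z₁ = toPair z₁
    ; z₁₂ = toPair z₁₂
    ; z₂ = toPair z₂
    ; row₁₀ = row z₁ (0F $ e 0F) z₁₂ (0F $ e 1F) (row₁ 0F)
    ; row₁₁ = row z₁ (1F $ e 0F) z₁₂ (1F $ e 1F) (row₁ 1F)
    ; row₂₀ = row z₁₂ (0F $ e 0F) z₂ (0F $ e 1F) (row₂ 0F)
    ; row₂₁ = row z₁₂ (1F $ e 0F) z₂ (1F $ e 1F) (row₂ 1F)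
    ; x₁-bound = x₁-bound Z Z∈F
    ; x₁₂-bound = x₁₂-bound Z Z∈F
    ; y₁₂≥0 = y₁₂-bound Z Z∈F
    ; 2y₁₂≤y₁ = y₁-bound Z Z∈F
    ; y₁≤y₂ = y₂-bound Z Z∈F
    ; ∣z₁∣≥1 = ∣z₁∣-bound Z Z∈F
    }

  module Result = Main.Theorem orderedRing numberField reducedTriple

  theorem : IsPrimitive K cmType ⊎ ¬ (z₁₂ Complex.≈ Complex.0#) → ∀ ω → (∀ i → CMField.IsInteger K (ω i)) →
    ∀ Δ → LinearAlgebra.det ℚ.+-*-rawRing (λ i j → CMField.Tr K (CMField._*_ K (ω i) (ω j))) ≡ Δ / 1 →
    Real.fromℚ (+ 2 / 3) Real.* (∣ Δ ∣ ^-½) Real.≤ Complex.∣ z₁₂ ∣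
  theorem hyp ω ω-integer Δ disc = bound Δ disc
    where
    imprimitive : toPair z₁₂ C.≈ C.0# → ¬ IsPrimitive K cmType
    imprimitive z₁₂≈0 isPrimitive = contradict (Result.z₁₂≈0⇒imprimitive z₁₂≈0)
      where
      contradict : ¬ (∃[ r ] Σ (0ℚ ℚ.< r) λ 0<r →
        Σ (FieldHom (ImaginaryQuadraticField.field′ r 0<r) numberField) λ h → ∀ x → embed 0F (FieldHom.map h x) C.≈ embed 1F (FieldHom.map h x))
      contradict (r , 0<r , h , agree) = isPrimitive (ImaginaryQuadraticField.field′ r 0<r ,
        (λ ψ im≈0 → ImaginaryQuadraticField.imaginary r 0<r orderedRing
          (_∘ʰ_ {C = gaussianRing} toPair-isRingHomomorphism (Embedding.isRingHomomorphism ψ))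
          (R.trans (⟦⟧-cong {_} {Real.0#} (im≈0 (ImaginaryQuadraticField.√-r r 0<r))) ⟦⟧-0)) ,
        h , λ x → toPair-reflects {0F $ FieldHom.map h x} {1F $ FieldHom.map h x} (agree x))

    z₁₂≉0 : ¬ (toPair z₁₂ C.≈ C.0#)
    z₁₂≉0 z₁₂≈0 = [ imprimitive z₁₂≈0 , (λ z₁₂≉0 → z₁₂≉0 (toPair-reflects {z₁₂} {Complex.0#} (C.trans z₁₂≈0 (C.sym toPair-0)))) ]′ hyp

    bound : ∀ Δ → LinearAlgebra.det ℚ.+-*-rawRing (λ i j → CMField.Tr K (CMField._*_ K (ω i) (ω j))) ≡ Δ / 1 →
      Real.fromℚ (+ 2 / 3) Real.* (∣ Δ ∣ ^-½) Real.≤ Complex.∣ z₁₂ ∣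
    -- At 0 the function `_^-½` has the dummy value 0, so the bound is trivial; in the other two
    -- cases Δ is visibly nonzero, as `main-bound` asks.
    bound (+ zero)  _    = 0≤∣z∣ z₁₂
    bound (+ suc n) disc = ∣z∣-bound z₁₂ n (Result.main-bound {ω} {+ suc n} ω-integer disc (λ ()) z₁₂≉0)
    bound -[1+ n ]  disc = ∣z∣-bound z₁₂ n (Result.main-bound {ω} { -[1+ n ]} ω-integer disc (λ ()) z₁₂≉0)

proposition3p3 : (F : NumberField 2) → TotallyReal F →
    (K : CMField 4) → CMField.IsGalois K →
    FieldHom F (CMField.numberField K) →
    (Δ : ℤ) → CMField.IsDiscriminant K Δ →
    (T : CMTriple K) →
    (Z : Sym₂ℂ) → CMTriple.IsReducedMatrix T Z →
    IsPrimitive K (CMTriple.cmType T) ⊎ ¬ (Sym₂ℂ.z₁₂ Z Complex.≈ Complex.0#) →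
    Real.fromℚ (+ 2 / 3) Real.* (∣ Δ ∣ ^-½) Real.≤ Complex.∣ Sym₂ℂ.z₁₂ Z ∣
proposition3p3 _ _ K galois _ Δ (ω , (ω-integer , _) , disc) T Z (Z∈F , e , e-basis , row₁ , row₂) hyp =
  Transfer.theorem ℝ-model galois T Z Z∈F e e-basis row₁ row₂ hyp ω ω-integer Δ disc
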